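{- Let $K$ be a field of characteristic $0$ with henselian valuation ring $A$, valuation $v$ and residue field $k$ of characteristic $p>0$, and assume $K$ contains a primitive $p$-th root of unity $\zeta$. Let $L=K(\alpha)$ be a non-trivial Kummer extension with $\alpha^p=h\in K^\times$, let $B$ be the integral closure of $A$ in $L$, let $\sigma$ be the generator of $\mathrm{Gal}(L|K)$ with $\sigma(\alpha)=\zeta\alpha$, and let $N=N_{L|K}$ be the norm. Put $\mathfrak{z}=\zeta-1$. Then $$\mathcal{H}=\mathcal{N}_\sigma$$ as ideals of $A$, where $\mathcal{H}$ and $\mathcal{N}_\sigma$ are defined below.
   Context: $B$ is a valuation ring (since $A$ is henselian). Let $\mathfrak{A}$ be the set of $h\in K$ such that the solutions of $X^p=h$ generate $L$ over $K$. Define the ideal $\mathcal{J}_\sigma$ of $B$ generated by $\{\sigma(b)/b-1 : b\in L^\times\}$, the ideal $\mathcal{H}$ of $A$ generated by $\{\mathfrak{z}^p/(h-1): h\in\mathfrak{A}\}$, and the ideal $\mathcal{N}_\sigma$ of $A$ generated by $N(\mathcal{J}_\sigma)$. -}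

module Defs where

open import Level using (_⊔_) renaming (suc to lsuc)
open import Algebra.Bundles using (CommutativeRing)
open import Algebra.Bundles.Raw using (RawRing)
open import Algebra.Morphism.Structures using (module RingMorphisms)
import Algebra.Definitions.RawSemiring as Powers
open import Data.Fin.Base using (Fin)
open import Data.List.Base using (List; []; _∷_; map)
open import Data.Nat.Base as ℕ using (ℕ; zero; suc)
open import Data.Nat.Divisibility using (_∣_)
open import Data.Product.Base using (Σ; ∃; ∃₂; _×_; _,_; proj₁; proj₂)
open import Data.Sum.Base using (_⊎_)
open import Function.Bundles using (_⇔_; Bijection)
open import Relation.Binary.Bundles using (Setoid)
import Relation.Binary.PropositionalEquality.Properties as ≡
open import Relation.Nullary.Negation using (¬_)
open import Relation.Unary using (Pred; _∈_)

-- R has characteristic n when the kernel of ℤ → R is nℤ; note that 0 ∣ m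
-- means m ≡ 0, so n = 0 is covered.
HasCharacteristic : ∀ {c ℓ} → RawRing c ℓ → ℕ → Set ℓ
HasCharacteristic R n = ∀ m → (m ×ᴿ 1# ≈ 0#) ⇔ (n ∣ m)
  where
  open RawRing R
  open Powers rawSemiring using () renaming (_×_ to _×ᴿ_)

-- Polynomials are lists of coefficients, constant term first.  Trailing
-- zeros are allowed, so polynomials are compared with _≈ᴾ_.
module Polynomials {c ℓ} (R : RawRing c ℓ) where
  open RawRing R

  Poly : Set c
  Poly = List Carrier

  coeff : Poly → ℕ → Carrier
  coeff []      n       = 0#
  coeff (a ∷ f) zero    = a
  coeff (a ∷ f) (suc n) = coeff f n

  infix 4 _≈ᴾ_
  _≈ᴾ_ : Poly → Poly → Set ℓ
  f ≈ᴾ g = ∀ n → coeff f n ≈ coeff g n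

  infixl 6 _+ᴾ_
  _+ᴾ_ : Poly → Poly → Poly
  []      +ᴾ g       = g
  (a ∷ f) +ᴾ []      = a ∷ f
  (a ∷ f) +ᴾ (b ∷ g) = (a + b) ∷ (f +ᴾ g)

  infixl 7 _*ᴾ_
  _*ᴾ_ : Poly → Poly → Poly
  []      *ᴾ g = []
  (a ∷ f) *ᴾ g = map (a *_) g +ᴾ (0# ∷ (f *ᴾ g))

  eval : Poly → Carrier → Carrier
  eval []      x = 0#
  eval (a ∷ f) x = a + x * eval f x

  Monic : Poly → Set ℓ
  Monic f = ∃ λ n → (coeff f n ≈ 1#) × (∀ m → n ℕ.< m → coeff f m ≈ 0#)

  Coprime : Poly → Poly → Set (c ⊔ ℓ)
  Coprime f g = ∃₂ λ u v → (u *ᴾ f) +ᴾ (v *ᴾ g) ≈ᴾ (1# ∷ [])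

record Field c ℓ : Set (lsuc (c ⊔ ℓ)) where
  field
    commutativeRing : CommutativeRing c ℓ

  open CommutativeRing commutativeRing public
  open RawRing rawRing public using (rawSemiring)
  open Powers rawSemiring public using (_^_; sum; product)

  field
    1≉0     : 1# ≉ 0#
    inverse : ∀ {x} → x ≉ 0# → ∃ λ y → x * y ≈ 1#

module _ {c ℓ} (K : Field c ℓ) where
  open Field K

  IsPrimitiveRoot : ℕ → Carrier → Set ℓ
  IsPrimitiveRoot n ζ =
    (ζ ^ n ≈ 1#) × (∀ m → 0 ℕ.< m → m ℕ.< n → ¬ (ζ ^ m ≈ 1#))

  -- The R-submodule of K generated by S, for a subring R of K.  When S ⊆ R
  -- it is the ideal of R generated by S.
  Span : ∀ {r s} → Pred Carrier r → Pred Carrier s → Pred Carrier (c ⊔ ℓ ⊔ r ⊔ s)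
  Span R S x = ∃ λ n → Σ (Fin n → Carrier) λ a → Σ (Fin n → Carrier) λ s →
    (∀ i → a i ∈ R) × (∀ i → s i ∈ S) × (x ≈ sum (λ i → a i * s i))

-- A valuation ring with fraction field K: for every x ∈ K^×, x or x⁻¹ lies
-- in A.
record ValuationRing {c ℓ} (K : Field c ℓ) a : Set (c ⊔ ℓ ⊔ lsuc a) where
  open Field K
  field
    A       : Pred Carrier a
    resp    : ∀ {x y} → x ≈ y → x ∈ A → y ∈ A
    0∈A     : 0# ∈ A
    1∈A     : 1# ∈ A
    +-closed : ∀ {x y} → x ∈ A → y ∈ A → (x + y) ∈ A
    *-closed : ∀ {x y} → x ∈ A → y ∈ A → (x * y) ∈ A
    neg-closed : ∀ {x} → x ∈ A → (- x) ∈ A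
    total   : ∀ {x y} → x * y ≈ 1# → x ∈ A ⊎ y ∈ A

  rawRingᴬ : RawRing (c ⊔ a) ℓ
  rawRingᴬ = record
    { Carrier = ∃ A
    ; _≈_     = λ x y → proj₁ x ≈ proj₁ y
    ; _+_     = λ x y → proj₁ x + proj₁ y , +-closed (proj₂ x) (proj₂ y)
    ; _*_     = λ x y → proj₁ x * proj₁ y , *-closed (proj₂ x) (proj₂ y)
    ; -_      = λ x → - proj₁ x , neg-closed (proj₂ x)
    ; 0#      = 0# , 0∈A
    ; 1#      = 1# , 1∈A
    }

  𝔪 : Pred (∃ A) (c ⊔ ℓ ⊔ a)
  𝔪 (x , _) = ¬ (∃ λ y → y ∈ A × x * y ≈ 1#)

  -- k = A / 𝔪 as a setoid quotient: the same elements as A, compared modulo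
  -- 𝔪.  The residue map A → k is therefore the identity on carriers.
  residueField : RawRing (c ⊔ a) (c ⊔ ℓ ⊔ a)
  residueField = record
    { Carrier = ∃ A
    ; _≈_     = λ x y → 𝔪 (x +ᴬ (-ᴬ y))
    ; _+_     = _+ᴬ_
    ; _*_     = _*ᴬ_
    ; -_      = -ᴬ_
    ; 0#      = 0ᴬ
    ; 1#      = 1ᴬ
    }
    where
    open RawRing rawRingᴬ using ()
      renaming (_+_ to _+ᴬ_; _*_ to _*ᴬ_; -_ to -ᴬ_; 0# to 0ᴬ; 1# to 1ᴬ)

  private
    module A[X] = Polynomials rawRingᴬ
    module k[X] = Polynomials residueField

  -- Hensel's lemma: a factorisation of the reduction of a monic polynomial
  -- into coprime monic factors over k lifts to a monic factorisation over A.
  Henselian : Set (c ⊔ ℓ ⊔ a)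
  Henselian = ∀ (f : A[X].Poly) (g₀ h₀ : k[X].Poly) →
    A[X].Monic f → k[X].Monic g₀ → k[X].Monic h₀ →
    f k[X].≈ᴾ g₀ k[X].*ᴾ h₀ → k[X].Coprime g₀ h₀ →
    ∃₂ λ (g h : A[X].Poly) →
      A[X].Monic g × A[X].Monic h × (f A[X].≈ᴾ g A[X].*ᴾ h) ×
      (g k[X].≈ᴾ g₀) × (h k[X].≈ᴾ h₀)

record FieldExtension {c ℓ} (K : Field c ℓ) c′ ℓ′ : Set (c ⊔ ℓ ⊔ lsuc (c′ ⊔ ℓ′)) where
  private
    module K = Field K
  field
    L : Field c′ ℓ′
  open Field L
  open RingMorphisms K.rawRing rawRing using (IsRingHomomorphism)
  field
    ι                    : K.Carrier → Carrier
    ι-isRingHomomorphism : IsRingHomomorphism ι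

  NonTrivial : Set (c ⊔ c′ ⊔ ℓ′)
  NonTrivial = ¬ (∀ x → ∃ λ a → ι a ≈ x)

  -- K⟨ S ⟩ is K(S), the subfield of L generated by ι(K) and S.
  data K⟨_⟩ {s} (S : Pred Carrier s) : Pred Carrier (c ⊔ c′ ⊔ ℓ′ ⊔ s) where
    base : ∀ a → K⟨ S ⟩ (ι a)
    gen  : ∀ {x} → x ∈ S → K⟨ S ⟩ x
    resp : ∀ {x y} → x ≈ y → K⟨ S ⟩ x → K⟨ S ⟩ y
    add  : ∀ {x y} → K⟨ S ⟩ x → K⟨ S ⟩ y → K⟨ S ⟩ (x + y)
    mul  : ∀ {x y} → K⟨ S ⟩ x → K⟨ S ⟩ y → K⟨ S ⟩ (x * y)
    neg  : ∀ {x} → K⟨ S ⟩ x → K⟨ S ⟩ (- x)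
    inv  : ∀ {x y} → x * y ≈ 1# → K⟨ S ⟩ x → K⟨ S ⟩ y

  Generates : ∀ {s} → Pred Carrier s → Set (c ⊔ c′ ⊔ ℓ′ ⊔ s)
  Generates S = ∀ x → x ∈ K⟨ S ⟩

  record Automorphism : Set (c ⊔ c′ ⊔ ℓ′) where
    open RingMorphisms rawRing rawRing using (IsRingIsomorphism)
    field
      ⟦_⟧               : Carrier → Carrier
      isRingIsomorphism : IsRingIsomorphism ⟦_⟧
      fixes-K           : ∀ a → ⟦ ι a ⟧ ≈ ι a

  open Automorphism public using (⟦_⟧)

  Gal : Setoid (c ⊔ c′ ⊔ ℓ′) (c′ ⊔ ℓ′)
  Gal = record
    { Carrier       = Automorphism
    ; _≈_           = λ τ υ → ∀ x → ⟦ τ ⟧ x ≈ ⟦ υ ⟧ x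
    ; isEquivalence = record
      { refl  = λ x → refl
      ; sym   = λ τ≈υ x → sym (τ≈υ x)
      ; trans = λ τ≈υ υ≈φ x → trans (τ≈υ x) (υ≈φ x)
      }
    }

  -- N_{L|K}(x) = y for a finite Galois extension L|K: y is the product of
  -- τ(x) over τ ∈ Gal(L|K), taken along an enumeration of the group without
  -- repetition.
  Norm : Carrier → K.Carrier → Set (c ⊔ c′ ⊔ ℓ′)
  Norm x y = ∃ λ n → Σ (Bijection (≡.setoid (Fin n)) Gal) λ e →
    ι y ≈ product (λ i → ⟦ Bijection.to e i ⟧ x)

module Ideals {c ℓ a c′ ℓ′} {K : Field c ℓ} (V : ValuationRing K a)
              (E : FieldExtension K c′ ℓ′) where
  open ValuationRing V using (A; rawRingᴬ)
  open FieldExtension E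
  private
    module K = Field K
    module L = Field L
    module A[X] = Polynomials rawRingᴬ
    module L[X] = Polynomials L.rawRing

  -- The integral closure of A in L.
  B : Pred L.Carrier (c ⊔ ℓ ⊔ a ⊔ ℓ′)
  B x = ∃ λ (f : A[X].Poly) → A[X].Monic f ×
    (L[X].eval (map (λ t → ι (proj₁ t)) f) x L.≈ L.0#)

  -- The roots are taken in L: as K will contain the p-th roots of unity,
  -- either all roots of X^p = h lie in L or none does, and in the latter
  -- case they do not generate L.
  𝔄 : ℕ → Pred K.Carrier (c ⊔ c′ ⊔ ℓ′)
  𝔄 p h = Generates (λ x → x L.^ p L.≈ ι h)

  𝓙 : Automorphism → Pred L.Carrier (c ⊔ ℓ ⊔ a ⊔ c′ ⊔ ℓ′)
  𝓙 σ = Span L B λ x → ∃₂ λ b b⁻¹ →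
    (b L.* b⁻¹ L.≈ L.1#) × (x L.≈ ⟦ σ ⟧ b L.* b⁻¹ L.- L.1#)

  𝓗 : ℕ → K.Carrier → Pred K.Carrier (c ⊔ ℓ ⊔ a ⊔ c′ ⊔ ℓ′)
  𝓗 p ζ = Span K A λ x → ∃₂ λ h d → h ∈ 𝔄 p ×
    ((h K.- K.1#) K.* d K.≈ K.1#) × (x K.≈ (ζ K.- K.1#) K.^ p K.* d)

  𝓝 : Automorphism → Pred K.Carrier (c ⊔ ℓ ⊔ a ⊔ c′ ⊔ ℓ′)
  𝓝 σ = Span K A λ y → ∃ λ x → x ∈ 𝓙 σ × Norm x y

-- By Hensel's lemma the integral closure B of A in L is local, and hence a
-- valuation ring; it is stable under σ.  Write w for its valuation, Δ = 1 - σ,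
-- z = 1 - ζ.  Since N(1 - β) = 1 - βᵖ for an eigenvector σ(β) = ζ β, the
-- quotient z / (1 - β) has norm zᵖ / (1 - βᵖ), up to sign a generator of 𝓗; and
-- it is, up to a unit, σ(b) / b - 1 for b = (1 - β) / β.  This gives 𝓗 ⊆ 𝓝.
--
-- For 𝓝 ⊆ 𝓗 every b ≠ 0 needs a β with w (z / (1 - β)) ≤ w (Δb / b).  Applying
-- 1 - ζᵏ σ for k = 0, 1, … to b gives finitely many nonzero elements; replace b
-- by one for which ε = Δb / b has minimal value.  If w (ε) ≤ w (z), it is tame:
-- w (Δᵐ b) ≥ w (εᵐ b) for all m, and so are its powers.  Expanding
-- ∏ (X - σˡ b) over 0 < l < p yields k with w (Tr bᵏ) ≤ w (εᵖ⁻¹ bᵏ).  For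
-- q = ∏ (1 - ζⁱ σ) bᵏ over 0 < i < p - 1 tameness gives w (q) ≥ w (εᵖ⁻² bᵏ), while
-- q - ζ⁻¹ σ(q) = Tr bᵏ; hence β = 1 - (1 - ζ⁻¹) q / Tr bᵏ is an eigenvector with
-- w (1 - β) ≥ w (z / ε).
module Submission where

open import Defs
open import Algebra.Bundles using (CommutativeMonoid; CommutativeRing)
open import Algebra.Bundles.Raw using (RawRing)
import Algebra.Definitions.RawSemiring as RawSemiringDefinitions
import Algebra.Morphism.Construct.Composition as Composition
import Algebra.Morphism.Construct.Identity as Identity
open import Algebra.Morphism.Structures using (module RingMorphisms)
open import Axiom.ExcludedMiddle using (ExcludedMiddle)
open import Data.Empty using (⊥-elim)
open import Data.Fin.Base as Fin using (Fin; toℕ; fromℕ<)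
open import Data.Fin.Permutation using (Permutation; permutation)
import Data.Fin.Properties as Fin
open import Data.List.Base using (List; []; _∷_; _++_; map; length; drop)
open import Data.List.Membership.Propositional using () renaming (_∈_ to _∈ᴸ_)
open import Data.List.Relation.Unary.All as All using (All; []; _∷_)
import Data.List.Relation.Unary.All.Properties as All
open import Data.List.Relation.Unary.Any using (here; there)
open import Data.Nat.Base as ℕ using (ℕ; zero; suc)
open import Data.Nat.Coprimality as Coprime using (coprime-Bézout; prime⇒coprime)
open import Data.Nat.Divisibility using (_∣_; divides; ∣-refl; 0∣⇒≡0; >⇒∤)
open import Data.Nat.DivMod using (_%_; _/_; m≡m%n+[m/n]*n; m%n<n)
open import Data.Nat.GCD using (module Bézout)
open import Data.Nat.Primality using (Prime; prime; Composite; composite; ¬prime[1]; prime⇒nonTrivial)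
import Data.Nat.Properties as ℕ
open import Data.Nat.Solver using (module +-*-Solver)
open import Data.Product.Base using (∃; ∃₂; _×_; _,_; proj₁; proj₂)
open import Data.Sum.Base using (_⊎_; inj₁; inj₂; [_,_]′)
open import Data.Unit.Base using (tt)
open import Function.Base using (case_of_)
open import Function.Bundles using (Bijection; module Equivalence)
open import Level using (Level; _⊔_)
open import Relation.Binary.Definitions using (tri<; tri≈; tri>)
open import Relation.Binary.PropositionalEquality.Core as ≡ using (_≡_)
import Relation.Binary.PropositionalEquality.Properties as ≡
open import Relation.Nullary.Decidable.Core using (yes; no)
open import Relation.Nullary.Negation using (¬_; contradiction)
open import Relation.Unary using (Pred; _∈_; _⊆_; _≐_; U)

-- The value group is arbitrary and no hypothesis excludes defect, so the values of `Δb / b` need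
-- not attain a minimum on `L`, and no uniformiser or residue generator is at hand to normalise `b`.
-- A minimum is therefore only ever taken over a finite list. The list comes from the eigenspaces of
-- `σ`: `1 - ζᵏ σ` multiplies the `ζⁱ`-component of `b` by `1 - ζᵏ⁺ⁱ`, so `p` consecutive operators
-- annihilate everything. Moreover `1 - ζᵏ σ = (1 - ζᵏ) + ζᵏ Δ`; while `w (ε) ≤ w (z)`, these
-- operators and `Δ` can be traded for each other, and minimality along the list controls all powers
-- of `Δ`. The trace estimate is in the spirit of Euler's formula: `∏ (b - σˡ b)` is the derivative
-- at `b` of the characteristic polynomial of `b`, and traces of powers of `b` bound it. Elements of
-- `𝓙 σ` are sums, and norms are not additive. What is carried through sums is therefore the
-- existence of an eigenvector `β` near 1; norms are taken only at the end.

-- Ring identities with integer coefficients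

module IntegerCoefficients {c ℓ : Level} (R : CommutativeRing c ℓ) where
  open CommutativeRing R
  open import Algebra.Properties.Ring ring
    using (-‿distribˡ-*; -‿distribʳ-*; -0#≈0#; -‿involutive)
  open import Algebra.Properties.AbelianGroup +-abelianGroup using (⁻¹-∙-comm)
  open import Algebra.Properties.Semiring.Mult.TCOptimised semiring
    using (×-homo-+; ×1-homo-*; 1+×) renaming (_×_ to _×ᴿ_)
  open import Algebra.Solver.CommutativeMonoid +-commutativeMonoid
    using (solve; _⊕_; _⊜_)
  open import Algebra.Solver.Ring.AlmostCommutativeRing
    using (fromCommutativeRing; _-Raw-AlmostCommutative⟶_)
  open import Data.Integer.Base as ℤ using (ℤ; -[1+_])
  import Data.Integer.Properties as ℤ
  open import Data.Maybe.Base using (Maybe; just; nothing)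
  import Data.Sign.Base as Sign
  open import Relation.Binary.Reasoning.Setoid setoid

  ⟦_⟧ℤ : ℤ → Carrier
  ⟦ ℤ.+ n ⟧ℤ    = n ×ᴿ 1#
  ⟦ -[1+ n ] ⟧ℤ = - (suc n ×ᴿ 1#)

  ⟦⟧ℤ-⊖ : ∀ m n → ⟦ m ℤ.⊖ n ⟧ℤ ≈ m ×ᴿ 1# + - (n ×ᴿ 1#)
  ⟦⟧ℤ-⊖ m       zero    = sym (trans (+-congˡ -0#≈0#) (+-identityʳ _))
  ⟦⟧ℤ-⊖ zero    (suc n) = sym (+-identityˡ _)
  ⟦⟧ℤ-⊖ (suc m) (suc n) = begin
    ⟦ suc m ℤ.⊖ suc n ⟧ℤ                   ≡⟨ ≡.cong ⟦_⟧ℤ (ℤ.[1+m]⊖[1+n]≡m⊖n m n) ⟩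
    ⟦ m ℤ.⊖ n ⟧ℤ                           ≈⟨ ⟦⟧ℤ-⊖ m n ⟩
    m ×ᴿ 1# + - (n ×ᴿ 1#)                    ≈⟨ +-identityˡ _ ⟨
    0# + (m ×ᴿ 1# + - (n ×ᴿ 1#))             ≈⟨ +-congʳ (-‿inverseʳ 1#) ⟨
    (1# + - 1#) + (m ×ᴿ 1# + - (n ×ᴿ 1#))
      ≈⟨ solve 4 (λ a b x y → (a ⊕ b) ⊕ (x ⊕ y) ⊜ (a ⊕ x) ⊕ (b ⊕ y)) refl 1# (- 1#) _ _ ⟩
    (1# + m ×ᴿ 1#) + (- 1# + - (n ×ᴿ 1#))    ≈⟨ +-congˡ (⁻¹-∙-comm 1# (n ×ᴿ 1#)) ⟩
    (1# + m ×ᴿ 1#) + - (1# + n ×ᴿ 1#)        ≈⟨ +-cong (1+× m 1#) (-‿cong (1+× n 1#)) ⟨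
    suc m ×ᴿ 1# + - (suc n ×ᴿ 1#)            ∎

  ⟦⟧ℤ-+ : ∀ i j → ⟦ i ℤ.+ j ⟧ℤ ≈ ⟦ i ⟧ℤ + ⟦ j ⟧ℤ
  ⟦⟧ℤ-+ (ℤ.+ m)  (ℤ.+ n)  = ×-homo-+ 1# m n
  ⟦⟧ℤ-+ (ℤ.+ m)  -[1+ n ] = ⟦⟧ℤ-⊖ m (suc n)
  ⟦⟧ℤ-+ -[1+ m ] (ℤ.+ n)  = trans (⟦⟧ℤ-⊖ n (suc m)) (+-comm _ _)
  ⟦⟧ℤ-+ -[1+ m ] -[1+ n ] = begin
    - (suc (suc (m ℕ.+ n)) ×ᴿ 1#)         ≡⟨ ≡.cong (λ k → - (suc k ×ᴿ 1#)) (≡.sym (ℕ.+-suc m n)) ⟩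
    - ((suc m ℕ.+ suc n) ×ᴿ 1#)           ≈⟨ -‿cong (×-homo-+ 1# (suc m) (suc n)) ⟩
    - (suc m ×ᴿ 1# + suc n ×ᴿ 1#)          ≈⟨ ⁻¹-∙-comm _ _ ⟨
    - (suc m ×ᴿ 1#) + - (suc n ×ᴿ 1#)      ∎

  ⟦⟧ℤ-neg : ∀ i → ⟦ ℤ.- i ⟧ℤ ≈ - ⟦ i ⟧ℤ
  ⟦⟧ℤ-neg (ℤ.+ zero)  = sym -0#≈0#
  ⟦⟧ℤ-neg (ℤ.+ suc n) = refl
  ⟦⟧ℤ-neg -[1+ n ]    = sym (-‿involutive _)

  ⟦⟧ℤ-+* : ∀ m j → ⟦ ℤ.+ m ℤ.* j ⟧ℤ ≈ ⟦ ℤ.+ m ⟧ℤ * ⟦ j ⟧ℤ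
  ⟦⟧ℤ-+* m (ℤ.+ n)  = begin
    ⟦ Sign.+ ℤ.◃ (m ℕ.* n) ⟧ℤ ≡⟨ ≡.cong ⟦_⟧ℤ (ℤ.+◃n≡+n (m ℕ.* n)) ⟩
    (m ℕ.* n) ×ᴿ 1#           ≈⟨ ×1-homo-* m n ⟩
    m ×ᴿ 1# * n ×ᴿ 1#          ∎
  ⟦⟧ℤ-+* m -[1+ n ] = begin
    ⟦ Sign.- ℤ.◃ (m ℕ.* suc n) ⟧ℤ ≡⟨ ≡.cong ⟦_⟧ℤ (ℤ.-◃n≡-n (m ℕ.* suc n)) ⟩
    ⟦ ℤ.- ℤ.+ (m ℕ.* suc n) ⟧ℤ    ≈⟨ ⟦⟧ℤ-neg (ℤ.+ (m ℕ.* suc n)) ⟩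
    - ((m ℕ.* suc n) ×ᴿ 1#)       ≈⟨ -‿cong (×1-homo-* m (suc n)) ⟩
    - (m ×ᴿ 1# * suc n ×ᴿ 1#)      ≈⟨ -‿distribʳ-* _ _ ⟩
    m ×ᴿ 1# * - (suc n ×ᴿ 1#)      ∎

  ⟦⟧ℤ-* : ∀ i j → ⟦ i ℤ.* j ⟧ℤ ≈ ⟦ i ⟧ℤ * ⟦ j ⟧ℤ
  ⟦⟧ℤ-* (ℤ.+ m)  j = ⟦⟧ℤ-+* m j
  ⟦⟧ℤ-* -[1+ m ] j = begin
    ⟦ ℤ.- ℤ.+ suc m ℤ.* j ⟧ℤ   ≡⟨ ≡.cong ⟦_⟧ℤ (≡.sym (ℤ.neg-distribˡ-* (ℤ.+ suc m) j)) ⟩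
    ⟦ ℤ.- (ℤ.+ suc m ℤ.* j) ⟧ℤ ≈⟨ ⟦⟧ℤ-neg (ℤ.+ suc m ℤ.* j) ⟩
    - ⟦ ℤ.+ suc m ℤ.* j ⟧ℤ     ≈⟨ -‿cong (⟦⟧ℤ-+* (suc m) j) ⟩
    - (suc m ×ᴿ 1# * ⟦ j ⟧ℤ)    ≈⟨ -‿distribˡ-* _ _ ⟩
    - (suc m ×ᴿ 1#) * ⟦ j ⟧ℤ    ∎

  ⟦⟧ℤ-homomorphism : CommutativeRing.rawRing ℤ.+-*-commutativeRing
                      -Raw-AlmostCommutative⟶ fromCommutativeRing R
  ⟦⟧ℤ-homomorphism = record
    { ⟦_⟧    = ⟦_⟧ℤ
    ; +-homo = ⟦⟧ℤ-+
    ; *-homo = ⟦⟧ℤ-*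
    ; -‿homo = ⟦⟧ℤ-neg
    ; 0-homo = refl
    ; 1-homo = refl
    }

  -- Distinct integers may have equal images in `R`, so a failed comparison yields `nothing` and not
  -- a refutation.
  ⟦⟧ℤ-≟ : ∀ i j → Maybe (⟦ i ⟧ℤ ≈ ⟦ j ⟧ℤ)
  ⟦⟧ℤ-≟ i j with i ℤ.≟ j
  ... | yes i≡j = just (reflexive (≡.cong ⟦_⟧ℤ i≡j))
  ... | no  _   = nothing

module RingSolver {c ℓ : Level} (R : CommutativeRing c ℓ) where
  open import Algebra.Solver.Ring.AlmostCommutativeRing using (fromCommutativeRing)
  open import Data.Integer.Base using (+_)
  open import Data.Integer.Properties using (+-*-commutativeRing)
  open IntegerCoefficients R using (⟦⟧ℤ-homomorphism; ⟦⟧ℤ-≟)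
  open import Algebra.Solver.Ring
    (CommutativeRing.rawRing +-*-commutativeRing) (fromCommutativeRing R)
    ⟦⟧ℤ-homomorphism ⟦⟧ℤ-≟ public
    using (Polynomial; solve; _:=_; _:+_; _:*_; _:-_; :-_; con)

  :0 :1 : ∀ {n} → Polynomial n
  :0 = con (+ 0)
  :1 = con (+ 1)

-- Fields, subrings and linear combinations

module FieldProperties {c ℓ : Level} (F : Field c ℓ) where
  open Field F
  open RingSolver commutativeRing
  open import Algebra.Properties.Semiring.Exp semiring public
    using (^-congˡ; ^-congʳ; ^-homo-*; ^-assocʳ)
  open import Algebra.Properties.CommutativeSemiring.Exp commutativeSemiring public
    using (^-distrib-*)
  open import Algebra.Properties.Ring ring public
    using (-‿distribˡ-*; -‿distribʳ-*; -0#≈0#; -‿involutive; -1*x≈-x)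

  x-y≈0⇒x≈y : ∀ {x y} → x - y ≈ 0# → x ≈ y
  x-y≈0⇒x≈y {x} {y} eq = trans (solve 2 (λ x y → x := (x :- y) :+ y) refl x y)
    (trans (+-congʳ eq) (+-identityˡ y))

  x≈y⇒x-y≈0 : ∀ {x y} → x ≈ y → x - y ≈ 0#
  x≈y⇒x-y≈0 {y = y} eq = trans (+-congʳ eq) (-‿inverseʳ y)

  x*y≈0⇒y≈0 : ∀ {x y} → x ≉ 0# → x * y ≈ 0# → y ≈ 0#
  x*y≈0⇒y≈0 {x} {y} x≉0 xy≈0 with x⁻¹ , xx⁻¹≈1 ← inverse x≉0 = begin
    y              ≈⟨ *-identityˡ y ⟨
    1# * y         ≈⟨ *-congʳ xx⁻¹≈1 ⟨
    x * x⁻¹ * y    ≈⟨ solve 3 (λ x x⁻¹ y → x :* x⁻¹ :* y := x⁻¹ :* (x :* y)) refl x x⁻¹ y ⟩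
    x⁻¹ * (x * y)  ≈⟨ *-congˡ xy≈0 ⟩
    x⁻¹ * 0#       ≈⟨ zeroʳ x⁻¹ ⟩
    0#             ∎
    where open import Relation.Binary.Reasoning.Setoid setoid

  *-cancelˡ : ∀ {x y z} → x ≉ 0# → x * y ≈ x * z → y ≈ z
  *-cancelˡ {x} {y} {z} x≉0 eq = x-y≈0⇒x≈y (x*y≈0⇒y≈0 x≉0
    (trans (solve 3 (λ x y z → x :* (y :- z) := x :* y :- x :* z) refl x y z) (x≈y⇒x-y≈0 eq)))

  *-cancelʳ : ∀ {x y z} → x ≉ 0# → y * x ≈ z * x → y ≈ z
  *-cancelʳ x≉0 eq = *-cancelˡ x≉0 (trans (*-comm _ _) (trans eq (*-comm _ _)))

  *-nonzero : ∀ {x y} → x ≉ 0# → y ≉ 0# → x * y ≉ 0#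
  *-nonzero x≉0 y≉0 xy≈0 = y≉0 (x*y≈0⇒y≈0 x≉0 xy≈0)

  ^-nonzero : ∀ {x} n → x ≉ 0# → x ^ n ≉ 0#
  ^-nonzero zero    x≉0 = 1≉0
  ^-nonzero (suc n) x≉0 = *-nonzero x≉0 (^-nonzero n x≉0)

  1^n≈1 : ∀ n → 1# ^ n ≈ 1#
  1^n≈1 zero    = refl
  1^n≈1 (suc n) = trans (*-identityˡ _) (1^n≈1 n)

  unit-nonzeroˡ : ∀ {x y} → x * y ≈ 1# → x ≉ 0#
  unit-nonzeroˡ {x} {y} eq x≈0 = 1≉0 (trans (sym eq) (trans (*-congʳ x≈0) (zeroˡ y)))

  unit-nonzeroʳ : ∀ {x y} → x * y ≈ 1# → y ≉ 0#
  unit-nonzeroʳ eq = unit-nonzeroˡ (trans (*-comm _ _) eq)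

record Subring {c ℓ r : Level} (F : Field c ℓ) (R : Pred (Field.Carrier F) r) : Set (c ⊔ ℓ ⊔ r) where
  open Field F
  field
    resp       : ∀ {x y} → x ≈ y → x ∈ R → y ∈ R
    0∈         : 0# ∈ R
    1∈         : 1# ∈ R
    +-closed   : ∀ {x y} → x ∈ R → y ∈ R → (x + y) ∈ R
    *-closed   : ∀ {x y} → x ∈ R → y ∈ R → (x * y) ∈ R
    neg-closed : ∀ {x} → x ∈ R → (- x) ∈ R

  sub-closed : ∀ {x y} → x ∈ R → y ∈ R → (x - y) ∈ R
  sub-closed x∈ y∈ = +-closed x∈ (neg-closed y∈)

  ^-closed : ∀ {x} n → x ∈ R → (x ^ n) ∈ R
  ^-closed zero    x∈ = 1∈
  ^-closed (suc n) x∈ = *-closed x∈ (^-closed n x∈)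

  sum-closed : ∀ n {f : Fin n → Carrier} → (∀ i → f i ∈ R) → sum f ∈ R
  sum-closed zero    f∈ = 0∈
  sum-closed (suc n) f∈ = +-closed (f∈ Fin.zero) (sum-closed n (λ i → f∈ (Fin.suc i)))

  product-closed : ∀ n {f : Fin n → Carrier} → (∀ i → f i ∈ R) → product f ∈ R
  product-closed zero    f∈ = 1∈
  product-closed (suc n) f∈ = *-closed (f∈ Fin.zero) (product-closed n (λ i → f∈ (Fin.suc i)))

module Combinations {c ℓ : Level} (F : Field c ℓ) where
  open Field F
  open RingSolver commutativeRing

  -- The coefficients range over a mere predicate because the elimination below takes them among
  -- polynomials in `u` of bounded degree, which are closed under sums but not under products.
  data Comb {q} (C : Pred Carrier q) : List Carrier → Pred Carrier (c ⊔ ℓ ⊔ q) where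
    nil  : ∀ {x} → x ≈ 0# → Comb C [] x
    cons : ∀ {a g y gs x} → a ∈ C → Comb C gs y → x ≈ a * g + y → Comb C (g ∷ gs) x

  Comb-resp : ∀ {q} {C : Pred Carrier q} {gs x y} → x ≈ y → Comb C gs x → Comb C gs y
  Comb-resp eq (nil x≈0)          = nil (trans (sym eq) x≈0)
  Comb-resp eq (cons a∈C cy x≈)   = cons a∈C cy (trans (sym eq) x≈)

  Comb-scale : ∀ {q r} {C : Pred Carrier q} {D : Pred Carrier r} {gs x} s →
    (∀ {a} → a ∈ C → (s * a) ∈ D) → Comb C gs x → Comb D gs (s * x)
  Comb-scale s f (nil x≈0) = nil (trans (*-congˡ x≈0) (zeroʳ s))
  Comb-scale s f (cons {a} {g} {y} a∈C cy x≈) = cons (f a∈C) (Comb-scale s f cy)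
    (trans (*-congˡ x≈) (solve 4 (λ s a g y → s :* (a :* g :+ y) := s :* a :* g :+ s :* y) refl s a g y))

  Comb-scale-generators : ∀ {q} {C : Pred Carrier q} {gs x} s →
    Comb C gs x → Comb C (map (s *_) gs) (s * x)
  Comb-scale-generators s (nil x≈0) = nil (trans (*-congˡ x≈0) (zeroʳ s))
  Comb-scale-generators s (cons {a} {g} {y} a∈C cy x≈) = cons a∈C (Comb-scale-generators s cy)
    (trans (*-congˡ x≈) (solve 4 (λ s a g y → s :* (a :* g :+ y) := a :* (s :* g) :+ s :* y) refl s a g y))

  module _ {q : Level} {C : Pred Carrier q} (0∈C : 0# ∈ C)
           (+-closed : ∀ {x y} → x ∈ C → y ∈ C → (x + y) ∈ C) where

    Comb-0 : ∀ gs → Comb C gs 0#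
    Comb-0 []       = nil refl
    Comb-0 (g ∷ gs) = cons 0∈C (Comb-0 gs) (sym (trans (+-identityʳ _) (zeroˡ g)))

    Comb-+ : ∀ {gs x y} → Comb C gs x → Comb C gs y → Comb C gs (x + y)
    Comb-+ (nil x≈0) (nil y≈0) = nil (trans (+-cong x≈0 y≈0) (+-identityˡ _))
    Comb-+ (cons {a} {g} {x} a∈ cx x≈) (cons {b} {_} {y} b∈ cy y≈) =
      cons (+-closed a∈ b∈) (Comb-+ cx cy)
        (trans (+-cong x≈ y≈)
          (solve 5 (λ a b g x y → a :* g :+ x :+ (b :* g :+ y) := (a :+ b) :* g :+ (x :+ y)) refl a b g x y))

    Comb-∈ : ∀ {gs g a} → g ∈ᴸ gs → a ∈ C → Comb C gs (a * g)
    Comb-∈ (here ≡.refl) a∈ = cons a∈ (Comb-0 _) (sym (+-identityʳ _))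
    Comb-∈ {g = g} {a} (there {x = h} g∈) a∈ = cons 0∈C (Comb-∈ g∈ a∈)
      (solve 3 (λ a g h → a :* g := :0 :* h :+ a :* g) refl a g h)

    Comb-++ : ∀ {gs hs x y} → Comb C gs x → Comb C hs y → Comb C (gs ++ hs) (x + y)
    Comb-++ (nil x≈0) cy = Comb-resp (sym (trans (+-congʳ x≈0) (+-identityˡ _))) cy
    Comb-++ {y = z} (cons {a} {g} {y} a∈ cx x≈) cy = cons a∈ (Comb-++ cx cy)
      (trans (+-congʳ x≈) (+-assoc _ _ _))

-- Integral elements over a subring of a field

module Integrality (em : ∀ {e} → ExcludedMiddle e) {c ℓ r : Level} (F : Field c ℓ)
  (R : Pred (Field.Carrier F) r) (isSubring : Subring F R) where
  open Field F
  open FieldProperties F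
  open Combinations F
  open RingSolver commutativeRing
  private module R = Subring isSubring

  -- Low u n is R + R u + ⋯ + R uⁿ⁻¹.
  data Low (u : Carrier) : ℕ → Pred Carrier (c ⊔ ℓ ⊔ r) where
    low₀ : ∀ {x} → x ≈ 0# → Low u 0 x
    lowₛ : ∀ {n a y x} → a ∈ R → Low u n y → x ≈ a + u * y → Low u (suc n) x

  Int : Pred Carrier (c ⊔ ℓ ⊔ r)
  Int u = ∃ λ n → Low u n (u ^ n)

  module _ {u : Carrier} where

    Low-resp : ∀ {n x y} → x ≈ y → Low u n x → Low u n y
    Low-resp eq (low₀ x≈0)      = low₀ (trans (sym eq) x≈0)
    Low-resp eq (lowₛ a∈ l x≈)  = lowₛ a∈ l (trans (sym eq) x≈)

    Low-0 : ∀ n → Low u n 0#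
    Low-0 zero    = low₀ refl
    Low-0 (suc n) = lowₛ R.0∈ (Low-0 n) (sym (trans (+-identityˡ _) (zeroʳ u)))

    Low-+ : ∀ {n x y} → Low u n x → Low u n y → Low u n (x + y)
    Low-+ (low₀ x≈0) (low₀ y≈0) = low₀ (trans (+-cong x≈0 y≈0) (+-identityˡ _))
    Low-+ (lowₛ {a = a} {x} a∈ lx x≈) (lowₛ {a = b} {y} b∈ ly y≈) =
      lowₛ (R.+-closed a∈ b∈) (Low-+ lx ly) (trans (+-cong x≈ y≈)
        (solve 5 (λ a b u x y → a :+ u :* x :+ (b :+ u :* y) := a :+ b :+ u :* (x :+ y)) refl a b u x y))

    Low-scale : ∀ {n s x} → s ∈ R → Low u n x → Low u n (s * x)
    Low-scale {s = s} s∈ (low₀ x≈0) = low₀ (trans (*-congˡ x≈0) (zeroʳ s))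
    Low-scale {s = s} s∈ (lowₛ {a = a} {x} a∈ lx x≈) =
      lowₛ (R.*-closed s∈ a∈) (Low-scale s∈ lx) (trans (*-congˡ x≈)
        (solve 4 (λ s a u x → s :* (a :+ u :* x) := s :* a :+ u :* (s :* x)) refl s a u x))

    Low-neg : ∀ {n x} → Low u n x → Low u n (- x)
    Low-neg lx = Low-resp (-1*x≈-x _) (Low-scale (R.neg-closed R.1∈) lx)

    Low-sucʳ : ∀ {n x} → Low u n x → Low u (suc n) x
    Low-sucʳ (low₀ x≈0)      = Low-resp (sym x≈0) (Low-0 1)
    Low-sucʳ (lowₛ a∈ lx x≈) = lowₛ a∈ (Low-sucʳ lx) x≈

    Low-mono : ∀ {m n x} → m ℕ.≤ n → Low u m x → Low u n x
    Low-mono m≤n = go (ℕ.≤⇒≤′ m≤n)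
      where
      go : ∀ {m n x} → m ℕ.≤′ n → Low u m x → Low u n x
      go (ℕ.≤′-reflexive ≡.refl) lx = lx
      go (ℕ.≤′-step m≤n)         lx = Low-sucʳ (go m≤n lx)

    Low-u* : ∀ {n x} → Low u n x → Low u (suc n) (u * x)
    Low-u* lx = lowₛ R.0∈ lx (sym (+-identityˡ _))

    Low-u^* : ∀ k {n x} → Low u n x → Low u (k ℕ.+ n) (u ^ k * x)
    Low-u^* zero    lx = Low-resp (sym (*-identityˡ _)) lx
    Low-u^* (suc k) lx = Low-resp (sym (*-assoc _ _ _)) (Low-u* (Low-u^* k lx))

    Low-* : ∀ {m n x y} → Low u m x → Low u n y → Low u (m ℕ.+ n) (x * y)
    Low-* {n = n} {y = y} (low₀ x≈0) ly = Low-resp (sym (trans (*-congʳ x≈0) (zeroˡ y))) (Low-0 n)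
    Low-* {suc m} {n} {y = y} (lowₛ {a = a} {x} a∈ lx x≈) ly = Low-resp
      (trans (solve 4 (λ a u x y → a :* y :+ u :* (x :* y) := (a :+ u :* x) :* y) refl a u x y)
        (sym (*-congʳ x≈)))
      (Low-+ (Low-mono (ℕ.m≤n+m n (suc m)) (Low-scale a∈ ly)) (Low-u* (Low-* lx ly)))

    R⊆Low₁ : ∀ {x} → x ∈ R → Low u 1 x
    R⊆Low₁ {x} x∈ = lowₛ x∈ (low₀ refl) (solve 2 (λ x u → x := x :+ u :* :0) refl x u)

    -- `Low` is built from the constant term, whereas reduction by a monic equation needs access to
    -- the other end.
    Low-top : ∀ n {x} → Low u (suc n) x → ∃₂ λ a y → a ∈ R × Low u n y × x ≈ y + a * u ^ n
    Low-top zero {x} (lowₛ {a = a} {y} a∈ (low₀ y≈0) x≈) = a , 0# , a∈ , low₀ refl ,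
      trans x≈ (trans (+-congˡ (*-congˡ y≈0))
        (solve 2 (λ a u → a :+ u :* :0 := :0 :+ a :* :1) refl a u))
    Low-top (suc n) {x} (lowₛ {a = b} {z} b∈ lz x≈)
      with a , y , a∈ , ly , z≈ ← Low-top n lz =
      a , b + u * y , a∈ , lowₛ b∈ ly refl ,
      trans x≈ (trans (+-congˡ (*-congˡ z≈))
        (solve 5 (λ a b u y w → b :+ u :* (y :+ a :* w) := b :+ u :* y :+ a :* (u :* w)) refl a b u y (u ^ n)))

    -- Eliminates the generators one after the other: multiplying the
    -- remaining rows by the pivot u ^ d - a doubles d.
    eliminate : ∀ d g gs → All (_≉ 0#) (g ∷ gs) →
      All (λ x → Comb (Low u d) (g ∷ gs) (u ^ d * x)) (g ∷ gs) → Int u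
    eliminate d g [] (g≉0 ∷ []) (cons {a} {_} {y} la (nil y≈0) eq ∷ []) =
      d , Low-resp (sym (*-cancelʳ g≉0 (trans eq (trans (+-congˡ y≈0) (+-identityʳ _))))) la
    eliminate d g (g′ ∷ gs′) (_ ∷ gs≉0) (cons {a} {_} {y} la cy eq ∷ rows) =
      eliminate (d ℕ.+ d) g′ gs′ gs≉0 (All.tabulate row)
      where
      gs : List Carrier
      gs = g′ ∷ gs′
      row : ∀ {x} → x ∈ᴸ gs → Comb (Low u (d ℕ.+ d)) gs (u ^ (d ℕ.+ d) * x)
      row {x} x∈ with cons {b} {_} {z} lb cz eq′ ← All.lookup rows x∈ =
        -- With `w = u ^ d`, multiply `w x = b g + z` by `w - a` and use `(w - a) g = y`: this gives
        -- `w² x = b y + (w - a) z + w a x`, from which `g` has disappeared without any division.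
        Comb-resp lemma
          (+ᶜ (+ᶜ (Comb-scale b (Low-* lb) cy) (Comb-scale (u ^ d) (Low-u^* d) cz))
              (+ᶜ (Comb-scale (- a) (Low-* (Low-neg la)) cz)
                  (Comb-∈ (Low-0 _) Low-+ x∈ (Low-u^* d la))))
        where
        open import Relation.Binary.Reasoning.Setoid setoid
        +ᶜ : ∀ {v w} → Comb (Low u (d ℕ.+ d)) gs v → Comb (Low u (d ℕ.+ d)) gs w → _
        +ᶜ = Comb-+ (Low-0 _) Low-+
        w = u ^ d
        y≈ : y ≈ w * g - a * g
        y≈ = trans (solve 3 (λ a g y → y := a :* g :+ y :- a :* g) refl a g y) (+-congʳ (sym eq))
        z≈ : z ≈ w * x - b * g
        z≈ = trans (solve 3 (λ a g y → y := a :* g :+ y :- a :* g) refl b g z) (+-congʳ (sym eq′))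
        lemma : b * y + w * z + (- a * z + w * a * x) ≈ u ^ (d ℕ.+ d) * x
        lemma = begin
          b * y + w * z + (- a * z + w * a * x)
            ≈⟨ +-cong (+-cong (*-congˡ y≈) (*-congˡ z≈)) (+-congʳ (*-congˡ z≈)) ⟩
          b * (w * g - a * g) + w * (w * x - b * g) + (- a * (w * x - b * g) + w * a * x)
            ≈⟨ solve 5 (λ b w g a x → b :* (w :* g :- a :* g) :+ w :* (w :* x :- b :* g) :+
                 (:- a :* (w :* x :- b :* g) :+ w :* a :* x) := w :* w :* x) refl b w g a x ⟩
          w * w * x              ≈⟨ *-congʳ (^-homo-* u d d) ⟨
          u ^ (d ℕ.+ d) * x      ∎

    -- Takes the place of the determinant trick. Elimination keeps the coefficient of `x` in its own
    -- row monic in `u`, up to lower terms; when one generator is left, cancelling it leaves a monic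
    -- equation, which is why the generators must not vanish. The start is `d = 1`, as elements of
    -- `R` are polynomials of degree below 1.
    integral-module : ∀ g gs → All (_≉ 0#) (g ∷ gs) →
      All (λ x → Comb R (g ∷ gs) (u * x)) (g ∷ gs) → Int u
    integral-module g gs gs≉0 rows = eliminate 1 g gs gs≉0 (All.map
      (λ {x} row → Comb-resp (trans (*-identityˡ _) (*-congʳ (sym (*-identityʳ u))))
        (Comb-scale 1# (λ a∈ → Low-resp (sym (*-identityˡ _)) (R⊆Low₁ a∈)) row)) rows)

  powers : Carrier → ℕ → List Carrier
  powers x zero    = []
  powers x (suc n) = 1# ∷ map (x *_) (powers x n)

  Low⇒Comb : ∀ {x n y} → Low x n y → Comb R (powers x n) y
  Low⇒Comb (low₀ y≈0) = nil y≈0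
  Low⇒Comb {x} (lowₛ a∈ ly y≈) = cons a∈ (Comb-scale-generators x (Low⇒Comb ly))
    (trans y≈ (+-congʳ (sym (*-identityʳ _))))

  powers-Low : ∀ x n → All (Low x n) (powers x n)
  powers-Low x zero    = []
  powers-Low x (suc n) = lowₛ R.1∈ (Low-0 n) (solve 1 (λ x → :1 := :1 :+ x :* :0) refl x) ∷
    All.map⁺ (All.map Low-u* (powers-Low x n))

  powers-nonzero : ∀ {x} n → x ≉ 0# → All (_≉ 0#) (powers x n)
  powers-nonzero zero    x≉0 = []
  powers-nonzero (suc n) x≉0 = 1≉0 ∷ All.map⁺ (All.map (*-nonzero x≉0) (powers-nonzero n x≉0))

  cross : List Carrier → List Carrier → List Carrier
  cross []       hs = []
  cross (g ∷ gs) hs = map (g *_) hs ++ cross gs hs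

  All-cross : ∀ {p q t} {P : Pred Carrier p} {Q : Pred Carrier q} {T : Pred Carrier t} {gs hs} →
    (∀ {g h} → P g → Q h → T (g * h)) → All P gs → All Q hs → All T (cross gs hs)
  All-cross f []         qs = []
  All-cross f (pg ∷ ps)  qs = All.++⁺ (All.map⁺ (All.map (f pg) qs)) (All-cross f ps qs)

  Comb-cross : ∀ {gs hs x y} → Comb R gs x → Comb R hs y → Comb R (cross gs hs) (x * y)
  Comb-cross (nil x≈0) cy = nil (trans (*-congʳ x≈0) (zeroˡ _))
  Comb-cross {y = y} (cons {a} {g} {x} a∈ cx x≈) cy = Comb-resp
    (trans (solve 4 (λ a g x y → a :* (g :* y) :+ x :* y := (a :* g :+ x) :* y) refl a g x y)
      (sym (*-congʳ x≈)))
    (Comb-++ R.0∈ R.+-closed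
      (Comb-scale a (R.*-closed a∈) (Comb-scale-generators g cy)) (Comb-cross cx cy))

  -- Multiplication by `x` creates at most one term of degree `n`, which the equation of `x`
  -- rewrites in lower terms.
  Low-stable : ∀ {x n y} → Low x n (x ^ n) → Low x n y → Low x n (x * y)
  Low-stable {n = n} lxⁿ ly with a , z , a∈ , lz , eq ← Low-top n (Low-u* ly) =
    Low-resp (sym eq) (Low-+ lz (Low-scale a∈ lxⁿ))

  Int-resp : ∀ {x y} → x ≈ y → Int x → Int y
  Int-resp {x} {y} eq (n , l) = n , Low-resp (^-congˡ n eq) (go l)
    where
    go : ∀ {n z} → Low x n z → Low y n z
    go (low₀ z≈0)      = low₀ z≈0
    go (lowₛ a∈ lz z≈) = lowₛ a∈ (go lz) (trans z≈ (+-congˡ (*-congʳ eq)))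

  R⊆Int : R ⊆ Int
  R⊆Int x∈ = 1 , Low-resp (sym (*-identityʳ _)) (R⊆Low₁ x∈)

  private
    module Closure {x y : Carrier} (x≉0 : x ≉ 0#) (y≉0 : y ≉ 0#) (ix : Int x) (iy : Int y) where
      m = proj₁ ix
      n = proj₁ iy

      G = cross (powers x m) (powers y n)

      -- The module spanned by all `xⁱ yʲ` with `i < m`, `j < n` serves both the sum and the
      -- product: it is stable under `x` and under `y`.
      rows : (u : Carrier) → (∀ {g h} → Low x m g → Low y n h → Comb R G (u * (g * h))) →
        Int u
      rows u f = go (All-cross *-nonzero (powers-nonzero m x≉0) (powers-nonzero n y≉0))
        (All-cross f (powers-Low x m) (powers-Low y n)) (Comb-cross (Low⇒Comb (proj₂ ix)) (Low⇒Comb (proj₂ iy)))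
        where
        go : All (_≉ 0#) G → All (λ g → Comb R G (u * g)) G → Comb R G (x ^ m * y ^ n) → Int u
        go with G
        -- `x ^ m * y ^ n` is itself a combination of `G`, so an empty `G` would make it vanish.
        ... | []     = λ { _ _ (nil eq) → ⊥-elim (*-nonzero (^-nonzero m x≉0) (^-nonzero n y≉0) eq) }
        ... | g ∷ gs = λ g≉0 rs _ → integral-module g gs g≉0 rs

      comb : ∀ {g h} → Low x m g → Low y n h → Comb R G (g * h)
      comb lg lh = Comb-cross (Low⇒Comb lg) (Low⇒Comb lh)

      Int-+ : Int (x + y)
      Int-+ = rows (x + y) λ {g} {h} lg lh → Comb-resp
        (solve 4 (λ x y g h → x :* g :* h :+ g :* (y :* h) := (x :+ y) :* (g :* h)) refl x y g h)
        (Comb-+ R.0∈ R.+-closed (comb (Low-stable (proj₂ ix) lg) lh) (comb lg (Low-stable (proj₂ iy) lh)))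

      Int-* : Int (x * y)
      Int-* = rows (x * y) λ {g} {h} lg lh → Comb-resp
        (solve 4 (λ x y g h → x :* g :* (y :* h) := x :* y :* (g :* h)) refl x y g h)
        (comb (Low-stable (proj₂ ix) lg) (Low-stable (proj₂ iy) lh))

  Int-+ : ∀ {x y} → Int x → Int y → Int (x + y)
  Int-+ {x} {y} ix iy with em {P = x ≈ 0#} | em {P = y ≈ 0#}
  ... | yes x≈0 | _       = Int-resp (sym (trans (+-congʳ x≈0) (+-identityˡ y))) iy
  ... | no _    | yes y≈0 = Int-resp (sym (trans (+-congˡ y≈0) (+-identityʳ x))) ix
  ... | no x≉0  | no y≉0  = Closure.Int-+ x≉0 y≉0 ix iy

  Int-* : ∀ {x y} → Int x → Int y → Int (x * y)
  Int-* {x} {y} ix iy with em {P = x ≈ 0#} | em {P = y ≈ 0#}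
  ... | yes x≈0 | _       = Int-resp (sym (trans (*-congʳ x≈0) (zeroˡ y))) (R⊆Int R.0∈)
  ... | no _    | yes y≈0 = Int-resp (sym (trans (*-congˡ y≈0) (zeroʳ x))) (R⊆Int R.0∈)
  ... | no x≉0  | no y≉0  = Closure.Int-* x≉0 y≉0 ix iy

  Int-isSubring : Subring F Int
  Int-isSubring = record
    { resp       = Int-resp
    ; 0∈         = R⊆Int R.0∈
    ; 1∈         = R⊆Int R.1∈
    ; +-closed   = Int-+
    ; *-closed   = Int-*
    ; neg-closed = λ ix → Int-resp (-1*x≈-x _) (Int-* (R⊆Int (R.neg-closed R.1∈)) ix)
    }

-- The maximal ideal, polynomials over the residue field, and Hensel factorisations

module ValuationRingProperties (em : ∀ {e} → ExcludedMiddle e) {c ℓ a : Level}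
  {K : Field c ℓ} (V : ValuationRing K a) where
  open Field K
  open FieldProperties K
  open RingSolver commutativeRing
  open ValuationRing V
  open import Algebra.Properties.Semiring.Mult semiring using (×1-homo-*)

  A-isSubring : Subring K A
  A-isSubring = record
    { resp = resp ; 0∈ = 0∈A ; 1∈ = 1∈A
    ; +-closed = +-closed ; *-closed = *-closed ; neg-closed = neg-closed }

  ∈A⊎inverse∈A : ∀ x → x ∈ A ⊎ ∃ λ y → y ∈ A × x * y ≈ 1#
  ∈A⊎inverse∈A x with em {P = x ≈ 0#}
  ... | yes x≈0 = inj₁ (resp (sym x≈0) 0∈A)
  ... | no x≉0 with y , xy≈1 ← inverse x≉0 with total xy≈1
  ...   | inj₁ x∈ = inj₁ x∈
  ...   | inj₂ y∈ = inj₂ (y , y∈ , xy≈1)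

  IsUnit : Pred (∃ A) _
  IsUnit (x , _) = ∃ λ y → y ∈ A × x * y ≈ 1#

  1∉𝔪 : ∀ {x} → proj₁ x ≈ 1# → ¬ 𝔪 x
  1∉𝔪 eq x∈𝔪 = x∈𝔪 (1# , 1∈A , trans (*-identityʳ _) eq)

  ∉𝔪⇒unit : ∀ {x} → ¬ 𝔪 x → IsUnit x
  ∉𝔪⇒unit {x} x∉𝔪 with em {P = IsUnit x}
  ... | yes u = u
  ... | no ¬u = contradiction ¬u x∉𝔪

  𝔪-resp : ∀ {x y : ∃ A} → proj₁ x ≈ proj₁ y → 𝔪 x → 𝔪 y
  𝔪-resp eq x∈𝔪 (w , w∈ , yw≈1) = x∈𝔪 (w , w∈ , trans (*-congʳ eq) yw≈1)

  𝔪-* : ∀ {x r y : ∃ A} → proj₁ y ≈ proj₁ r * proj₁ x → 𝔪 x → 𝔪 y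
  𝔪-* {x , _} {r , r∈} {y , _} eq x∈𝔪 (w , w∈ , yw≈1) =
    x∈𝔪 (r * w , *-closed r∈ w∈ , trans
      (trans (solve 3 (λ x r w → x :* (r :* w) := r :* x :* w) refl x r w) (*-congʳ (sym eq))) yw≈1)

  𝔪-0 : ∀ {x : ∃ A} → proj₁ x ≈ 0# → 𝔪 x
  𝔪-0 eq (w , w∈ , xw≈1) = 1≉0 (trans (sym xw≈1) (trans (*-congʳ eq) (zeroˡ w)))

  -- One of `x / y` and `y / x` lies in `A`, so the sum is an `A`-multiple of one of the two
  -- summands.
  𝔪-+ : ∀ {x y z : ∃ A} → proj₁ z ≈ proj₁ x + proj₁ y → 𝔪 x → 𝔪 y → 𝔪 z
  𝔪-+ {x , x∈} {y , y∈} {z , z∈} eq x∈𝔪 y∈𝔪 with em {P = x ≈ 0#} | em {P = y ≈ 0#}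
  ... | yes x≈0 | _       = 𝔪-resp {y , y∈} {z , z∈} (sym (trans eq (trans (+-congʳ x≈0) (+-identityˡ _)))) y∈𝔪
  ... | no _    | yes y≈0 = 𝔪-resp {x , x∈} {z , z∈} (sym (trans eq (trans (+-congˡ y≈0) (+-identityʳ _)))) x∈𝔪
  ... | no x≉0  | no y≉0
    with x′ , xx′≈1 ← inverse x≉0 | y′ , yy′≈1 ← inverse y≉0
    with total {x * y′} {y * x′} (trans
      (solve 4 (λ x x′ y y′ → x :* y′ :* (y :* x′) := x :* x′ :* (y :* y′)) refl x x′ y y′)
      (trans (*-cong xx′≈1 yy′≈1) (*-identityˡ 1#)))
  ... | inj₁ r∈ = 𝔪-* {y , y∈} {x * y′ + 1# , +-closed r∈ 1∈A} {z , z∈} (trans eq (sym (trans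
      (solve 3 (λ x y y′ → (x :* y′ :+ :1) :* y := x :* (y :* y′) :+ y) refl x y y′)
      (+-congʳ (trans (*-congˡ yy′≈1) (*-identityʳ x)))))) y∈𝔪
  ... | inj₂ r∈ = 𝔪-* {x , x∈} {y * x′ + 1# , +-closed r∈ 1∈A} {z , z∈} (trans eq (sym (trans
      (solve 3 (λ x y x′ → (y :* x′ :+ :1) :* x := x :+ y :* (x :* x′)) refl x y x′)
      (+-congˡ (trans (*-congˡ xx′≈1) (*-identityʳ y)))))) x∈𝔪

  ≡ₖ-unit : ∀ {x y d : ∃ A} → proj₁ d ≈ proj₁ x - proj₁ y → 𝔪 d → ¬ 𝔪 y → ¬ 𝔪 x
  ≡ₖ-unit {x , x∈} {y , y∈} {d , d∈} eq d∈𝔪 y∉𝔪 x∈𝔪 =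
    y∉𝔪 (𝔪-+ {x , x∈} { - d , neg-closed d∈} {y , y∈}
      (sym (trans (+-congˡ (-‿cong eq)) (solve 2 (λ x y → x :+ :- (x :- y) := y) refl x y)))
      x∈𝔪 (𝔪-* {d , d∈} { - 1# , neg-closed 1∈A} { - d , neg-closed d∈} (sym (-1*x≈-x d)) d∈𝔪))

  module A[X] = Polynomials rawRingᴬ
  module k[X] = Polynomials residueField
  open A[X] using (Poly; coeff; _+ᴾ_; _*ᴾ_)

  private
    infixl 7 _·_
    _·_ : ∃ A → Poly → Poly
    x · f = map (λ y → proj₁ x * proj₁ y , *-closed (proj₂ x) (proj₂ y)) f

  1ᴬ 0ᴬ : ∃ A
  1ᴬ = 1# , 1∈A
  0ᴬ = 0# , 0∈A

  coeff₀ : Poly → ℕ → Carrier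
  coeff₀ f n = proj₁ (coeff f n)

  coeff-+ᴾ : ∀ f g n → coeff₀ (f +ᴾ g) n ≈ coeff₀ f n + coeff₀ g n
  coeff-+ᴾ []      g       n       = sym (+-identityˡ _)
  coeff-+ᴾ (x ∷ f) []      n       = sym (+-identityʳ _)
  coeff-+ᴾ (x ∷ f) (y ∷ g) zero    = refl
  coeff-+ᴾ (x ∷ f) (y ∷ g) (suc n) = coeff-+ᴾ f g n

  coeff-· : ∀ x f n → coeff₀ (x · f) n ≈ proj₁ x * coeff₀ f n
  coeff-· x []      n       = sym (zeroʳ _)
  coeff-· x (y ∷ f) zero    = refl
  coeff-· x (y ∷ f) (suc n) = coeff-· x f n

  coeff-*ᴾ-zero : ∀ x f g → coeff₀ ((x ∷ f) *ᴾ g) 0 ≈ proj₁ x * coeff₀ g 0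
  coeff-*ᴾ-zero x f g = trans (coeff-+ᴾ (x · g) _ 0)
    (trans (+-identityʳ _) (coeff-· x g 0))

  coeff-*ᴾ-suc : ∀ x f g n →
    coeff₀ ((x ∷ f) *ᴾ g) (suc n) ≈ proj₁ x * coeff₀ g (suc n) + coeff₀ (f *ᴾ g) n
  coeff-*ᴾ-suc x f g n = trans (coeff-+ᴾ (x · g) _ (suc n)) (+-congʳ (coeff-· x g (suc n)))

  coeff-++ : ∀ (f : Poly) {g} n → coeff (f ++ g) (length f ℕ.+ n) ≡ coeff g n
  coeff-++ []      n = ≡.refl
  coeff-++ (x ∷ f) n = coeff-++ f n

  coeff-drop : ∀ m (f : Poly) n → coeff (drop m f) n ≡ coeff f (m ℕ.+ n)
  coeff-drop zero    f       n = ≡.refl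
  coeff-drop (suc m) []      n = ≡.refl
  coeff-drop (suc m) (x ∷ f) n = coeff-drop m f n

  X^ : ℕ → Poly
  X^ zero    = 1ᴬ ∷ []
  X^ (suc n) = 0ᴬ ∷ X^ n

  coeff-*ᴾ0∷ : ∀ f g → coeff₀ (f *ᴾ (0ᴬ ∷ g)) 0 ≈ 0# ×
    (∀ n → coeff₀ (f *ᴾ (0ᴬ ∷ g)) (suc n) ≈ coeff₀ (f *ᴾ g) n)
  coeff-*ᴾ0∷ []      g = refl , λ _ → refl
  coeff-*ᴾ0∷ (x ∷ f) g with eq₀ , eqₛ ← coeff-*ᴾ0∷ f g =
    trans (coeff-*ᴾ-zero x f (0ᴬ ∷ g)) (zeroʳ _) , λ
    { zero → trans (coeff-*ᴾ-suc x f (0ᴬ ∷ g) 0)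
        (trans (+-congˡ eq₀) (trans (+-identityʳ _) (sym (coeff-*ᴾ-zero x f g))))
    ; (suc n) → trans (coeff-*ᴾ-suc x f (0ᴬ ∷ g) (suc n))
        (trans (+-congˡ (eqₛ n)) (sym (coeff-*ᴾ-suc x f g n)))
    }

  coeff-*ᴾ1 : ∀ f n → coeff₀ (f *ᴾ (1ᴬ ∷ [])) n ≈ coeff₀ f n
  coeff-*ᴾ1 []      n       = refl
  coeff-*ᴾ1 (x ∷ f) zero    = trans (coeff-*ᴾ-zero x f (1ᴬ ∷ [])) (*-identityʳ _)
  coeff-*ᴾ1 (x ∷ f) (suc n) = trans (coeff-*ᴾ-suc x f (1ᴬ ∷ []) n)
    (trans (+-cong (zeroʳ _) (coeff-*ᴾ1 f n)) (+-identityˡ _))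

  coeff-*ᴾX^-< : ∀ m f {n} → n ℕ.< m → coeff₀ (f *ᴾ X^ m) n ≈ 0#
  coeff-*ᴾX^-< (suc m) f {zero}  n<m = proj₁ (coeff-*ᴾ0∷ f (X^ m))
  coeff-*ᴾX^-< (suc m) f {suc n} n<m =
    trans (proj₂ (coeff-*ᴾ0∷ f (X^ m)) n) (coeff-*ᴾX^-< m f (ℕ.s≤s⁻¹ n<m))

  coeff-*ᴾX^ : ∀ m f n → coeff₀ (f *ᴾ X^ m) (m ℕ.+ n) ≈ coeff₀ f n
  coeff-*ᴾX^ zero    f n = coeff-*ᴾ1 f n
  coeff-*ᴾX^ (suc m) f n = trans (proj₂ (coeff-*ᴾ0∷ f (X^ m)) (m ℕ.+ n)) (coeff-*ᴾX^ m f n)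

  <⊎+ : ∀ m n → n ℕ.< m ⊎ ∃ λ j → n ≡ m ℕ.+ j
  <⊎+ m n with n ℕ.<? m
  ... | yes n<m = inj₁ n<m
  ... | no n≮m  = inj₂ (n ℕ.∸ m , ≡.sym (ℕ.m+[n∸m]≡n (ℕ.≮⇒≥ n≮m)))

  -- Power series division by a polynomial whose constant term is a unit.
  divide : ∀ e gs → IsUnit e → ∀ m (r : ℕ → ∃ A) →
    ∃ λ u → ∀ {n} → n ℕ.< m → coeff₀ (u *ᴾ (e ∷ gs)) n ≈ proj₁ (r n)
  divide e gs e-unit                 zero    r = [] , λ ()
  divide e gs e-unit@(e′ , e′∈ , ee′≈1) (suc m) r with divide e gs e-unit m r′
    where
    -- What is left to produce after the constant coefficient `q = r₀ / e` has been chosen: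
    -- `r - q (e ∷ gs)` divided by `X`.
    r′ : ℕ → ∃ A
    r′ n = proj₁ (r (suc n)) - proj₁ (r 0) * e′ * coeff₀ gs n ,
      +-closed (proj₂ (r (suc n)))
        (neg-closed (*-closed (*-closed (proj₂ (r 0)) e′∈) (proj₂ (coeff gs n))))
  ... | u , eq = (q ∷ u) , λ
    { {zero}  _   → trans (coeff-*ᴾ-zero q u (e ∷ gs)) (trans (*-assoc _ _ _)
        (trans (*-congˡ (trans (*-comm _ _) ee′≈1)) (*-identityʳ _)))
    ; {suc n} n<m → trans (coeff-*ᴾ-suc q u (e ∷ gs) n) (trans (+-congˡ (eq (ℕ.s≤s⁻¹ n<m)))
        (solve 2 (λ x y → x :+ (y :- x) := y) refl _ _))
    }
    where
    q : ∃ A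
    q = proj₁ (r 0) * e′ , *-closed (proj₂ (r 0)) e′∈

  -- Power series division inverts `e ∷ gs` modulo `X ^ m`; the remainder `1 - u (e ∷ gs)` is then a
  -- multiple of `X ^ m`, and dropping its first `m` coefficients gives `v`.
  coprime-X^ : ∀ e gs → IsUnit e → ∀ m →
    ∃₂ λ u v → ∀ n → coeff₀ ((u *ᴾ (e ∷ gs)) +ᴾ (v *ᴾ X^ m)) n ≈ coeff₀ (X^ 0) n
  coprime-X^ e gs e-unit m with u , eq ← divide e gs e-unit m (coeff (X^ 0)) = u , v , λ n →
    trans (coeff-+ᴾ ug (v *ᴾ X^ m) n) (go n)
    where
    ug = u *ᴾ (e ∷ gs)
    -ug = (- 1# , neg-closed 1∈A) · ug
    w = X^ 0 +ᴾ -ug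
    v = drop m w
    go : ∀ n → coeff₀ ug n + coeff₀ (v *ᴾ X^ m) n ≈ coeff₀ (X^ 0) n
    go n with <⊎+ m n
    ... | inj₁ n<m = trans (+-cong (eq n<m) (coeff-*ᴾX^-< m v n<m)) (+-identityʳ _)
    ... | inj₂ (j , ≡.refl) = trans (+-congˡ (trans (coeff-*ᴾX^ m v j)
        (trans (reflexive (≡.cong proj₁ (coeff-drop m w j))) (trans (coeff-+ᴾ (X^ 0) -ug (m ℕ.+ j))
          (+-congˡ (trans (coeff-· (- 1# , neg-closed 1∈A) ug (m ℕ.+ j)) (-1*x≈-x _)))))))
        (solve 2 (λ x y → x :+ (y :- x) := y) refl _ _)

  -- `A` and `k` share carriers and operations, but `A[X]` and `k[X]` are two instances of a module
  -- of recursive functions, whose agreement has to be shown by induction.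
  coeffₖ≡ : ∀ f n → k[X].coeff f n ≡ coeff f n
  coeffₖ≡ []      n       = ≡.refl
  coeffₖ≡ (x ∷ f) zero    = ≡.refl
  coeffₖ≡ (x ∷ f) (suc n) = coeffₖ≡ f n

  +ᴾₖ≡ : ∀ f g → f k[X].+ᴾ g ≡ f +ᴾ g
  +ᴾₖ≡ []      g       = ≡.refl
  +ᴾₖ≡ (x ∷ f) []      = ≡.refl
  +ᴾₖ≡ (x ∷ f) (y ∷ g) = ≡.cong (_ ∷_) (+ᴾₖ≡ f g)

  *ᴾₖ≡ : ∀ f g → f k[X].*ᴾ g ≡ f *ᴾ g
  *ᴾₖ≡ []      g = ≡.refl
  *ᴾₖ≡ (x ∷ f) g = ≡.trans (+ᴾₖ≡ (x · g) _) (≡.cong (λ h → (x · g) +ᴾ (0ᴬ ∷ h)) (*ᴾₖ≡ f g))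

  infix 4 _≈ₖ_
  _≈ₖ_ : ∃ A → ∃ A → Set _
  x ≈ₖ y = 𝔪 (proj₁ x - proj₁ y , +-closed (proj₂ x) (neg-closed (proj₂ y)))

  ≈⇒≈ₖ : ∀ x y → proj₁ x ≈ proj₁ y → x ≈ₖ y
  ≈⇒≈ₖ x y eq = 𝔪-0 {proj₁ x - proj₁ y , +-closed (proj₂ x) (neg-closed (proj₂ y))} (x≈y⇒x-y≈0 eq)

  ≈ᴾ⇒≈ᴾₖ : ∀ f g → (∀ n → coeff f n ≈ₖ coeff g n) → f k[X].≈ᴾ g
  ≈ᴾ⇒≈ᴾₖ f g eq n rewrite coeffₖ≡ f n | coeffₖ≡ g n = eq n

  ≈ᴾₖ⇒≈ᴾ : ∀ f g → f k[X].≈ᴾ g → ∀ n → coeff f n ≈ₖ coeff g n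
  ≈ᴾₖ⇒≈ᴾ f g eq n with eqₙ ← eq n rewrite coeffₖ≡ f n | coeffₖ≡ g n = eqₙ

  Monic⇒Monicₖ : ∀ f → A[X].Monic f → k[X].Monic f
  Monic⇒Monicₖ f (n , eq , eqs) = n , lead , λ m n<m → rest m (eqs m n<m)
    where
    lead : k[X].coeff f n ≈ₖ 1ᴬ
    lead rewrite coeffₖ≡ f n = ≈⇒≈ₖ (coeff f n) 1ᴬ eq
    rest : ∀ m → coeff₀ f m ≈ 0# → k[X].coeff f m ≈ₖ 0ᴬ
    rest m eq′ rewrite coeffₖ≡ f m = ≈⇒≈ₖ (coeff f m) 0ᴬ eq′

  coeff-𝔪 : ∀ {ms} g {n} → All 𝔪 ms → n ℕ.< length ms → 𝔪 (coeff (ms ++ g) n)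
  coeff-𝔪 g {zero}  (m∈ ∷ ms∈) n<    = m∈
  coeff-𝔪 g {suc n} (m∈ ∷ ms∈) n<    = coeff-𝔪 g ms∈ (ℕ.s≤s⁻¹ n<)

  -- The length of `ms` is the order of vanishing at 0 of the reduction of `f`; the coefficient 1
  -- guarantees that the search ends.
  first-unit : ∀ (f : Poly) n → coeff₀ f n ≈ 1# →
    ∃ λ ms → ∃₂ λ e gs → f ≡ ms ++ e ∷ gs × All 𝔪 ms × ¬ 𝔪 e
  first-unit []      n       eq = contradiction (sym eq) 1≉0
  first-unit (x ∷ f) n       eq with em {P = 𝔪 x}
  first-unit (x ∷ f) n       eq | no x∉𝔪 = [] , x , f , ≡.refl , [] , x∉𝔪
  first-unit (x ∷ f) zero    eq | yes x∈𝔪 = contradiction x∈𝔪 (1∉𝔪 {x} eq)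
  first-unit (x ∷ f) (suc n) eq | yes x∈𝔪 with ms , e , gs , ≡.refl , ms∈ , e∉ ← first-unit f n eq =
    x ∷ ms , e , gs , ≡.refl , x∈𝔪 ∷ ms∈ , e∉

  -- Over `k`, a monic polynomial is a power of `X` times a polynomial with nonzero constant term.
  -- These two are coprime, so the factorisation lifts. Henselianity enters the proof through this
  -- factorisation alone.
  hensel-factors : Henselian → ∀ f → A[X].Monic f →
    ∃ λ m → ∃₂ λ e gs → ∃₂ λ g h → ¬ 𝔪 e × (f A[X].≈ᴾ g *ᴾ h) ×
      (∀ n → coeff g n ≈ₖ coeff (e ∷ gs) n) × (∀ n → coeff h n ≈ₖ coeff (X^ m) n)
  hensel-factors hensel f monic@(n , lead , above)
    with ms , e , gs , ≡.refl , ms∈𝔪 , e∉𝔪 ← first-unit f n lead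
    with u , v , bezout ← coprime-X^ e gs (∉𝔪⇒unit {e} e∉𝔪) (length ms)
    with hensel (ms ++ e ∷ gs) (e ∷ gs) (X^ (length ms)) monic
      (Monic⇒Monicₖ (e ∷ gs) G-monic) (Monic⇒Monicₖ (X^ (length ms)) (X^-monic (length ms)))
      (≡.subst ((ms ++ e ∷ gs) k[X].≈ᴾ_) (≡.sym (*ᴾₖ≡ (e ∷ gs) (X^ (length ms))))
        (≈ᴾ⇒≈ᴾₖ (ms ++ e ∷ gs) ((e ∷ gs) *ᴾ X^ (length ms)) reduction))
      (u , v , ≡.subst (k[X]._≈ᴾ (1ᴬ ∷ [])) (≡.sym (≡.trans (+ᴾₖ≡ (u k[X].*ᴾ (e ∷ gs)) _)
          (≡.cong₂ _+ᴾ_ (*ᴾₖ≡ u (e ∷ gs)) (*ᴾₖ≡ v (X^ (length ms))))))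
        (≈ᴾ⇒≈ᴾₖ (combination u v) (1ᴬ ∷ []) (λ n → ≈⇒≈ₖ (coeff (combination u v) n) (coeff (1ᴬ ∷ []) n) (bezout n))))
    where
    combination : Poly → Poly → Poly
    combination u v = (u *ᴾ (e ∷ gs)) +ᴾ (v *ᴾ X^ (length ms))
    X^-monic : ∀ m → A[X].Monic (X^ m)
    X^-monic zero    = 0 , refl , λ { (suc _) _ → refl }
    X^-monic (suc m) with n , lead , above ← X^-monic m = suc n , lead , λ
      { (suc k) n<k → above k (ℕ.s≤s⁻¹ n<k) }
    -- The leading 1 of `f` cannot be among `ms`, whose members lie in `𝔪`; hence it is also the
    -- leading coefficient of the tail.
    G-monic : A[X].Monic (e ∷ gs)
    G-monic with <⊎+ (length ms) n
    ... | inj₁ n<m = contradiction (coeff-𝔪 (e ∷ gs) ms∈𝔪 n<m) (1∉𝔪 {coeff (ms ++ e ∷ gs) n} lead)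
    ... | inj₂ (j , ≡.refl) = j ,
      trans (reflexive (≡.cong proj₁ (≡.sym (coeff-++ ms j)))) lead ,
      λ k j<k → trans (reflexive (≡.cong proj₁ (≡.sym (coeff-++ ms k)))) (above (length ms ℕ.+ k) (ℕ.+-monoʳ-< (length ms) j<k))
    reduction : ∀ n → coeff (ms ++ e ∷ gs) n ≈ₖ coeff ((e ∷ gs) *ᴾ X^ (length ms)) n
    reduction n with <⊎+ (length ms) n
    ... | inj₁ n<m = 𝔪-resp {coeff (ms ++ e ∷ gs) n} {_ , +-closed (proj₂ (coeff (ms ++ e ∷ gs) n)) (neg-closed (proj₂ (coeff ((e ∷ gs) *ᴾ X^ (length ms)) n)))}
      (sym (trans (+-congˡ (trans (-‿cong (coeff-*ᴾX^-< (length ms) (e ∷ gs) n<m)) -0#≈0#)) (+-identityʳ _)))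
      (coeff-𝔪 (e ∷ gs) ms∈𝔪 n<m)
    ... | inj₂ (j , ≡.refl) = ≈⇒≈ₖ (coeff (ms ++ e ∷ gs) (length ms ℕ.+ j)) (coeff ((e ∷ gs) *ᴾ X^ (length ms)) (length ms ℕ.+ j))
      (trans (reflexive (≡.cong proj₁ (coeff-++ ms j))) (sym (coeff-*ᴾX^ (length ms) (e ∷ gs) j)))
  ... | g , h , _ , _ , f≈gh , g≈ , h≈ =
    length ms , e , gs , g , h , e∉𝔪 , f≈gh , ≈ᴾₖ⇒≈ᴾ g (e ∷ gs) g≈ , ≈ᴾₖ⇒≈ᴾ h (X^ (length ms)) h≈

  private
    module k = RawSemiringDefinitions (RawRing.rawSemiring residueField)
  open RawSemiringDefinitions rawSemiring using () renaming (_×_ to _×ᴷ_)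

  -- Multiples are formed with the operations of `residueField`, so that its characteristic speaks
  -- about them directly.
  numeral : ℕ → ∃ A
  numeral m = m k.× 1ᴬ

  numeral≡ : ∀ m → proj₁ (numeral m) ≡ m ×ᴷ 1#
  numeral≡ zero    = ≡.refl
  numeral≡ (suc m) = ≡.cong (1# +_) (numeral≡ m)

  numeral-* : ∀ m n → proj₁ (numeral (m ℕ.* n)) ≈ proj₁ (numeral m) * proj₁ (numeral n)
  numeral-* m n rewrite numeral≡ m | numeral≡ n | numeral≡ (m ℕ.* n) = ×1-homo-* m n

  module _ {p : ℕ} (0<p : 0 ℕ.< p) (char : HasCharacteristic residueField p) where

    numeral-unit : ∀ m → .{{ℕ.NonZero m}} → m ℕ.< p → IsUnit (numeral m)
    numeral-unit m m<p = ∉𝔪⇒unit {numeral m} (λ m∈𝔪 → >⇒∤ m<p (Equivalence.to (char m)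
      (𝔪-resp {numeral m} {proj₁ (numeral m) - 0# , +-closed (proj₂ (numeral m)) (neg-closed 0∈A)}
        (sym (trans (+-congˡ -0#≈0#) (+-identityʳ _))) m∈𝔪)))

    numeral-p∈𝔪 : 𝔪 (numeral p)
    numeral-p∈𝔪 = 𝔪-resp {proj₁ (numeral p) - 0# , +-closed (proj₂ (numeral p)) (neg-closed 0∈A)} {numeral p}
      (trans (+-congˡ -0#≈0#) (+-identityʳ _)) (Equivalence.from (char p) ∣-refl)

    units-product : ∀ q d → p ≡ q ℕ.* d → IsUnit (numeral q) → IsUnit (numeral d) → ¬ 𝔪 (numeral p)
    units-product q d ≡.refl (q′ , q′∈ , qq′≈1) (d′ , d′∈ , dd′≈1) p∈𝔪 = p∈𝔪 (q′ * d′ , *-closed q′∈ d′∈ ,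
      trans (*-congʳ (numeral-* q d)) (trans
        (solve 4 (λ q d q′ d′ → q :* d :* (q′ :* d′) := q :* q′ :* (d :* d′)) refl _ _ q′ d′)
        (trans (*-cong qq′≈1 dd′≈1) (*-identityˡ 1#))))

    -- Proper divisors of `p` are nonzero in `k`, hence units of `A`; if `p` were a product of two
    -- of them it would be a unit, whereas it lies in `𝔪`. For `p = 1` the unit 1 would lie in `𝔪`.
    residue-characteristic-prime : Prime p
    residue-characteristic-prime = go p ≡.refl
      where
      not-composite : ¬ Composite p
      not-composite (composite {d} d<p (divides zero    p≡0))  = ℕ.<⇒≢ 0<p (≡.sym p≡0)
      not-composite (composite {d} d<p (divides q@(suc _) p≡qd)) = units-product q d p≡qd
        (numeral-unit q (≡.subst (q ℕ.<_) (≡.sym p≡qd) (ℕ.m<m*n q d (ℕ.nonTrivial⇒n>1 d))))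
        (numeral-unit d {{ℕ.nonTrivial⇒nonZero d}} d<p) numeral-p∈𝔪
      go : ∀ m → p ≡ m → Prime p
      go zero          p≡0 = contradiction (≡.sym p≡0) (ℕ.<⇒≢ 0<p)
      go (suc zero)    p≡1 = contradiction numeral-p∈𝔪
        (1∉𝔪 {numeral p} (trans (reflexive (≡.cong (λ m → proj₁ (numeral m)) p≡1)) (+-identityʳ 1#)))
      go (suc (suc _)) ≡.refl = prime not-composite

-- The embedding of `K` into `L`

module ExtensionProperties (em : ∀ {e} → ExcludedMiddle e) {c ℓ c′ ℓ′ : Level}
  {K : Field c ℓ} (E : FieldExtension K c′ ℓ′) where
  open FieldExtension E
  private
    module K = Field K
    module KP = FieldProperties K
  open Field L
  open FieldProperties L
  open RingMorphisms.IsRingHomomorphism ι-isRingHomomorphism public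
    using () renaming (⟦⟧-cong to ι-cong; +-homo to ι-+; *-homo to ι-*; -‿homo to ι-neg; 0#-homo to ι-0; 1#-homo to ι-1)

  ι-sub : ∀ x y → ι (x K.- y) ≈ ι x - ι y
  ι-sub x y = trans (ι-+ x (K.- y)) (+-congˡ (ι-neg y))

  ι-^ : ∀ x n → ι (x K.^ n) ≈ ι x ^ n
  ι-^ x zero    = ι-1
  ι-^ x (suc n) = trans (ι-* x (x K.^ n)) (*-congˡ (ι-^ x n))

  ι-inverse : ∀ {x y} → x K.* y K.≈ K.1# → ι x * ι y ≈ 1#
  ι-inverse {x} {y} eq = trans (sym (ι-* x y)) (trans (ι-cong eq) ι-1)

  ι-nonzero : ∀ {x} → x K.≉ K.0# → ι x ≉ 0#
  ι-nonzero x≉0 = unit-nonzeroˡ (ι-inverse (proj₂ (K.inverse x≉0)))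

  ι≈0⇒≈0 : ∀ {x} → ι x ≈ 0# → x K.≈ K.0#
  ι≈0⇒≈0 {x} ιx≈0 with em {P = x K.≈ K.0#}
  ... | yes x≈0 = x≈0
  ... | no x≉0  = contradiction ιx≈0 (ι-nonzero x≉0)

  ι-injective : ∀ {x y} → ι x ≈ ι y → x K.≈ y
  ι-injective {x} {y} eq = KP.x-y≈0⇒x≈y (ι≈0⇒≈0 (trans (ι-sub x y) (x≈y⇒x-y≈0 eq)))

  Image : ∀ {r} → Pred K.Carrier r → Pred Carrier (c ⊔ ℓ′ ⊔ r)
  Image R x = ∃ λ a → a ∈ R × ι a ≈ x

  Image-isSubring : ∀ {r} {R : Pred K.Carrier r} → Subring K R → Subring L (Image R)
  Image-isSubring isSubring = record
    { resp       = λ { eq (a , a∈ , ιa≈) → a , a∈ , trans ιa≈ eq }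
    ; 0∈         = K.0# , R.0∈ , ι-0
    ; 1∈         = K.1# , R.1∈ , ι-1
    ; +-closed   = λ { (a , a∈ , ιa≈) (b , b∈ , ιb≈) →
        a K.+ b , R.+-closed a∈ b∈ , trans (ι-+ a b) (+-cong ιa≈ ιb≈) }
    ; *-closed   = λ { (a , a∈ , ιa≈) (b , b∈ , ιb≈) →
        a K.* b , R.*-closed a∈ b∈ , trans (ι-* a b) (*-cong ιa≈ ιb≈) }
    ; neg-closed = λ { (a , a∈ , ιa≈) → K.- a , R.neg-closed a∈ , trans (ι-neg a) (-‿cong ιa≈) }
    }
    where module R = Subring isSubring

  U-isSubring : Subring K U
  U-isSubring = _

-- The integral closure of `A` in `L` as a local ring and a valuation ring

module IntegralClosure (em : ∀ {e} → ExcludedMiddle e) {c ℓ a c′ ℓ′ : Level}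
  {K : Field c ℓ} (V : ValuationRing K a) (E : FieldExtension K c′ ℓ′) where
  open FieldExtension E using (L; ι)
  open ExtensionProperties em E
  open ValuationRingProperties em V
  private
    module K = Field K
    module V = ValuationRing V
    module KS = RingSolver (Field.commutativeRing K)
  open V using (A; 𝔪; Henselian)
  open Field L
  open FieldProperties L
  open RingSolver commutativeRing
  open import Relation.Binary.Reasoning.Setoid setoid

  -- Integrality over all of `K` is algebraicity, so the same development covers both notions.
  module Alg = Integrality em L (Image U) (Image-isSubring U-isSubring)
  open Integrality em L (Image A) (Image-isSubring A-isSubring) public
  open Subring Int-isSubring public using ()
    renaming (neg-closed to Int-neg; 0∈ to Int-0)

  A⊆Int : ∀ {x} → x ∈ A → Int (ι x)
  A⊆Int {x} x∈ = R⊆Int (x , x∈ , refl)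

  open A[X] using (Poly; coeff; _+ᴾ_; _*ᴾ_)

  ev : Poly → Carrier → Carrier
  ev f x = Polynomials.eval rawRing (map (λ t → ι (proj₁ t)) f) x

  ev-≈0 : ∀ f {x} → (∀ n → coeff₀ f n K.≈ K.0#) → ev f x ≈ 0#
  ev-≈0 []      eq = refl
  ev-≈0 (t ∷ f) {x} eq = begin
    ι (proj₁ t) + x * ev f x  ≈⟨ +-cong (trans (ι-cong (eq 0)) ι-0) (*-congˡ (ev-≈0 f (λ n → eq (suc n)))) ⟩
    0# + x * 0#               ≈⟨ solve 1 (λ x → :0 :+ x :* :0 := :0) refl x ⟩
    0#                        ∎

  ev-cong : ∀ f g {x} → (∀ n → coeff₀ f n K.≈ coeff₀ g n) → ev f x ≈ ev g x
  ev-cong []      g       eq = sym (ev-≈0 g (λ n → K.sym (eq n)))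
  ev-cong (t ∷ f) []      eq = ev-≈0 (t ∷ f) eq
  ev-cong (t ∷ f) (s ∷ g) eq = +-cong (ι-cong (eq 0)) (*-congˡ (ev-cong f g (λ n → eq (suc n))))

  ev-+ᴾ : ∀ f g {x} → ev (f +ᴾ g) x ≈ ev f x + ev g x
  ev-+ᴾ []      g       = sym (+-identityˡ _)
  ev-+ᴾ (t ∷ f) []      = sym (+-identityʳ _)
  ev-+ᴾ (t ∷ f) (s ∷ g) {x} = begin
    ι (proj₁ t K.+ proj₁ s) + x * ev (f +ᴾ g) x             ≈⟨ +-cong (ι-+ _ _) (*-congˡ (ev-+ᴾ f g)) ⟩
    ι (proj₁ t) + ι (proj₁ s) + x * (ev f x + ev g x)
      ≈⟨ solve 5 (λ t s x f g → t :+ s :+ x :* (f :+ g) := t :+ x :* f :+ (s :+ x :* g)) refl _ _ x _ _ ⟩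
    ι (proj₁ t) + x * ev f x + (ι (proj₁ s) + x * ev g x)   ∎

  ev-*ᴾ : ∀ f g {x} → ev (f *ᴾ g) x ≈ ev f x * ev g x
  ev-*ᴾ []      g = sym (zeroˡ _)
  ev-*ᴾ (t ∷ f) g {x} = begin
    ev (tg +ᴾ (0ᴬ ∷ f *ᴾ g)) x                     ≈⟨ ev-+ᴾ tg (0ᴬ ∷ f *ᴾ g) ⟩
    ev tg x + (ι K.0# + x * ev (f *ᴾ g) x)         ≈⟨ +-cong (scale g) (+-cong ι-0 (*-congˡ (ev-*ᴾ f g))) ⟩
    ι (proj₁ t) * ev g x + (0# + x * (ev f x * ev g x))
      ≈⟨ solve 4 (λ t x f g → t :* g :+ (:0 :+ x :* (f :* g)) := (t :+ x :* f) :* g) refl _ x _ _ ⟩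
    (ι (proj₁ t) + x * ev f x) * ev g x            ∎
    where
    t· : ∃ A → ∃ A
    t· s = proj₁ t K.* proj₁ s , V.*-closed (proj₂ t) (proj₂ s)
    tg = map t· g
    scale : ∀ g → ev (map t· g) x ≈ ι (proj₁ t) * ev g x
    scale []      = sym (zeroʳ _)
    scale (s ∷ g) = begin
      ι (proj₁ t K.* proj₁ s) + x * ev (map t· g) x           ≈⟨ +-cong (ι-* _ _) (*-congˡ (scale g)) ⟩
      ι (proj₁ t) * ι (proj₁ s) + x * (ι (proj₁ t) * ev g x)
        ≈⟨ solve 4 (λ t s x g → t :* s :+ x :* (t :* g) := t :* (s :+ x :* g)) refl _ _ x _ ⟩
      ι (proj₁ t) * (ι (proj₁ s) + x * ev g x)                ∎

  Int-ev : ∀ f {u} → Int u → Int (ev f u)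
  Int-ev []      iu = Int-0
  Int-ev (t ∷ f) iu = Int-+ (A⊆Int (proj₂ t)) (Int-* iu (Int-ev f iu))

  Low⇒Poly : ∀ {u n y} → Low u n y → ∃ λ f → length f ≡ n × ev f u ≈ y
  Low⇒Poly (low₀ y≈0) = [] , ≡.refl , sym y≈0
  Low⇒Poly (lowₛ (b , b∈ , ιb≈) ly y≈) with f , len , eq ← Low⇒Poly ly =
    (b , b∈) ∷ f , ≡.cong suc len , trans (+-cong ιb≈ (*-congˡ eq)) (sym y≈)

  ev-snoc : ∀ f {u} → ev (f ++ 1ᴬ ∷ []) u ≈ ev f u + u ^ length f
  ev-snoc [] {u} = trans (+-congʳ ι-1) (solve 1 (λ u → :1 :+ u :* :0 := :0 :+ :1) refl u)
  ev-snoc (t ∷ f) {u} = trans (+-congˡ (*-congˡ (ev-snoc f)))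
    (solve 4 (λ t u f w → t :+ u :* (f :+ w) := t :+ u :* f :+ u :* w) refl _ u _ _)

  snoc-monic : ∀ f → A[X].Monic (f ++ 1ᴬ ∷ [])
  snoc-monic []      = 0 , K.refl , λ { (suc _) _ → K.refl }
  snoc-monic (t ∷ f) with n , lead , above ← snoc-monic f =
    suc n , lead , λ { (suc m) n<m → above m (ℕ.s≤s⁻¹ n<m) }

  Int⇒root : ∀ {u} → Int u → ∃ λ f → A[X].Monic f × ev f u ≈ 0#
  Int⇒root {u} (n , l) with f , ≡.refl , eq ← Low⇒Poly (Low-neg l) =
    f ++ 1ᴬ ∷ [] , snoc-monic f ,
    trans (ev-snoc f) (trans (+-congʳ eq) (-‿inverseˡ _))

  root⇒Int : ∀ f {u} → A[X].Monic f → ev f u ≈ 0# → Int u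
  root⇒Int f {u} (n , monic) root with go n f monic
    where
    go : ∀ n f → coeff₀ f n K.≈ K.1# × (∀ m → n ℕ.< m → coeff₀ f m K.≈ K.0#) →
      ∃ λ y → Low u n y × ev f u ≈ u ^ n + y
    go n       []      (lead , _)     = contradiction (K.sym lead) K.1≉0
    go zero    (t ∷ f) (lead , above) = 0# , low₀ refl , (begin
      ι (proj₁ t) + u * ev f u  ≈⟨ +-cong (trans (ι-cong lead) ι-1) (*-congˡ (ev-≈0 f (λ m → above (suc m) ℕ.z<s))) ⟩
      1# + u * 0#               ≈⟨ +-congˡ (zeroʳ u) ⟩
      1# + 0#                   ∎)
    go (suc n) (t ∷ f) (lead , above) with y , ly , eq ← go n f (lead , λ m n<m → above (suc m) (ℕ.s<s n<m)) =
      ι (proj₁ t) + u * y , lowₛ (proj₁ t , proj₂ t , refl) ly refl ,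
      trans (+-congˡ (*-congˡ eq))
        (solve 4 (λ t u w y → t :+ u :* (w :+ y) := u :* w :+ (t :+ u :* y)) refl _ u _ y)
  ... | y , ly , eq = n , Low-resp (sym (x-y≈0⇒x≈y (trans (+-congˡ (-‿involutive y)) (trans (sym eq) root)))) (Low-neg ly)

  -- If `y = x⁻¹` lies in `A`, multiplying an equation of degree `n + 1` by `yⁿ` isolates `x` and
  -- turns all other terms into elements of `A`.
  Int∩K⊆A : ∀ {x} → Int (ι x) → x ∈ A
  Int∩K⊆A {x} (n , l) with ∈A⊎inverse∈A x
  ... | inj₁ x∈ = x∈
  ... | inj₂ (y , y∈ , xy≈1) = go n l
    where
    lower : ∀ n {z} → Low (ι x) (suc n) z → Image A (ι y ^ n * z)
    lower zero (lowₛ (b , b∈ , ιb≈) (low₀ w≈0) z≈) = b , b∈ , trans ιb≈ (sym (trans (*-identityˡ _)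
      (trans z≈ (trans (+-congˡ (trans (*-congˡ w≈0) (zeroʳ _))) (+-identityʳ _)))))
    lower (suc n) {z} (lowₛ {y = w} (b , b∈ , ιb≈) lw z≈) with d , d∈ , ιd≈ ← lower n lw =
      y K.^ suc n K.* b K.+ d ,
      V.+-closed (V.*-closed (Subring.^-closed A-isSubring (suc n) y∈) b∈) d∈ , (begin
        ι (y K.^ suc n K.* b K.+ d)                     ≈⟨ trans (ι-+ _ d) (+-congʳ (ι-* _ b)) ⟩
        ι (y K.^ suc n) * ι b + ι d                     ≈⟨ +-cong (*-congʳ (ι-^ y (suc n))) ιd≈ ⟩
        ι y ^ suc n * ι b + ι y ^ n * w                 ≈⟨ +-cong (*-congˡ (sym ιb≈)) (*-congʳ (*-identityˡ _)) ⟨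
        ι y ^ suc n * _ + 1# * ι y ^ n * w              ≈⟨ +-congˡ (*-congʳ (*-congʳ (ι-inverse xy≈1))) ⟨
        ι y ^ suc n * _ + ι x * ι y * ι y ^ n * w
          ≈⟨ solve 5 (λ x y yⁿ b w → y :* yⁿ :* b :+ x :* y :* yⁿ :* w := y :* yⁿ :* (b :+ x :* w)) refl (ι x) (ι y) _ _ w ⟩
        ι y ^ suc n * (_ + ι x * w)                     ≈⟨ *-congˡ z≈ ⟨
        ι y ^ suc n * z                                 ∎)
    cancel : ∀ n → ι y ^ n * (ι x ^ suc n) ≈ ι x
    cancel zero    = solve 1 (λ x → :1 :* (x :* :1) := x) refl (ι x)
    cancel (suc n) = trans
      (solve 4 (λ x y xⁿ yⁿ → y :* yⁿ :* (x :* xⁿ) := x :* y :* (yⁿ :* xⁿ)) refl (ι x) (ι y) _ _)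
      (trans (*-cong (ι-inverse xy≈1) (cancel n)) (*-identityˡ _))
    go : ∀ n → Low (ι x) n (ι x ^ n) → x ∈ A
    go zero    (low₀ 1≈0) = contradiction 1≈0 1≉0
    go (suc n) l with d , d∈ , ιd≈ ← lower n l = V.resp (ι-injective (trans ιd≈ (cancel n))) d∈

  -- The value `f(1)`, computed inside `A` so that it can be reduced modulo `𝔪`.
  sumᴬ : Poly → ∃ A
  sumᴬ []      = 0ᴬ
  sumᴬ (t ∷ f) = proj₁ t K.+ proj₁ (sumᴬ f) , V.+-closed (proj₂ t) (proj₂ (sumᴬ f))

  sumᴬ-X^ : ∀ n → proj₁ (sumᴬ (X^ n)) K.≈ K.1#
  sumᴬ-X^ zero    = K.+-identityʳ _
  sumᴬ-X^ (suc n) = K.trans (K.+-identityˡ _) (sumᴬ-X^ n)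

  private
    d : ∃ A → ∃ A → ∃ A
    d x y = proj₁ x K.- proj₁ y , V.+-closed (proj₂ x) (V.neg-closed (proj₂ y))

  sumᴬ-≈ₖ : ∀ f g → (∀ n → coeff f n ≈ₖ coeff g n) → sumᴬ f ≈ₖ sumᴬ g
  sumᴬ-≈ₖ []      []      eq = ≈⇒≈ₖ 0ᴬ 0ᴬ K.refl
  sumᴬ-≈ₖ (t ∷ f) []      eq = 𝔪-+ {d t 0ᴬ} {d (sumᴬ f) 0ᴬ} {d (sumᴬ (t ∷ f)) 0ᴬ}
    (KS.solve 2 (λ x y → x KS.:+ y KS.:- KS.:0 KS.:= (x KS.:- KS.:0) KS.:+ (y KS.:- KS.:0)) K.refl _ _)
    (eq 0) (sumᴬ-≈ₖ f [] (λ n → eq (suc n)))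
  sumᴬ-≈ₖ []      (s ∷ g) eq = 𝔪-+ {d 0ᴬ s} {d 0ᴬ (sumᴬ g)} {d 0ᴬ (sumᴬ (s ∷ g))}
    (KS.solve 2 (λ x y → KS.:0 KS.:- (x KS.:+ y) KS.:= (KS.:0 KS.:- x) KS.:+ (KS.:0 KS.:- y)) K.refl _ _)
    (eq 0) (sumᴬ-≈ₖ [] g (λ n → eq (suc n)))
  sumᴬ-≈ₖ (t ∷ f) (s ∷ g) eq = 𝔪-+ {d t s} {d (sumᴬ f) (sumᴬ g)} {d (sumᴬ (t ∷ f)) (sumᴬ (s ∷ g))}
    (KS.solve 4 (λ x y u v → x KS.:+ y KS.:- (u KS.:+ v) KS.:= (x KS.:- u) KS.:+ (y KS.:- v)) K.refl _ _ _ _)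
    (eq 0) (sumᴬ-≈ₖ f g (λ n → eq (suc n)))

  -- Division of `f` by `X - 1`: the remainder is `f(1)`, and the quotient evaluated at `u` is again
  -- integral.
  ev-1 : ∀ f {u} → Int u → ∃ λ w → Int w × ι (proj₁ (sumᴬ f)) + (u - 1#) * w ≈ ev f u
  ev-1 []      {u} iu = 0# , Int-0 , trans (+-cong ι-0 (zeroʳ _)) (+-identityʳ _)
  ev-1 (t ∷ f) {u} iu with w , iw , eq ← ev-1 f iu =
    w + ev f u , Int-+ iw (Int-ev f iu) , (begin
      ι (proj₁ t K.+ s) + (u - 1#) * (w + ev f u)           ≈⟨ +-congʳ (ι-+ _ s) ⟩
      ι (proj₁ t) + ι s + (u - 1#) * (w + ev f u)
        ≈⟨ solve 5 (λ t s u w v → t :+ s :+ (u :- :1) :* (w :+ v) := t :+ (s :+ (u :- :1) :* w) :+ (u :- :1) :* v) refl _ _ u w _ ⟩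
      ι (proj₁ t) + (ι s + (u - 1#) * w) + (u - 1#) * ev f u ≈⟨ +-congʳ (+-congˡ eq) ⟩
      ι (proj₁ t) + ev f u + (u - 1#) * ev f u
        ≈⟨ solve 3 (λ t u v → t :+ v :+ (u :- :1) :* v := t :+ u :* v) refl _ u _ ⟩
      ι (proj₁ t) + u * ev f u                               ∎)
    where s = proj₁ (sumᴬ f)

  -- B is a local ring: a factor of a monic equation of u whose reduction is
  -- prime to X makes u a unit, one whose reduction is a power of X makes
  -- u - 1 a unit.
  Int-local : Henselian → ∀ {u} → Int u → ∃ λ v → Int v × (u * v ≈ 1# ⊎ (u - 1#) * v ≈ 1#)
  Int-local hensel {u} iu with f , monic , root ← Int⇒root iu
    with m , e , gs , g , h , e∉𝔪 , f≈gh , g≈ , h≈ ← hensel-factors hensel f monic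
    with gh≈0 ← trans (sym (trans (ev-cong f (g *ᴾ h) f≈gh) (ev-*ᴾ g h))) root
    with em {P = ev g u ≈ 0#}
  ... | yes g≈0 = from-g g g≈ g≈0
    where
    from-g : ∀ g → (∀ n → coeff g n ≈ₖ coeff (e ∷ gs) n) → ev g u ≈ 0# →
      ∃ λ v → Int v × (u * v ≈ 1# ⊎ (u - 1#) * v ≈ 1#)
    from-g []      g≈ _ = contradiction (𝔪-0 {0ᴬ} K.refl)
      (≡ₖ-unit {0ᴬ} {e} {d 0ᴬ e} K.refl (g≈ 0) e∉𝔪)
    -- The constant term `t` is congruent to `e`, hence a unit, and `t + u g(u) = 0` for the tail
    -- `g` exhibits `- g(u) / t` as the inverse of `u`.
    from-g (t ∷ g) g≈ eq with t′ , t′∈ , tt′≈1 ← ∉𝔪⇒unit {t} (≡ₖ-unit {t} {e} {d t e} K.refl (g≈ 0) e∉𝔪) =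
      - (ev g u * ι t′) , Int-neg (Int-* (Int-ev g iu) (A⊆Int t′∈)) , inj₁ (begin
        u * - (ev g u * ι t′)
          ≈⟨ solve 4 (λ u v t t′ → u :* :- (v :* t′) := t :* t′ :- (t :+ u :* v) :* t′) refl u _ (ι (proj₁ t)) (ι t′) ⟩
        ι (proj₁ t) * ι t′ - (ι (proj₁ t) + u * ev g u) * ι t′  ≈⟨ +-cong (ι-inverse tt′≈1) (-‿cong (*-congʳ eq)) ⟩
        1# - 0# * ι t′  ≈⟨ solve 1 (λ t → :1 :- :0 :* t := :1) refl (ι t′) ⟩
        1#  ∎)
  -- Now `h(u) = 0`. Since `h(1)` is congruent to 1 it is a unit, and `h(1) + (u - 1) w = 0` inverts
  -- `u - 1`.
  ... | no g≉0 with w , iw , eq ← ev-1 h iu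
    with s′ , s′∈ , ss′≈1 ← ∉𝔪⇒unit {sumᴬ h} (≡ₖ-unit {sumᴬ h} {sumᴬ (X^ m)} {d (sumᴬ h) (sumᴬ (X^ m))} K.refl
      (sumᴬ-≈ₖ h (X^ m) h≈) (1∉𝔪 {sumᴬ (X^ m)} (sumᴬ-X^ m))) =
    - (w * ι s′) , Int-neg (Int-* iw (A⊆Int s′∈)) , inj₂ (begin
      (u - 1#) * - (w * ι s′)
        ≈⟨ solve 4 (λ u w s s′ → (u :- :1) :* :- (w :* s′) := s :* s′ :- (s :+ (u :- :1) :* w) :* s′) refl u w s (ι s′) ⟩
      s * ι s′ - (s + (u - 1#) * w) * ι s′
        ≈⟨ +-cong (ι-inverse ss′≈1) (-‿cong (*-congʳ (trans eq (x*y≈0⇒y≈0 g≉0 gh≈0)))) ⟩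
      1# - 0# * ι s′  ≈⟨ solve 1 (λ t → :1 :- :0 :* t := :1) refl (ι s′) ⟩
      1#  ∎)
    where s = ι (proj₁ (sumᴬ h))

  -- If c₀ + c₁ x + ⋯ = 0 is scaled so that all coefficients lie in A and one
  -- of them is 1, then cutting the left-hand side at that coefficient gives
  -- p + xᵏ (1 + x s).
  scale-relation : ∀ {x n y} → Alg.Low x n y → ∃ λ d →
    ∃₂ λ k m → k ℕ.+ m ≡ n × ∃₂ λ p s → Low x k p × Low x m s ×
    ι d * (y + x ^ n) ≈ p + x ^ k * (1# + x * s)
  scale-relation {x} (Alg.low₀ y≈0) = K.1# , 0 , 0 , ≡.refl , 0# , 0# , low₀ refl , low₀ refl ,
    trans (*-cong ι-1 (+-congʳ y≈0)) (solve 1 (λ x → :1 :* (:0 :+ :1) := :0 :+ :1 :* (:1 :+ x :* :0)) refl x)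
  scale-relation {x} {suc n} {y} (Alg.lowₛ {a = a} {z} (c , _ , ιc≈) lz y≈)
    with d , k , m , ≡.refl , p , s , lp , ls , eq ← scale-relation lz
    with ∈A⊎inverse∈A (d K.* c)
  ... | inj₁ dc∈ = d , suc k , m , ≡.refl , ι (d K.* c) + x * p , s ,
    lowₛ (d K.* c , dc∈ , refl) lp refl , ls , unscaled
    where
    unscaled : ι d * (y + x * x ^ n) ≈ ι (d K.* c) + x * p + x * x ^ k * (1# + x * s)
    unscaled = begin
      ι d * (y + x * x ^ n)               ≈⟨ *-congˡ (+-congʳ (trans y≈ (+-congʳ (sym ιc≈)))) ⟩
      ι d * (ι c + x * z + x * x ^ n)
        ≈⟨ solve 5 (λ d c x z w → d :* (c :+ x :* z :+ x :* w) := d :* c :+ x :* (d :* (z :+ w))) refl _ _ x z _ ⟩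
      ι d * ι c + x * (ι d * (z + x ^ n)) ≈⟨ +-cong (sym (ι-* d c)) (*-congˡ eq) ⟩
      ι (d K.* c) + x * (p + x ^ k * (1# + x * s))
        ≈⟨ solve 5 (λ c x p w s → c :+ x :* (p :+ w :* (:1 :+ x :* s)) := c :+ x :* p :+ x :* w :* (:1 :+ x :* s)) refl _ x p _ s ⟩
      ι (d K.* c) + x * p + x * x ^ k * (1# + x * s) ∎
  -- Here rescaling by `e`, the inverse of `d c`, makes the new constant coefficient 1 and keeps the
  -- others in `A`. The cut moves down to degree 0, and the earlier cut is absorbed into `s`.
  ... | inj₂ (e , e∈ , dce≈1) = e K.* d , 0 , suc n , ≡.refl , 0# , ι e * r ,
    low₀ refl , Low-scale (e , e∈ , refl) lr , (begin
      ι (e K.* d) * (y + x * x ^ n)       ≈⟨ *-cong (ι-* e d) (+-congʳ (trans y≈ (+-congʳ (sym ιc≈)))) ⟩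
      ι e * ι d * (ι c + x * z + x * x ^ n)
        ≈⟨ solve 6 (λ e d c x z w → e :* d :* (c :+ x :* z :+ x :* w) := d :* c :* e :+ x :* (e :* (d :* (z :+ w)))) refl (ι e) _ _ x z _ ⟩
      ι d * ι c * ι e + x * (ι e * (ι d * (z + x ^ n)))
        ≈⟨ +-cong (trans (*-congʳ (sym (ι-* d c))) (ι-inverse dce≈1)) (*-congˡ (*-congˡ eq)) ⟩
      1# + x * (ι e * r)                  ≈⟨ solve 1 (λ r → r := :0 :+ :1 :* r) refl _ ⟩
      0# + 1# * (1# + x * (ι e * r))      ∎)
    where
    r = p + x ^ k * (1# + x * s)
    lr : Low x (suc (k ℕ.+ m)) r
    lr = Low-+ (Low-mono (ℕ.≤-trans (ℕ.m≤m+n k m) (ℕ.n≤1+n _)) lp)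
      (≡.subst (λ j → Low x j (x ^ k * (1# + x * s))) (ℕ.+-suc k m) (Low-u^* k
        (lowₛ (K.1# , V.1∈A , ι-1) ls refl)))

  All-powers : ∀ {q} {P : Pred Carrier q} x n → (∀ j → j ℕ.< n → P (x ^ j)) → All P (powers x n)
  All-powers x zero    f = []
  All-powers x (suc n) f = f 0 ℕ.z<s ∷ All.map⁺ (All-powers x n (λ j j<n → f (suc j) (ℕ.s<s j<n)))

  -- Such a y maps A + A x + ⋯ + A xⁿ⁻¹ to itself.
  Low-integral : ∀ {x y} n k m → x ≉ 0# → Low x m y → Low x (suc k) (x ^ k * y) →
    m ℕ.+ k ℕ.≤ suc (suc n) → Int y
  Low-integral {x} {y} n k m x≉0 ly lky m+k≤ = integral-module 1# _ (powers-nonzero (suc n) x≉0)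
    (All.map Low⇒Comb (All-powers x (suc n) row))
    where
    row : ∀ j → j ℕ.< suc n → Low x (suc n) (y * x ^ j)
    -- For `j < k` the degree of `y xʲ` is below `m + j`, at most `n + 1`; for `j = k + i` the
    -- element `xⁱ (xᵏ y)` has degree at most `j`.
    row j j<n with <⊎+ k j
    ... | inj₁ j<k = Low-resp (*-comm _ _) (Low-mono
      (ℕ.s≤s⁻¹ (ℕ.≤-trans (ℕ.≤-reflexive (≡.cong suc (ℕ.+-comm j m)))
        (ℕ.≤-trans (ℕ.≤-reflexive (≡.sym (ℕ.+-suc m j))) (ℕ.≤-trans (ℕ.+-monoʳ-≤ m j<k) m+k≤))))
      (Low-u^* j ly))
    ... | inj₂ (i , ≡.refl) = Low-resp
      (trans (solve 3 (λ a b y → a :* (b :* y) := y :* (b :* a)) refl (x ^ i) (x ^ k) y) (*-congˡ (sym (^-homo-* x k i))))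
      (Low-mono (ℕ.≤-trans (ℕ.≤-reflexive (≡.trans (ℕ.+-suc i k) (≡.cong suc (ℕ.+-comm i k)))) j<n) (Low-u^* i lky))

  -- With b = 1 + x s, so that p + xᵏ b = 0, the elements b, x b and s are
  -- integral; B being local, b or b - 1 = x s is a unit of B.
  module Cut {x p s : Carrier} (x≉0 : x ≉ 0#) (n k m : ℕ) (k+m≡1+n : k ℕ.+ m ≡ suc n)
    (lp : Low x k p) (ls : Low x m s) (relation : p + x ^ k * (1# + x * s) ≈ 0#) where

    b = 1# + x * s

    xᵏb : - p ≈ x ^ k * b
    xᵏb = trans (solve 2 (λ p w → :- p := w :- (p :+ w)) refl p (x ^ k * b))
      (trans (+-congˡ (trans (-‿cong relation) -0#≈0#)) (+-identityʳ _))

    m+k≡1+n : m ℕ.+ k ≡ suc n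
    m+k≡1+n = ≡.trans (ℕ.+-comm m k) k+m≡1+n

    Low-b : Low x (suc m) b
    Low-b = lowₛ (K.1# , V.1∈A , ι-1) ls refl

    Int-b : Int b
    Int-b = Low-integral n k (suc m) x≉0 Low-b (Low-sucʳ (Low-resp xᵏb (Low-neg lp)))
      (ℕ.s≤s (ℕ.≤-reflexive m+k≡1+n))

    -- `xᵏ⁺¹ s = xᵏ b - xᵏ = - p - xᵏ` has degree at most `k`.
    Int-s : Int s
    Int-s = Low-integral n (suc k) m x≉0 ls
      (Low-sucʳ (Low-resp (trans
        (+-congʳ xᵏb) (solve 3 (λ w x s → w :* (:1 :+ x :* s) :- w :* :1 := x :* w :* s) refl (x ^ k) x s))
        (Low-+ (Low-sucʳ (Low-neg lp)) (Low-neg (≡.subst (λ j → Low x j (x ^ k * 1#)) (ℕ.+-comm k 1)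
          (Low-u^* k (R⊆Low₁ (K.1# , V.1∈A , ι-1))))))))
      (ℕ.≤-reflexive (≡.trans (ℕ.+-suc m k) (≡.cong suc m+k≡1+n)))

    Int-xb : Int (x * b)
    Int-xb = go k lp xᵏb m+k≡1+n
      where
      go : ∀ k → Low x k p → - p ≈ x ^ k * b → m ℕ.+ k ≡ suc n → Int (x * b)
      -- For `k = 0` there is no power `xᵏ⁻¹` to multiply with, but then `p = 0` forces `b = 0`.
      go zero (low₀ p≈0) eq _ = Int-resp (sym (trans (*-congˡ (trans (sym (*-identityˡ b))
        (trans (sym eq) (trans (-‿cong p≈0) -0#≈0#)))) (zeroʳ x))) Int-0
      go (suc k) lp eq m+k≡ = Low-integral n k (suc (suc m)) x≉0 (Low-u* Low-b)
        (Low-resp (trans eq (solve 3 (λ x w b → x :* w :* b := w :* (x :* b)) refl x (x ^ k) b)) (Low-neg lp))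
        (ℕ.≤-reflexive (≡.cong suc (≡.trans (≡.sym (ℕ.+-suc m k)) m+k≡)))

    conclude : Henselian → ∀ {x⁻¹} → x * x⁻¹ ≈ 1# → Int x ⊎ Int x⁻¹
    conclude hensel {x⁻¹} xx⁻¹≈1 = go (Int-local hensel Int-b)
      where
      go : (∃ λ v → Int v × (b * v ≈ 1# ⊎ (b - 1#) * v ≈ 1#)) → Int x ⊎ Int x⁻¹
      go (v , iv , inj₁ bv≈1) = inj₁ (Int-resp
        (trans (*-assoc _ _ _) (trans (*-congˡ bv≈1) (*-identityʳ x))) (Int-* Int-xb iv))
      go (v , iv , inj₂ xsv≈1) = inj₂ (Int-resp (begin
        s * v                           ≈⟨ *-identityˡ _ ⟨
        1# * (s * v)                    ≈⟨ *-congʳ xx⁻¹≈1 ⟨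
        x * x⁻¹ * (s * v)
          ≈⟨ solve 4 (λ x y s v → x :* y :* (s :* v) := (:1 :+ x :* s :- :1) :* v :* y) refl x x⁻¹ s v ⟩
        (b - 1#) * v * x⁻¹              ≈⟨ *-congʳ xsv≈1 ⟩
        1# * x⁻¹                        ≈⟨ *-identityˡ _ ⟩
        x⁻¹                             ∎) (Int-* Int-s iv))

  -- A local ring need not be a valuation ring; the equation of `x` over `K` supplies the integral
  -- element `1 + x s` on which locality decides between `x` and `x⁻¹`.
  Int-total : Henselian → ∀ {x x⁻¹} → x * x⁻¹ ≈ 1# → Alg.Int x → Int x ⊎ Int x⁻¹
  Int-total hensel {x} {x⁻¹} xx⁻¹≈1 (n , l)
    with d , k , m , k+m≡n , p , s , lp , ls , eq ← scale-relation (Alg.Low-neg l)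
    = go k m n k+m≡n lp ls (trans (sym eq) (trans (*-congˡ (-‿inverseˡ _)) (zeroʳ _)))
    where
    go : ∀ {p s} k m n → k ℕ.+ m ≡ n → Low x k p → Low x m s →
      p + x ^ k * (1# + x * s) ≈ 0# → Int x ⊎ Int x⁻¹
    go k m (suc n) k+m≡1+n lp ls eq =
      Cut.conclude (unit-nonzeroˡ xx⁻¹≈1) n k m k+m≡1+n lp ls eq hensel xx⁻¹≈1
    go zero zero zero ≡.refl (low₀ p≈0) (low₀ s≈0) eq = contradiction (trans (sym (trans
      (+-cong p≈0 (*-congˡ (+-congˡ (*-congˡ s≈0))))
      (solve 1 (λ x → :0 :+ :1 :* (:1 :+ x :* :0) := :1) refl x))) eq) 1≉0

-- Finite sums and products, roots of unity and q-binomial coefficients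

module Range {c ℓ : Level} (M : CommutativeMonoid c ℓ) where
  open CommutativeMonoid M
  open import Algebra.Properties.CommutativeMonoid.Sum M
    using (sum; sum-cong-≋; ∑-distrib-+)

  -- Terms are indexed by natural numbers so that sequences can be shifted beyond the range of
  -- summation.
  big : ℕ → (ℕ → Carrier) → Carrier
  big n f = sum {n} (λ i → f (toℕ i))

  big-cong : ∀ n {f g} → (∀ i → i ℕ.< n → f i ≈ g i) → big n f ≈ big n g
  big-cong n f≈g = sum-cong-≋ {n} (λ i → f≈g (toℕ i) (Fin.toℕ<n i))

  big-∙ : ∀ n f g → big n (λ i → f i ∙ g i) ≈ big n f ∙ big n g
  big-∙ n f g = ∑-distrib-+ {n} (λ i → f (toℕ i)) (λ i → g (toℕ i))

  big-suc : ∀ n f → big (suc n) f ≈ big n f ∙ f n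
  big-suc zero    f = trans (identityʳ _) (sym (identityˡ _))
  big-suc (suc n) f = trans (∙-congˡ (big-suc n (λ i → f (suc i)))) (sym (assoc _ _ _))

  big-hom : ∀ (h : Carrier → Carrier) → h ε ≈ ε → (∀ x y → h (x ∙ y) ≈ h x ∙ h y) →
    ∀ n f → h (big n f) ≈ big n (λ i → h (f i))
  big-hom h h-ε h-∙ zero    f = h-ε
  big-hom h h-ε h-∙ (suc n) f = trans (h-∙ _ _) (∙-congˡ (big-hom h h-ε h-∙ n (λ i → f (suc i))))

module Cyclotomic (em : ∀ {e} → ExcludedMiddle e) {c ℓ : Level} (F : Field c ℓ)
  (n : ℕ) (ζ : Field.Carrier F) (ζ-primitive : IsPrimitiveRoot F (suc n) ζ) where
  open Field F
  open FieldProperties F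
  open RingSolver commutativeRing
  open import Relation.Binary.Reasoning.Setoid setoid
  module ∑ = Range +-commutativeMonoid
  module ∏ = Range *-commutativeMonoid

  Sequence : Set c
  Sequence = ℕ → Carrier

  -- ∏ (1 - ζⁱ S) over 1 ≤ i ≤ m, for the shift S, and its coefficients.
  G : ℕ → Sequence → Sequence
  G zero    u k = u k
  G (suc m) u k = G m u k - ζ ^ suc m * G m u (suc k)

  g : ℕ → ℕ → Carrier
  g zero    zero    = 1#
  g zero    (suc k) = 0#
  g (suc m) zero    = g m 0
  g (suc m) (suc k) = g m (suc k) - ζ ^ suc m * g m k

  g-0 : ∀ m → g m 0 ≈ 1#
  g-0 zero    = refl
  g-0 (suc m) = g-0 m

  g-> : ∀ m {k} → m ℕ.< k → g m k ≈ 0#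
  g-> zero    {suc k} m<k = refl
  g-> (suc m) {suc k} m<k = begin
    g m (suc k) - ζ ^ suc m * g m k
      ≈⟨ +-cong (g-> m (ℕ.<-trans (ℕ.n<1+n m) m<k)) (-‿cong (*-congˡ (g-> m (ℕ.s≤s⁻¹ m<k)))) ⟩
    0# - ζ ^ suc m * 0#  ≈⟨ solve 1 (λ x → :0 :- x :* :0 := :0) refl _ ⟩
    0#                   ∎

  G≈∑g : ∀ m u k → G m u k ≈ ∑.big (suc m) (λ i → g m i * u (i ℕ.+ k))
  G≈∑g zero    u k = solve 1 (λ x → x := :1 :* x :+ :0) refl (u k)
  G≈∑g (suc m) u k = begin
    G m u k - q * G m u (suc k)
      ≈⟨ +-cong (G≈∑g m u k) (-‿cong (*-congˡ (G≈∑g m u (suc k)))) ⟩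
    ∑.big (suc m) a - q * ∑.big (suc m) b
      ≈⟨ +-cong (sym lastzero) (trans (-‿distribˡ-* q _) (∑.big-hom (- q *_) (zeroʳ _) (distribˡ _) (suc m) b)) ⟩
    ∑.big (suc (suc m)) a + ∑.big (suc m) (λ i → - q * b i)      ≈⟨ +-assoc _ _ _ ⟩
    a 0 + (∑.big (suc m) (λ i → a (suc i)) + ∑.big (suc m) (λ i → - q * b i))
      ≈⟨ +-congˡ (∑.big-∙ (suc m) (λ i → a (suc i)) (λ i → - q * b i)) ⟨
    a 0 + ∑.big (suc m) (λ i → a (suc i) + - q * b i)
      ≈⟨ +-congˡ (∑.big-cong (suc m) (λ i _ → term i)) ⟩
    ∑.big (suc (suc m)) (λ i → g (suc m) i * u (i ℕ.+ k))        ∎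
    where
    q = ζ ^ suc m
    a b : Sequence
    a i = g m i * u (i ℕ.+ k)
    b i = g m i * u (i ℕ.+ suc k)
    lastzero : ∑.big (suc (suc m)) a ≈ ∑.big (suc m) a
    lastzero = trans (∑.big-suc (suc m) a)
      (trans (+-congˡ (trans (*-congʳ (g-> m (ℕ.n<1+n m))) (zeroˡ _))) (+-identityʳ _))
    term : ∀ i → a (suc i) + - q * b i ≈ g (suc m) (suc i) * u (suc i ℕ.+ k)
    term i rewrite ℕ.+-suc i k =
      solve 4 (λ x y q u → x :* u :+ :- q :* (y :* u) := (x :- q :* y) :* u) refl _ _ q _

  -- The ratio of consecutive q-binomial coefficients.
  g-ratio : ∀ m k → (ζ ^ suc k - 1#) * g m (suc k) ≈ (ζ ^ suc k - ζ ^ suc m) * g m k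
  g-ratio zero zero    = solve 1 (λ x → (x :- :1) :* :0 := (x :- x) :* :1) refl (ζ ^ 1)
  g-ratio zero (suc k) = trans (zeroʳ _) (sym (zeroʳ _))
  g-ratio (suc m) zero = begin
    (ζ ^ 1 - 1#) * (g m 1 - q * g m 0)
      ≈⟨ solve 4 (λ w q x y → (w :- :1) :* (x :- q :* y) := (w :- :1) :* x :- (w :- :1) :* (q :* y)) refl (ζ ^ 1) q _ _ ⟩
    (ζ ^ 1 - 1#) * g m 1 - (ζ ^ 1 - 1#) * (q * g m 0)   ≈⟨ +-congʳ (g-ratio m 0) ⟩
    (ζ ^ 1 - q) * g m 0 - (ζ ^ 1 - 1#) * (q * g m 0)
      ≈⟨ solve 3 (λ z q y → (z :* :1 :- q) :* y :- (z :* :1 :- :1) :* (q :* y) := (z :* :1 :- z :* q) :* y) refl ζ q _ ⟩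
    (ζ ^ 1 - ζ * q) * g m 0                             ∎
    where q = ζ ^ suc m
  g-ratio (suc m) (suc k) = begin
    (ζ * w - 1#) * (g m (suc (suc k)) - q * g m (suc k))
      ≈⟨ solve 4 (λ w q x y → (w :- :1) :* (x :- q :* y) := (w :- :1) :* x :- (w :- :1) :* (q :* y)) refl (ζ * w) q _ _ ⟩
    (ζ * w - 1#) * g m (suc (suc k)) - (ζ * w - 1#) * (q * g m (suc k))
      ≈⟨ +-congʳ (g-ratio m (suc k)) ⟩
    (ζ * w - q) * g m (suc k) - (ζ * w - 1#) * (q * g m (suc k))
      ≈⟨ solve 4 (λ z w q y → (z :* w :- q) :* y :- (z :* w :- :1) :* (q :* y)
           := (z :* w :- z :* q) :* y :- z :* (q :* ((w :- :1) :* y))) refl ζ w q _ ⟩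
    (ζ * w - ζ * q) * g m (suc k) - ζ * (q * ((w - 1#) * g m (suc k)))
      ≈⟨ +-congˡ (-‿cong (*-congˡ (*-congˡ (g-ratio m k)))) ⟩
    (ζ * w - ζ * q) * g m (suc k) - ζ * (q * ((w - q) * g m k))
      ≈⟨ solve 5 (λ z w q x y → (z :* w :- z :* q) :* x :- z :* (q :* ((w :- q) :* y))
           := (z :* w :- z :* q) :* (x :- q :* y)) refl ζ w q _ _ ⟩
    (ζ * w - ζ * q) * (g m (suc k) - q * g m k)         ∎
    where
    q = ζ ^ suc m
    w = ζ ^ suc k

  ζ^p≈1 : ζ ^ suc n ≈ 1#
  ζ^p≈1 = proj₁ ζ-primitive

  -- As `ζ ^ suc n = 1`, both factors in `g-ratio` become `ζ ^ suc k - 1`, which primitivity allows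
  -- to cancel. So `∏ (1 - ζⁱ X)` over `1 ≤ i ≤ n` is `1 + X + ⋯ + Xⁿ`.
  g≈1 : ∀ k → k ℕ.≤ n → g n k ≈ 1#
  g≈1 zero    k≤n = g-0 n
  g≈1 (suc k) k≤n = *-cancelˡ (λ eq → proj₂ ζ-primitive (suc k) ℕ.z<s (ℕ.s≤s k≤n) (x-y≈0⇒x≈y eq))
    (trans (g-ratio n k) (*-cong (+-congˡ (-‿cong ζ^p≈1)) (g≈1 k (ℕ.<⇒≤ k≤n))))

  -- Formulated for the shift on sequences to serve twice: on the powers of `x` it factors `1 - xᵖ`,
  -- and on an orbit of `σ` it turns a product of operators into the trace.
  G≈∑ : ∀ u k → G n u k ≈ ∑.big (suc n) (λ i → u (i ℕ.+ k))
  G≈∑ u k = trans (G≈∑g n u k) (∑.big-cong (suc n) {g = λ i → u (i ℕ.+ k)}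
    (λ i i<1+n → trans (*-congʳ (g≈1 i (ℕ.s≤s⁻¹ i<1+n))) (*-identityˡ _)))

  geometric : ∀ x m → (1# - x) * ∑.big m (x ^_) ≈ 1# - x ^ m
  geometric x zero    = solve 1 (λ x → (:1 :- x) :* :0 := :1 :- :1) refl x
  geometric x (suc m) = begin
    (1# - x) * ∑.big (suc m) (x ^_)      ≈⟨ *-congˡ (∑.big-suc m (x ^_)) ⟩
    (1# - x) * (∑.big m (x ^_) + x ^ m)  ≈⟨ distribˡ _ _ _ ⟩
    (1# - x) * ∑.big m (x ^_) + (1# - x) * x ^ m  ≈⟨ +-congʳ (geometric x m) ⟩
    1# - x ^ m + (1# - x) * x ^ m        ≈⟨ solve 2 (λ x w → :1 :- w :+ (:1 :- x) :* w := :1 :- x :* w) refl x _ ⟩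
    1# - x * x ^ m                       ∎

  ∏1-ζⁱx≈1-xᵖ : ∀ x → ∏.big (suc n) (λ i → 1# - ζ ^ i * x) ≈ 1# - x ^ suc n
  ∏1-ζⁱx≈1-xᵖ x = begin
    (1# - 1# * x) * ∏.big n f            ≈⟨ *-cong (+-congˡ (-‿cong (*-identityˡ x))) (sym (trans (G-x^ n 0) (*-identityʳ _))) ⟩
    (1# - x) * G n (x ^_) 0              ≈⟨ *-congˡ (trans (G≈∑ (x ^_) 0)
                                             (∑.big-cong (suc n) (λ i _ → ^-congʳ x (ℕ.+-identityʳ i)))) ⟩
    (1# - x) * ∑.big (suc n) (x ^_)      ≈⟨ geometric x (suc n) ⟩
    1# - x ^ suc n                       ∎
    where
    f : Sequence
    f i = 1# - ζ ^ suc i * x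
    G-x^ : ∀ m k → G m (x ^_) k ≈ ∏.big m f * x ^ k
    G-x^ zero    k = sym (*-identityˡ _)
    G-x^ (suc m) k = begin
      G m (x ^_) k - q * G m (x ^_) (suc k)            ≈⟨ +-cong (G-x^ m k) (-‿cong (*-congˡ (G-x^ m (suc k)))) ⟩
      ∏.big m f * x ^ k - q * (∏.big m f * (x * x ^ k))
        ≈⟨ solve 4 (λ π w q x → π :* w :- q :* (π :* (x :* w)) := π :* (:1 :- q :* x) :* w) refl _ (x ^ k) q x ⟩
      ∏.big m f * (1# - q * x) * x ^ k                 ≈⟨ *-congʳ (∏.big-suc m f) ⟨
      ∏.big (suc m) f * x ^ k                          ∎
      where q = ζ ^ suc m

  ζ^[m*p]≈1 : ∀ m → ζ ^ (m ℕ.* suc n) ≈ 1#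
  ζ^[m*p]≈1 zero    = refl
  ζ^[m*p]≈1 (suc m) = trans (^-homo-* ζ (suc n) (m ℕ.* suc n)) (trans (*-cong ζ^p≈1 (ζ^[m*p]≈1 m)) (*-identityˡ _))

  ζ^-% : ∀ k → ζ ^ k ≈ ζ ^ (k % suc n)
  ζ^-% k = trans (^-congʳ ζ (m≡m%n+[m/n]*n k (suc n))) (trans (^-homo-* ζ (k % suc n) (k / suc n ℕ.* suc n))
    (trans (*-congˡ (ζ^[m*p]≈1 (k / suc n))) (*-identityʳ _)))

  ζ^k≈1⇒p∣k : ∀ k → ζ ^ k ≈ 1# → suc n ∣ k
  ζ^k≈1⇒p∣k k eq with k % suc n in k%p
  ... | zero  = divides (k / suc n) (≡.trans (m≡m%n+[m/n]*n k (suc n)) (≡.cong (ℕ._+ k / suc n ℕ.* suc n) k%p))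
  ... | suc r = contradiction (trans (^-congʳ ζ (≡.sym k%p)) (trans (sym (ζ^-% k)) eq))
    (proj₂ ζ-primitive (suc r) ℕ.z<s (≡.subst (ℕ._< suc n) k%p (m%n<n k (suc n))))

  ζ≉0 : ζ ≉ 0#
  ζ≉0 = unit-nonzeroˡ ζ^p≈1

  ζ^-injective-< : ∀ {i j} → i ℕ.< j → j ℕ.< suc n → ¬ (ζ ^ i ≈ ζ ^ j)
  ζ^-injective-< {i} {j} i<j j<p eq = proj₂ ζ-primitive (j ℕ.∸ i) (ℕ.m<n⇒0<n∸m i<j)
    (ℕ.≤-<-trans (ℕ.m∸n≤m j i) j<p) (*-cancelˡ (^-nonzero i ζ≉0) (begin
      ζ ^ i * ζ ^ (j ℕ.∸ i)   ≈⟨ ^-homo-* ζ i (j ℕ.∸ i) ⟨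
      ζ ^ (i ℕ.+ (j ℕ.∸ i))   ≈⟨ ^-congʳ ζ (ℕ.m+[n∸m]≡n (ℕ.<⇒≤ i<j)) ⟩
      ζ ^ j                   ≈⟨ eq ⟨
      ζ ^ i                   ≈⟨ *-identityʳ _ ⟨
      ζ ^ i * 1#              ∎))

  ζ^-injective : ∀ {i j} → i ℕ.< suc n → j ℕ.< suc n → ζ ^ i ≈ ζ ^ j → i ≡ j
  ζ^-injective {i} {j} i<p j<p eq with ℕ.<-cmp i j
  ... | tri< i<j _ _ = contradiction eq (ζ^-injective-< i<j j<p)
  ... | tri≈ _ i≡j _ = i≡j
  ... | tri> _ _ j<i = contradiction (sym eq) (ζ^-injective-< j<i i<p)

  ∏≈0⇒factor≈0 : ∀ m f → ∏.big m f ≈ 0# → ∃ λ i → i ℕ.< m × f i ≈ 0#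
  ∏≈0⇒factor≈0 zero    f eq = contradiction eq 1≉0
  ∏≈0⇒factor≈0 (suc m) f eq with em {P = f 0 ≈ 0#}
  ... | yes f0≈0 = 0 , ℕ.z<s , f0≈0
  ... | no f0≉0 with i , i<m , fi≈0 ← ∏≈0⇒factor≈0 m (λ i → f (suc i)) (x*y≈0⇒y≈0 f0≉0 eq) =
    suc i , ℕ.s<s i<m , fi≈0

  root-of-unity : ∀ {ω} → ω ^ suc n ≈ 1# → ∃ λ k → k ℕ.< suc n × ω ≈ ζ ^ k
  root-of-unity {ω} ω^p≈1
    with i , i<p , eq ← ∏≈0⇒factor≈0 (suc n) _ (trans (∏1-ζⁱx≈1-xᵖ ω) (trans (+-congˡ (-‿cong ω^p≈1)) (-‿inverseʳ 1#))) =
    -- A vanishing factor `1 - ζⁱ ω` means `ω = ζᵖ⁻ⁱ`; the exponent is reduced because `i` may be 0.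
    (suc n ℕ.∸ i) % suc n , m%n<n (suc n ℕ.∸ i) (suc n) , trans ω≈ (ζ^-% (suc n ℕ.∸ i))
    where
    ω≈ : ω ≈ ζ ^ (suc n ℕ.∸ i)
    ω≈ = *-cancelˡ (^-nonzero i ζ≉0) (begin
      ζ ^ i * ω                        ≈⟨ x-y≈0⇒x≈y eq ⟨
      1#                               ≈⟨ ζ^p≈1 ⟨
      ζ ^ suc n                        ≈⟨ ^-congʳ ζ (ℕ.m+[n∸m]≡n (ℕ.<⇒≤ i<p)) ⟨
      ζ ^ (i ℕ.+ (suc n ℕ.∸ i))        ≈⟨ ^-homo-* ζ i (suc n ℕ.∸ i) ⟩
      ζ ^ i * ζ ^ (suc n ℕ.∸ i)        ∎)

-- Galois theory of the Kummer extension

module AutomorphismProperties {c ℓ c′ ℓ′ : Level} {K : Field c ℓ}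
  (E : FieldExtension K c′ ℓ′) where
  open FieldExtension E
  open Field L
  open FieldProperties L
  open RingMorphisms rawRing rawRing using (module IsRingIsomorphism)

  identity : Automorphism
  identity = record
    { ⟦_⟧ = λ x → x
    ; isRingIsomorphism = Identity.isRingIsomorphism rawRing refl
    ; fixes-K = λ _ → refl
    }

  _∘_ : Automorphism → Automorphism → Automorphism
  τ ∘ υ = record
    { ⟦_⟧ = λ x → ⟦ τ ⟧ (⟦ υ ⟧ x)
    ; isRingIsomorphism = Composition.isRingIsomorphism trans
        (Automorphism.isRingIsomorphism υ) τ-iso
    ; fixes-K = λ a → trans (IsRingIsomorphism.⟦⟧-cong τ-iso (Automorphism.fixes-K υ a)) (Automorphism.fixes-K τ a)
    }
    where τ-iso = Automorphism.isRingIsomorphism τ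

  infixr 10 _^ᴬ_
  _^ᴬ_ : Automorphism → ℕ → Automorphism
  τ ^ᴬ zero  = identity
  τ ^ᴬ suc k = τ ∘ (τ ^ᴬ k)

  module _ (τ : Automorphism) where
    open IsRingIsomorphism (Automorphism.isRingIsomorphism τ) public
      using () renaming (⟦⟧-cong to τ-cong; +-homo to τ-+; *-homo to τ-*; -‿homo to τ-neg; 0#-homo to τ-0; 1#-homo to τ-1)

    τ-sub : ∀ x y → ⟦ τ ⟧ (x - y) ≈ ⟦ τ ⟧ x - ⟦ τ ⟧ y
    τ-sub x y = trans (τ-+ x (- y)) (+-congˡ (τ-neg y))

    τ-^ : ∀ x n → ⟦ τ ⟧ (x ^ n) ≈ ⟦ τ ⟧ x ^ n
    τ-^ x zero    = τ-1
    τ-^ x (suc n) = trans (τ-* x (x ^ n)) (*-congˡ (τ-^ x n))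

    τ-ι* : ∀ a x → ⟦ τ ⟧ (ι a * x) ≈ ι a * ⟦ τ ⟧ x
    τ-ι* a x = trans (τ-* (ι a) x) (*-congʳ (Automorphism.fixes-K τ a))

    τ-inverse : ∀ {x y} → x * y ≈ 1# → ⟦ τ ⟧ x * ⟦ τ ⟧ y ≈ 1#
    τ-inverse {x} {y} eq = trans (sym (τ-* x y)) (trans (τ-cong eq) τ-1)

    τ-nonzero : ∀ {x} → x ≉ 0# → ⟦ τ ⟧ x ≉ 0#
    τ-nonzero x≉0 = unit-nonzeroˡ (τ-inverse (proj₂ (inverse x≉0)))

    ^ᴬ-+ : ∀ m k x → ⟦ τ ^ᴬ (m ℕ.+ k) ⟧ x ≡ ⟦ τ ^ᴬ m ⟧ (⟦ τ ^ᴬ k ⟧ x)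
    ^ᴬ-+ zero    k x = ≡.refl
    ^ᴬ-+ (suc m) k x = ≡.cong ⟦ τ ⟧ (^ᴬ-+ m k x)

    ^ᴬ-comm : ∀ k x → ⟦ τ ^ᴬ k ⟧ (⟦ τ ⟧ x) ≡ ⟦ τ ⟧ (⟦ τ ^ᴬ k ⟧ x)
    ^ᴬ-comm zero    x = ≡.refl
    ^ᴬ-comm (suc k) x = ≡.cong ⟦ τ ⟧ (^ᴬ-comm k x)

  module _ (τ υ : Automorphism) {s : Level} {S : Pred Carrier s} where

    agree : (∀ {x} → x ∈ S → ⟦ τ ⟧ x ≈ ⟦ υ ⟧ x) → ∀ {x} → x ∈ K⟨ S ⟩ → ⟦ τ ⟧ x ≈ ⟦ υ ⟧ x
    agree eq (base a)     = trans (Automorphism.fixes-K τ a) (sym (Automorphism.fixes-K υ a))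
    agree eq (gen x∈)     = eq x∈
    agree eq (resp x≈y d) = trans (τ-cong τ (sym x≈y)) (trans (agree eq d) (τ-cong υ x≈y))
    agree eq (add d e)    = trans (τ-+ τ _ _) (trans (+-cong (agree eq d) (agree eq e)) (sym (τ-+ υ _ _)))
    agree eq (mul d e)    = trans (τ-* τ _ _) (trans (*-cong (agree eq d) (agree eq e)) (sym (τ-* υ _ _)))
    agree eq (neg d)      = trans (τ-neg τ _) (trans (-‿cong (agree eq d)) (sym (τ-neg υ _)))
    agree eq (inv xy≈1 d) = *-cancelˡ (unit-nonzeroˡ (τ-inverse τ xy≈1))
      (trans (τ-inverse τ xy≈1) (trans (sym (τ-inverse υ xy≈1)) (*-congʳ (sym (agree eq d)))))

-- Indexing by `n = p - 1` makes `ζ ^ n` the inverse of `ζ`, and products over `p` conjugates split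
-- off their first factor by computation.
record KummerData {c ℓ c′ ℓ′ : Level} {K : Field c ℓ} (E : FieldExtension K c′ ℓ′) (n : ℕ) :
  Set (c ⊔ ℓ ⊔ c′ ⊔ ℓ′) where
  open FieldExtension E
  private
    module K = Field K
    module L = Field L
  field
    ζ           : K.Carrier
    ζ-primitive : IsPrimitiveRoot K (suc n) ζ
    α           : L.Carrier
    h           : K.Carrier
    h≉0         : ¬ (h K.≈ K.0#)
    α^p≈ιh      : α L.^ suc n L.≈ ι h
    generated   : Generates (λ x → x L.≈ α)
    σ           : Automorphism
    σα≈ζα       : ⟦ σ ⟧ α L.≈ ι ζ L.* α

module Kummer (em : ∀ {e} → ExcludedMiddle e) {c ℓ c′ ℓ′ : Level} {K : Field c ℓ}
  (char0 : HasCharacteristic (Field.rawRing K) 0)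
  {E : FieldExtension K c′ ℓ′} {n : ℕ} (D : KummerData E n) where
  open KummerData D public
  open FieldExtension E
  open AutomorphismProperties E public
  open ExtensionProperties em E public
  module K = Field K
  module KP = FieldProperties K
  open Field L
  open FieldProperties L
  open RingSolver commutativeRing
  open import Relation.Binary.Reasoning.Setoid setoid

  p : ℕ
  p = suc n

  ζᴸ : Carrier
  ζᴸ = ι ζ

  ι-primitive : ∀ {ω} → IsPrimitiveRoot K p ω → IsPrimitiveRoot L p (ι ω)
  ι-primitive {ω} (ω^p≈1 , ω^m≉1) = trans (sym (ι-^ ω p)) (trans (ι-cong ω^p≈1) ι-1) ,
    λ m 0<m m<p eq → ω^m≉1 m 0<m m<p (ι-injective (trans (ι-^ ω m) (trans eq (sym ι-1))))

  open Cyclotomic em L n ζᴸ (ι-primitive ζ-primitive) public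

  s : Carrier → Carrier
  s = ⟦ σ ⟧

  σ^ : ℕ → Carrier → Carrier
  σ^ k = ⟦ σ ^ᴬ k ⟧

  α≉0 : α ≉ 0#
  α≉0 α≈0 = h≉0 (ι≈0⇒≈0 (trans (sym α^p≈ιh) (trans (*-congʳ α≈0) (zeroˡ _))))

  σ^-eigenvector : ∀ {ω x} → s x ≈ ι ω * x → ∀ k → σ^ k x ≈ ι ω ^ k * x
  σ^-eigenvector eq zero    = sym (*-identityˡ _)
  σ^-eigenvector {ω} {x} eq (suc k) = begin
    s (σ^ k x)              ≈⟨ τ-cong σ (σ^-eigenvector eq k) ⟩
    s (ι ω ^ k * x)         ≈⟨ τ-* σ _ _ ⟩
    s (ι ω ^ k) * s x       ≈⟨ *-cong (trans (τ-^ σ _ k) (^-congˡ k (Automorphism.fixes-K σ ω))) eq ⟩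
    ι ω ^ k * (ι ω * x)     ≈⟨ solve 3 (λ w z x → w :* (z :* x) := z :* w :* x) refl _ (ι ω) x ⟩
    ι ω ^ suc k * x         ∎

  σ^p≈id : ∀ x → σ^ p x ≈ x
  σ^p≈id x = agree (σ ^ᴬ p) identity
    (λ x≈α → trans (τ-cong (σ ^ᴬ p) x≈α) (trans (σ^-eigenvector σα≈ζα p)
      (trans (*-congʳ ζ^p≈1) (trans (*-identityˡ α) (sym x≈α))))) (generated x)

  σ^[m*p]≈id : ∀ m x → σ^ (m ℕ.* p) x ≈ x
  σ^[m*p]≈id zero    x = refl
  σ^[m*p]≈id (suc m) x = trans (reflexive (^ᴬ-+ σ p (m ℕ.* p) x))
    (trans (σ^p≈id _) (σ^[m*p]≈id m x))

  Tr Nm : Carrier → Carrier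
  Tr x = ∑.big p (λ k → σ^ k x)
  Nm x = ∏.big p (λ k → σ^ k x)

  σ-∑ : ∀ m f → s (∑.big m f) ≈ ∑.big m (λ k → s (f k))
  σ-∑ m f = ∑.big-hom s (τ-0 σ) (τ-+ σ) m f

  σ-∏ : ∀ m f → s (∏.big m f) ≈ ∏.big m (λ k → s (f k))
  σ-∏ m f = ∏.big-hom s (τ-1 σ) (τ-* σ) m f

  σ-Tr : ∀ x → s (Tr x) ≈ Tr x
  σ-Tr x = begin
    s (Tr x)                             ≈⟨ σ-∑ p (λ k → σ^ k x) ⟩
    ∑.big p (λ k → σ^ (suc k) x)         ≈⟨ ∑.big-suc n (λ k → σ^ (suc k) x) ⟩
    ∑.big n (λ k → σ^ (suc k) x) + σ^ p x  ≈⟨ +-congˡ (σ^p≈id x) ⟩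
    ∑.big n (λ k → σ^ (suc k) x) + x     ≈⟨ +-comm _ _ ⟩
    Tr x                                 ∎

  σ-Nm : ∀ x → s (Nm x) ≈ Nm x
  σ-Nm x = begin
    s (Nm x)                             ≈⟨ σ-∏ p (λ k → σ^ k x) ⟩
    ∏.big p (λ k → σ^ (suc k) x)         ≈⟨ ∏.big-suc n (λ k → σ^ (suc k) x) ⟩
    ∏.big n (λ k → σ^ (suc k) x) * σ^ p x  ≈⟨ *-congˡ (σ^p≈id x) ⟩
    ∏.big n (λ k → σ^ (suc k) x) * x     ≈⟨ *-comm _ _ ⟩
    Nm x                                 ∎

  ∏-nonzero : ∀ m f → (∀ i → f i ≉ 0#) → ∏.big m f ≉ 0#
  ∏-nonzero zero    f f≉0 = 1≉0
  ∏-nonzero (suc m) f f≉0 = *-nonzero (f≉0 0) (∏-nonzero m (λ i → f (suc i)) (λ i → f≉0 (suc i)))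

  Nm-nonzero : ∀ {x} → x ≉ 0# → Nm x ≉ 0#
  Nm-nonzero x≉0 = ∏-nonzero p _ (λ k → τ-nonzero (σ ^ᴬ k) x≉0)

  Nm-* : ∀ x y → Nm (x * y) ≈ Nm x * Nm y
  Nm-* x y = trans (∏.big-cong p (λ k _ → τ-* (σ ^ᴬ k) x y)) (∏.big-∙ p (λ k → σ^ k x) (λ k → σ^ k y))

  Nm-cong : ∀ {x y} → x ≈ y → Nm x ≈ Nm y
  Nm-cong eq = ∏.big-cong p (λ k _ → τ-cong (σ ^ᴬ k) eq)

  ∏-const : ∀ m x → ∏.big m (λ _ → x) ≈ x ^ m
  ∏-const zero    x = refl
  ∏-const (suc m) x = *-congˡ (∏-const m x)

  Nm-ι : ∀ a → Nm (ι a) ≈ ι (a K.^ p)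
  Nm-ι a = trans (∏.big-cong p (λ k _ → Automorphism.fixes-K (σ ^ᴬ k) a)) (trans (∏-const p (ι a)) (sym (ι-^ a p)))

  -- Exponents are not bounded by `p`, so that products just add them; they are reduced by `αᵖ = h`
  -- when a trace is evaluated.
  data K[α] : Carrier → Set (c ⊔ c′ ⊔ ℓ′) where
    term : ∀ a i {x} → x ≈ ι a * α ^ i → K[α] x
    plus : ∀ {x y z} → K[α] x → K[α] y → z ≈ x + y → K[α] z

  K[α]-resp : ∀ {x y} → x ≈ y → K[α] x → K[α] y
  K[α]-resp eq (term a i x≈)  = term a i (trans (sym eq) x≈)
  K[α]-resp eq (plus d e x≈) = plus d e (trans (sym eq) x≈)

  K[α]-ι : ∀ a → K[α] (ι a)
  K[α]-ι a = term a 0 (sym (*-identityʳ _))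

  K[α]-* : ∀ {x y} → K[α] x → K[α] y → K[α] (x * y)
  K[α]-* (plus {x} {y} d e z≈) f = plus (K[α]-* d f) (K[α]-* e f)
    (trans (*-congʳ z≈) (distribʳ _ x y))
  K[α]-* d@(term _ _ _) (plus {x} {y} e f z≈) = plus (K[α]-* d e) (K[α]-* d f)
    (trans (*-congˡ z≈) (distribˡ _ x y))
  K[α]-* (term a i x≈) (term b j y≈) = term (a K.* b) (i ℕ.+ j) (begin
    _                               ≈⟨ *-cong x≈ y≈ ⟩
    ι a * α ^ i * (ι b * α ^ j)     ≈⟨ solve 4 (λ a b x y → a :* x :* (b :* y) := a :* b :* (x :* y)) refl _ _ _ _ ⟩
    ι a * ι b * (α ^ i * α ^ j)     ≈⟨ *-cong (ι-* a b) (^-homo-* α i j) ⟨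
    ι (a K.* b) * α ^ (i ℕ.+ j)     ∎)

  K[α]-neg : ∀ {x} → K[α] x → K[α] (- x)
  K[α]-neg d = K[α]-resp (trans (*-congʳ (trans (ι-neg K.1#) (-‿cong ι-1))) (-1*x≈-x _))
    (K[α]-* (K[α]-ι (K.- K.1#)) d)

  K[α]-σ : ∀ {x} → K[α] x → K[α] (s x)
  K[α]-σ (plus d e z≈) = plus (K[α]-σ d) (K[α]-σ e) (trans (τ-cong σ z≈) (τ-+ σ _ _))
  K[α]-σ (term a i {x} x≈) = term (a K.* ζ K.^ i) i (begin
    s x                            ≈⟨ trans (τ-cong σ x≈) (τ-ι* σ a _) ⟩
    ι a * s (α ^ i)                ≈⟨ *-congˡ (trans (τ-^ σ α i) (^-congˡ i σα≈ζα)) ⟩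
    ι a * (ζᴸ * α) ^ i             ≈⟨ *-congˡ (trans (^-distrib-* ζᴸ α i) (*-congʳ (sym (ι-^ ζ i)))) ⟩
    ι a * (ι (ζ K.^ i) * α ^ i)    ≈⟨ trans (sym (*-assoc _ _ _)) (*-congʳ (sym (ι-* a _))) ⟩
    ι (a K.* ζ K.^ i) * α ^ i      ∎)

  K[α]-σ^ : ∀ k {x} → K[α] x → K[α] (σ^ k x)
  K[α]-σ^ zero    d = d
  K[α]-σ^ (suc k) d = K[α]-σ (K[α]-σ^ k d)

  K[α]-∏ : ∀ m f → (∀ i → K[α] (f i)) → K[α] (∏.big m f)
  K[α]-∏ zero    f d = K[α]-resp ι-1 (K[α]-ι K.1#)
  K[α]-∏ (suc m) f d = K[α]-* (d 0) (K[α]-∏ m (λ i → f (suc i)) (λ i → d (suc i)))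

  open RawSemiringDefinitions K.rawSemiring using () renaming (_×_ to _×ᴷ_)

  ι-× : ∀ m → ι (m ×ᴷ K.1#) ≈ ∑.big m (λ _ → 1#)
  ι-× zero    = ι-0
  ι-× (suc m) = trans (ι-+ _ _) (+-cong ι-1 (ι-× m))

  p×1≉0 : p ×ᴷ K.1# K.≉ K.0#
  p×1≉0 eq with () ← 0∣⇒≡0 (Equivalence.to (char0 p) eq)

  α^[m*p] : ∀ m → α ^ (m ℕ.* p) ≈ ι (h K.^ m)
  α^[m*p] zero    = sym ι-1
  α^[m*p] (suc m) = trans (^-homo-* α p (m ℕ.* p)) (trans (*-cong α^p≈ιh (α^[m*p] m)) (sym (ι-* _ _)))

  -- The trace of `a αⁱ` is `a αⁱ` times the geometric sum of `ζⁱ`. The sum vanishes unless `p`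
  -- divides `i`, and in that case `αⁱ` is a power of `h`.
  Tr-K[α] : ∀ {x} → K[α] x → ∃ λ a → ι a ≈ Tr x
  Tr-K[α] (plus {x} {y} d e z≈) with a , ιa≈ ← Tr-K[α] d with b , ιb≈ ← Tr-K[α] e =
    a K.+ b , trans (ι-+ a b) (trans (+-cong ιa≈ ιb≈) (trans (sym (∑.big-∙ p (λ k → σ^ k x) (λ k → σ^ k y)))
      (∑.big-cong p (λ k _ → trans (sym (τ-+ (σ ^ᴬ k) x y)) (τ-cong (σ ^ᴬ k) (sym z≈))))))
  Tr-K[α] (term a i {x} x≈) = go (em {P = q ≈ 1#})
    where
    q = ζᴸ ^ i
    Tr≈ : Tr x ≈ ι a * α ^ i * ∑.big p (q ^_)
    Tr≈ = sym (trans (∑.big-hom (ι a * α ^ i *_) (zeroʳ _) (distribˡ _) p (q ^_))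
      (∑.big-cong p (λ k _ → sym (begin
        σ^ k x                           ≈⟨ trans (τ-cong (σ ^ᴬ k) x≈) (τ-ι* (σ ^ᴬ k) a _) ⟩
        ι a * σ^ k (α ^ i)               ≈⟨ *-congˡ (trans (τ-^ (σ ^ᴬ k) α i) (^-congˡ i (σ^-eigenvector σα≈ζα k))) ⟩
        ι a * (ζᴸ ^ k * α) ^ i           ≈⟨ *-congˡ (^-distrib-* _ α i) ⟩
        ι a * ((ζᴸ ^ k) ^ i * α ^ i)     ≈⟨ *-congˡ (*-congʳ (trans (^-assocʳ ζᴸ k i)
                                              (trans (^-congʳ ζᴸ (ℕ.*-comm k i)) (sym (^-assocʳ ζᴸ i k))))) ⟩
        ι a * (q ^ k * α ^ i)            ≈⟨ solve 3 (λ a b c → a :* (b :* c) := a :* c :* b) refl _ _ _ ⟩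
        ι a * α ^ i * q ^ k              ∎))))
    go : _ → ∃ λ b → ι b ≈ Tr x
    go (yes q≈1) with divides m ≡.refl ← ζ^k≈1⇒p∣k i q≈1 =
      a K.* h K.^ m K.* (p ×ᴷ K.1#) , sym (begin
        Tr x                                  ≈⟨ Tr≈ ⟩
        ι a * α ^ i * ∑.big p (q ^_)          ≈⟨ *-cong (*-congˡ (α^[m*p] m))
                                                  (∑.big-cong p (λ k _ → trans (^-congˡ k q≈1) (1^n≈1 k))) ⟩
        ι a * ι (h K.^ m) * ∑.big p (λ _ → 1#)  ≈⟨ *-cong (sym (ι-* a _)) (sym (ι-× p)) ⟩
        ι (a K.* h K.^ m) * ι (p ×ᴷ K.1#)     ≈⟨ ι-* _ _ ⟨
        ι (a K.* h K.^ m K.* (p ×ᴷ K.1#))     ∎)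
    go (no q≉1) = K.0# , trans ι-0 (sym (trans Tr≈ (trans (*-congˡ (x*y≈0⇒y≈0
        (λ 1-q≈0 → q≉1 (sym (x-y≈0⇒x≈y 1-q≈0)))
        (trans (geometric q p) (trans (+-congˡ (-‿cong (begin
          q ^ p              ≈⟨ trans (^-assocʳ ζᴸ i p) (trans (^-congʳ ζᴸ (ℕ.*-comm i p)) (sym (^-assocʳ ζᴸ p i))) ⟩
          (ζᴸ ^ p) ^ i       ≈⟨ trans (^-congˡ i ζ^p≈1) (1^n≈1 i) ⟩
          1#                 ∎))) (-‿inverseʳ 1#))))) (zeroʳ _))))

  -- A fixed `x` equals `Tr x / p`, and characteristic 0 provides the inverse of `p`.
  K[α]-fixed : ∀ {x} → K[α] x → s x ≈ x → ∃ λ a → ι a ≈ x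
  K[α]-fixed {x} d sx≈x with a , ιa≈Tr ← Tr-K[α] d with q , pq≈1 ← K.inverse p×1≉0 =
    a K.* q , (begin
      ι (a K.* q)                         ≈⟨ ι-* a q ⟩
      ι a * ι q                           ≈⟨ *-congʳ (trans ιa≈Tr (∑.big-cong p {g = λ _ → x * 1#}
                                               (λ k _ → trans (σ^x≈x k) (sym (*-identityʳ x))))) ⟩
      ∑.big p (λ _ → x * 1#) * ι q        ≈⟨ *-congʳ (∑.big-hom (x *_) (zeroʳ x) (distribˡ x) p (λ _ → 1#)) ⟨
      x * ∑.big p (λ _ → 1#) * ι q        ≈⟨ *-congʳ (*-congˡ (ι-× p)) ⟨
      x * ι (p ×ᴷ K.1#) * ι q             ≈⟨ trans (*-assoc _ _ _) (*-congˡ (ι-inverse pq≈1)) ⟩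
      x * 1#                              ≈⟨ *-identityʳ x ⟩
      x                                   ∎)
    where
    σ^x≈x : ∀ k → σ^ k x ≈ x
    σ^x≈x zero    = refl
    σ^x≈x (suc k) = trans (τ-cong σ (σ^x≈x k)) sx≈x

  -- The inverse is the product of the other conjugates divided by the norm, and the norm is fixed
  -- by `σ`, hence in `K`. Thus `K[α]` is a field and exhausts `L`.
  K[α]-inverse : ∀ {x y} → x * y ≈ 1# → K[α] x → K[α] y
  K[α]-inverse {x} {y} xy≈1 d =
    go (K[α]-fixed (K[α]-∏ p (λ k → σ^ k x) (λ k → K[α]-σ^ k d)) (σ-Nm x))
    where
    w = ∏.big n (λ k → σ^ (suc k) x)
    scaled : ∀ {a b} → ι a ≈ Nm x → a K.* b K.≈ K.1# → w * ι b ≈ y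
    scaled {a} {b} ιa≈ ab≈1 = *-cancelˡ (unit-nonzeroˡ xy≈1) (begin
      x * (w * ι b)        ≈⟨ *-assoc x w (ι b) ⟨
      x * w * ι b          ≈⟨ *-congʳ ιa≈ ⟨
      ι a * ι b            ≈⟨ ι-inverse ab≈1 ⟩
      1#                   ≈⟨ xy≈1 ⟨
      x * y                ∎)
    go : (∃ λ a → ι a ≈ Nm x) → K[α] y
    go (a , ιa≈) = go′ (K.inverse (λ a≈0 → Nm-nonzero (unit-nonzeroˡ xy≈1) (trans (sym ιa≈) (trans (ι-cong a≈0) ι-0))))
      where
      go′ : (∃ λ b → a K.* b K.≈ K.1#) → K[α] y
      go′ (b , ab≈1) = K[α]-resp (scaled ιa≈ ab≈1)
        (K[α]-* (K[α]-∏ n (λ k → σ^ (suc k) x) (λ k → K[α]-σ^ (suc k) d)) (K[α]-ι b))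

  L⊆K[α] : ∀ x → K[α] x
  L⊆K[α] x = go (generated x)
    where
    go : ∀ {x} → x ∈ K⟨ (λ x → x ≈ α) ⟩ → K[α] x
    go (base a)     = K[α]-ι a
    go (gen x≈α)    = term K.1# 1 (trans x≈α (sym (trans (*-congʳ ι-1) (trans (*-identityˡ _) (*-identityʳ α)))))
    go (resp x≈y d) = K[α]-resp x≈y (go d)
    go (add d e)    = plus (go d) (go e) refl
    go (mul d e)    = K[α]-* (go d) (go e)
    go (neg d)      = K[α]-neg (go d)
    go (inv xy≈1 d) = K[α]-inverse xy≈1 (go d)

  fixed-field : ∀ {x} → s x ≈ x → ∃ λ a → ι a ≈ x
  fixed-field {x} = K[α]-fixed (L⊆K[α] x)

  conjugate-root : ∀ (τ : Automorphism) {x a} → x ≉ 0# → x ^ p ≈ ι a →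
    ∃ λ k → k ℕ.< p × ⟦ τ ⟧ x ≈ ζᴸ ^ k * x
  conjugate-root τ {x} {a} x≉0 x^p≈ιa = go (inverse x≉0)
    where
    root : ∀ {y} → x * y ≈ 1# → (⟦ τ ⟧ x * y) ^ p ≈ 1#
    root {y} xy≈1 = begin
      (⟦ τ ⟧ x * y) ^ p     ≈⟨ ^-distrib-* _ y p ⟩
      ⟦ τ ⟧ x ^ p * y ^ p   ≈⟨ *-congʳ (trans (sym (τ-^ τ x p)) (trans (τ-cong τ x^p≈ιa)
                                (trans (Automorphism.fixes-K τ a) (sym x^p≈ιa)))) ⟩
      x ^ p * y ^ p         ≈⟨ ^-distrib-* x y p ⟨
      (x * y) ^ p           ≈⟨ trans (^-congˡ p xy≈1) (1^n≈1 p) ⟩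
      1#                    ∎
    unscaled : ∀ {y w} → x * y ≈ 1# → ⟦ τ ⟧ x * y ≈ w → ⟦ τ ⟧ x ≈ w * x
    unscaled {y} {w} xy≈1 eq = *-cancelʳ (unit-nonzeroʳ xy≈1)
      (trans eq (sym (trans (*-assoc w x y) (trans (*-congˡ xy≈1) (*-identityʳ w)))))
    go : (∃ λ y → x * y ≈ 1#) → ∃ λ k → k ℕ.< p × ⟦ τ ⟧ x ≈ ζᴸ ^ k * x
    go (y , xy≈1) = go′ (root-of-unity (root xy≈1))
      where
      go′ : (∃ λ k → k ℕ.< p × ⟦ τ ⟧ x * y ≈ ζᴸ ^ k) → ∃ λ k → k ℕ.< p × ⟦ τ ⟧ x ≈ ζᴸ ^ k * x
      go′ (k , k<p , eq) = k , k<p , unscaled xy≈1 eq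

  enumeration : Bijection (≡.setoid (Fin p)) Gal
  enumeration = record
    { to        = λ i → σ ^ᴬ toℕ i
    ; cong      = λ { ≡.refl x → refl }
    ; bijective = (λ {i} {j} eq → Fin.toℕ-injective (ζ^-injective (Fin.toℕ<n i) (Fin.toℕ<n j)
        (*-cancelʳ α≉0 (trans (sym (σ^-eigenvector σα≈ζα (toℕ i))) (trans (eq α) (σ^-eigenvector σα≈ζα (toℕ j)))))))
      , surj
    }
    where
    surj : ∀ τ → ∃ λ i → ∀ {j} → j ≡ i → ∀ x → σ^ (toℕ j) x ≈ ⟦ τ ⟧ x
    surj τ = case conjugate-root τ α≉0 α^p≈ιh of λ { (k , k<p , eq) → fromℕ< k<p , λ { ≡.refl x →
      agree (σ ^ᴬ toℕ (fromℕ< k<p)) τ (λ y≈α → trans (τ-cong (σ ^ᴬ toℕ (fromℕ< k<p)) y≈α)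
        (trans (reflexive (≡.cong (λ m → σ^ m α) (Fin.toℕ-fromℕ< k<p)))
        (trans (σ^-eigenvector σα≈ζα k) (trans (sym eq) (τ-cong τ (sym y≈α)))))) (generated x) } }

  -- `Norm` allows any enumeration of the group, of any length. Comparing it with the powers of `σ`
  -- gives a permutation of indices, which does not change the product.
  Norm⇒Nm : ∀ {x y} → Norm x y → ι y ≈ Nm x
  Norm⇒Nm {x} {y} (m , e , ιy≈) = trans ιy≈ (trans
    (sum-permute (λ i → ⟦ Bijection.to e i ⟧ x) π)
    (sum-cong-≋ {p} (λ i → proj₂ (e.surjective (e₀.to i)) ≡.refl x)))
    where
    open import Algebra.Properties.CommutativeMonoid.Sum *-commutativeMonoid using (sum-permute; sum-cong-≋)
    module e = Bijection e
    module e₀ = Bijection enumeration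
    f : Fin p → Fin m
    f i = proj₁ (e.surjective (e₀.to i))
    f⁻¹ : Fin m → Fin p
    f⁻¹ j = proj₁ (e₀.surjective (e.to j))
    π : Permutation p m
    π = permutation f f⁻¹
      (λ j → e.injective (λ x → trans (proj₂ (e.surjective (e₀.to (f⁻¹ j))) ≡.refl x) (proj₂ (e₀.surjective (e.to j)) ≡.refl x)))
      (λ i → e₀.injective (λ x → trans (proj₂ (e₀.surjective (e.to (f i))) ≡.refl x) (proj₂ (e.surjective (e₀.to i)) ≡.refl x)))

  Nm⇒Norm : ∀ {x y} → ι y ≈ Nm x → Norm x y
  Nm⇒Norm ιy≈ = p , enumeration , ιy≈

  -- The conjugates of `1 - β` are `1 - ωⁱ β`. The eigenvalue is left general because a root of
  -- `Xᵖ = h′` with `h′ ∈ 𝔄 p` need not have eigenvalue `ζ`.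
  Nm-eigenvector : ∀ {ω β} → IsPrimitiveRoot K p ω → s β ≈ ι ω * β → Nm (1# - β) ≈ 1# - β ^ p
  Nm-eigenvector {ω} {β} ω-primitive eq = trans
    (∏.big-cong p (λ i _ → trans (τ-sub (σ ^ᴬ i) 1# β)
      (+-cong (τ-1 (σ ^ᴬ i)) (-‿cong (σ^-eigenvector eq i)))))
    (Cyclotomic.∏1-ζⁱx≈1-xᵖ em L n (ι ω) (ι-primitive ω-primitive) β)

  eigenvector-^p : ∀ {β} → s β ≈ ζᴸ * β → ∃ λ a → ι a ≈ β ^ p
  eigenvector-^p {β} eq = fixed-field (trans (τ-^ σ β p) (trans (^-congˡ p eq)
    (trans (^-distrib-* ζᴸ β p) (trans (*-congʳ ζ^p≈1) (*-identityˡ _)))))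

  -- `α / β` is fixed by `σ`, so `α` is a multiple of `β` by an element of `K`.
  eigenvector-generates : ∀ {r} {S : Pred Carrier r} {β} → β ≉ 0# → s β ≈ ζᴸ * β → β ∈ S → Generates S
  eigenvector-generates {S = S} {β} β≉0 sβ≈ζβ β∈S x = case inverse β≉0 of λ { (β⁻¹ , ββ⁻¹≈1) →
    case fixed-field (fixed ββ⁻¹≈1) of λ { (a , ιa≈) → go (scaled ββ⁻¹≈1 ιa≈) (generated x) } }
    where
    fixed : ∀ {β⁻¹} → β * β⁻¹ ≈ 1# → s (α * β⁻¹) ≈ α * β⁻¹
    fixed {β⁻¹} ββ⁻¹≈1 = *-cancelʳ (*-nonzero ζ≉0 β≉0) (begin
      s (α * β⁻¹) * (ζᴸ * β)     ≈⟨ *-cong (τ-* σ α β⁻¹) (sym sβ≈ζβ) ⟩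
      s α * s β⁻¹ * s β          ≈⟨ trans (*-assoc _ _ _) (*-congˡ (trans (*-comm _ _) (τ-inverse σ ββ⁻¹≈1))) ⟩
      s α * 1#                   ≈⟨ *-cong σα≈ζα (sym ββ⁻¹≈1) ⟩
      ζᴸ * α * (β * β⁻¹)         ≈⟨ solve 4 (λ z a b c → z :* a :* (b :* c) := a :* c :* (z :* b)) refl ζᴸ α β β⁻¹ ⟩
      α * β⁻¹ * (ζᴸ * β)         ∎)
    scaled : ∀ {β⁻¹ a} → β * β⁻¹ ≈ 1# → ι a ≈ α * β⁻¹ → ι a * β ≈ α
    scaled {β⁻¹} ββ⁻¹≈1 ιa≈ = trans (*-congʳ ιa≈) (trans (*-assoc _ _ _)
      (trans (*-congˡ (trans (*-comm _ _) ββ⁻¹≈1)) (*-identityʳ α)))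
    go : ∀ {a} → ι a * β ≈ α → ∀ {x} → x ∈ K⟨ (λ x → x ≈ α) ⟩ → x ∈ K⟨ S ⟩
    go eq (base b)     = base b
    go eq (gen x≈α)    = resp (trans eq (sym x≈α)) (mul (base _) (gen β∈S))
    go eq (resp x≈y d) = resp x≈y (go eq d)
    go eq (add d e)    = add (go eq d) (go eq e)
    go eq (mul d e)    = mul (go eq d) (go eq e)
    go eq (neg d)      = neg (go eq d)
    go eq (inv xy≈1 d) = inv xy≈1 (go eq d)

-- Inverses modulo `p`, and the order defined by a valuation ring

-- The inverse `j` of `l` modulo `p`, written without subtraction so that it can be read off in
-- exponents of `σ` and of roots of unity.
prime-inverse : ∀ {n} → Prime (suc n) → ∀ l → 0 ℕ.< l → l ℕ.< suc n → ∃ λ j → ∃₂ λ m m′ → j ℕ.* l ℕ.+ m′ ℕ.* suc n ≡ 1 ℕ.+ m ℕ.* suc n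
prime-inverse {n} p-prime l@(suc _) _ l<p with coprime-Bézout (Coprime.sym (prime⇒coprime p-prime l<p))
... | Bézout.+- x y eq = x , y , 0 , ≡.trans (ℕ.+-identityʳ _) (≡.sym eq)
-- Here `1 + x l = y p`, so the inverse is `- x`; `n` stands in for -1 modulo `p = 1 + n`.
... | Bézout.-+ x y eq = n ℕ.* x , n ℕ.* y , 1 , ≡.trans
  (+-*-Solver.solve 3 (λ n x l → n ℕₛ.:* x ℕₛ.:* l ℕₛ.:+ (ℕₛ.con 1 ℕₛ.:* (ℕₛ.con 1 ℕₛ.:+ n)) ℕₛ.:= ℕₛ.con 1 ℕₛ.:+ n ℕₛ.:* (ℕₛ.con 1 ℕₛ.:+ x ℕₛ.:* l)) ≡.refl n x l)
  (≡.cong suc (≡.trans (≡.cong (n ℕ.*_) eq) (≡.sym (ℕ.*-assoc n y (suc n)))))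
  where module ℕₛ = +-*-Solver

-- w (x) ≤ w (y) for the valuation w with valuation ring W.
module ValuationOrder (em : ∀ {e} → ExcludedMiddle e) {c ℓ w : Level} (L : Field c ℓ)
  (W : Pred (Field.Carrier L) w) (W-isSubring : Subring L W)
  (W-total : ∀ {x y} → Field._≈_ L (Field._*_ L x y) (Field.1# L) → x ∈ W ⊎ y ∈ W) where
  open Field L
  open FieldProperties L
  open RingSolver commutativeRing
  private module W = Subring W-isSubring

  infix 4 _≼_
  -- Divisibility in `W` replaces a value group, and 0 automatically has the largest value.
  _≼_ : Carrier → Carrier → Set (c ⊔ ℓ ⊔ w)
  x ≼ y = ∃ λ r → r ∈ W × y ≈ r * x

  ≼-respʳ : ∀ {x y z} → y ≈ z → x ≼ y → x ≼ z
  ≼-respʳ eq (r , r∈ , y≈) = r , r∈ , trans (sym eq) y≈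

  ≼-respˡ : ∀ {x y z} → x ≈ y → x ≼ z → y ≼ z
  ≼-respˡ eq (r , r∈ , z≈) = r , r∈ , trans z≈ (*-congˡ eq)

  ≼-refl : ∀ {x} → x ≼ x
  ≼-refl = 1# , W.1∈ , sym (*-identityˡ _)

  ≼-trans : ∀ {x y z} → x ≼ y → y ≼ z → x ≼ z
  ≼-trans (r , r∈ , y≈) (q , q∈ , z≈) =
    q * r , W.*-closed q∈ r∈ , trans z≈ (trans (*-congˡ y≈) (sym (*-assoc q r _)))

  ≼-0 : ∀ {x} → x ≼ 0#
  ≼-0 {x} = 0# , W.0∈ , sym (zeroˡ x)

  ≼-+ : ∀ {x y z} → x ≼ y → x ≼ z → x ≼ y + z
  ≼-+ (r , r∈ , y≈) (q , q∈ , z≈) =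
    r + q , W.+-closed r∈ q∈ , trans (+-cong y≈ z≈) (sym (distribʳ _ r q))

  ≼-neg : ∀ {x y} → x ≼ y → x ≼ - y
  ≼-neg (r , r∈ , y≈) = - r , W.neg-closed r∈ , trans (-‿cong y≈) (-‿distribˡ-* r _)

  ≼-sub : ∀ {x y z} → x ≼ y → x ≼ z → x ≼ y - z
  ≼-sub x≼y x≼z = ≼-+ x≼y (≼-neg x≼z)

  ≼-* : ∀ {x y u v} → x ≼ y → u ≼ v → x * u ≼ y * v
  ≼-* {x} {u = u} (r , r∈ , y≈) (q , q∈ , v≈) = r * q , W.*-closed r∈ q∈ ,
    trans (*-cong y≈ v≈) (solve 4 (λ r x q u → r :* x :* (q :* u) := r :* q :* (x :* u)) refl r x q u)

  ≼-scale : ∀ {r x y} → r ∈ W → x ≼ y → x ≼ r * y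
  ≼-scale r∈ x≼y = ≼-trans x≼y (_ , r∈ , refl)

  ≼-cancel : ∀ {x y z} → z ≉ 0# → z * x ≼ z * y → x ≼ y
  ≼-cancel {x} {y} {z} z≉0 (r , r∈ , zy≈) = r , r∈ ,
    *-cancelˡ z≉0 (trans zy≈ (solve 3 (λ r z x → r :* (z :* x) := z :* (r :* x)) refl r z x))

  ≼-nonzero : ∀ {x y} → x ≼ y → y ≉ 0# → x ≉ 0#
  ≼-nonzero (r , _ , y≈) y≉0 x≈0 = y≉0 (trans y≈ (trans (*-congˡ x≈0) (zeroʳ r)))

  ≼-total : ∀ x y → x ≼ y ⊎ y ≼ x
  ≼-total x y with em {P = x ≈ 0#} | em {P = y ≈ 0#}
  ... | yes x≈0 | _       = inj₂ (≼-respʳ (sym x≈0) ≼-0)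
  ... | no _    | yes y≈0 = inj₁ (≼-respʳ (sym y≈0) ≼-0)
  ... | no x≉0  | no y≉0 with x′ , xx′≈1 ← inverse x≉0 | y′ , yy′≈1 ← inverse y≉0
    with W-total {y * x′} {x * y′} (trans
      (solve 4 (λ x x′ y y′ → y :* x′ :* (x :* y′) := x :* x′ :* (y :* y′)) refl x x′ y y′)
      (trans (*-cong xx′≈1 yy′≈1) (*-identityˡ 1#)))
  ... | inj₁ r∈ = inj₁ (_ , r∈ , sym (trans
    (solve 3 (λ x x′ y → y :* x′ :* x := x :* x′ :* y) refl x x′ y) (trans (*-congʳ xx′≈1) (*-identityˡ y))))
  ... | inj₂ r∈ = inj₂ (_ , r∈ , sym (trans
    (solve 3 (λ y y′ x → x :* y′ :* y := y :* y′ :* x) refl y y′ x) (trans (*-congʳ yy′≈1) (*-identityˡ x))))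

  minimum : ∀ (f : ℕ → Carrier) N → ∃ λ j → j ℕ.≤ N × (∀ k → k ℕ.≤ N → f j ≼ f k)
  minimum f zero = 0 , ℕ.z≤n , λ { zero ℕ.z≤n → ≼-refl }
  minimum f (suc N) with j , j≤N , min ← minimum f N with ≼-total (f j) (f (suc N))
  ... | inj₁ le = j , ℕ.m≤n⇒m≤1+n j≤N , λ k k≤1+N → case ℕ.m≤n⇒m<n∨m≡n k≤1+N of λ
    { (inj₁ k<1+N) → min k (ℕ.s≤s⁻¹ k<1+N) ; (inj₂ ≡.refl) → le }
  ... | inj₂ ge = suc N , ℕ.≤-refl , λ k k≤1+N → case ℕ.m≤n⇒m<n∨m≡n k≤1+N of λ
    { (inj₁ k<1+N) → ≼-trans ge (min k (ℕ.s≤s⁻¹ k<1+N)) ; (inj₂ ≡.refl) → ≼-refl }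

-- Tame elements, small traces and eigenvectors near 1

module Approximation (em : ∀ {e} → ExcludedMiddle e) {c ℓ c′ ℓ′ w : Level} {K : Field c ℓ}
  (char0 : HasCharacteristic (Field.rawRing K) 0)
  {E : FieldExtension K c′ ℓ′} {n : ℕ} (D : KummerData E n) (p-prime : Prime (suc n))
  (W : Pred (Field.Carrier (FieldExtension.L E)) w) (W-isSubring : Subring (FieldExtension.L E) W)
  (W-total : ∀ {x y} → Field._≈_ (FieldExtension.L E) (Field._*_ (FieldExtension.L E) x y)
    (Field.1# (FieldExtension.L E)) → x ∈ W ⊎ y ∈ W)
  (W-σ : ∀ {x} → x ∈ W → FieldExtension.Automorphism.⟦_⟧ (KummerData.σ D) x ∈ W) where
  open Kummer em char0 D
  open FieldExtension E
  open Field L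
  open FieldProperties L
  open RingSolver commutativeRing
  open ValuationOrder em L W W-isSubring W-total public
  private module W = Subring W-isSubring
  open import Relation.Binary.Reasoning.Setoid setoid

  W-σ^ : ∀ k {x} → x ∈ W → σ^ k x ∈ W
  W-σ^ zero    x∈ = x∈
  W-σ^ (suc k) x∈ = W-σ (W-σ^ k x∈)

  W-root-of-unity : ∀ {ω} → ω ^ p ≈ 1# → ω ∈ W
  W-root-of-unity {ω} ω^p≈1 = [ (λ ω∈ → ω∈) , (λ ω⁻¹∈ → W.resp inverse-power (W.^-closed n ω⁻¹∈)) ]′ (W-total ω^p≈1)
    where
    -- `n = p - 1` is its own inverse modulo `p`, so `ω` is a power of `ω⁻¹ = ω ^ n`.
    inverse-power : (ω ^ n) ^ n ≈ ω
    inverse-power = *-cancelˡ (unit-nonzeroʳ ω^p≈1) (begin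
      ω ^ n * (ω ^ n) ^ n   ≈⟨ ^-assocʳ ω n p ⟩
      ω ^ (n ℕ.* p)         ≈⟨ trans (^-congʳ ω (ℕ.*-comm n p)) (sym (^-assocʳ ω p n)) ⟩
      (ω ^ p) ^ n           ≈⟨ trans (^-congˡ n ω^p≈1) (1^n≈1 n) ⟩
      1#                    ≈⟨ trans (sym ω^p≈1) (*-comm ω _) ⟩
      ω ^ n * ω             ∎)

  ζ∈W : ζᴸ ∈ W
  ζ∈W = W-root-of-unity ζ^p≈1

  ζ^∈W : ∀ k → ζᴸ ^ k ∈ W
  ζ^∈W k = W.^-closed k ζ∈W

  W-inverse-Nm : ∀ {r} → r ∈ W → Nm r ≈ 1# → ∃ λ r⁻¹ → r⁻¹ ∈ W × r * r⁻¹ ≈ 1#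
  W-inverse-Nm {r} r∈ eq = ∏.big n (λ k → σ^ (suc k) r) , W.product-closed n (λ k → W-σ^ (suc (toℕ k)) r∈) , eq

  ≼-σ : ∀ {x y} → x ≼ y → s x ≼ s y
  ≼-σ (r , r∈ , y≈) = s r , W-σ r∈ , trans (τ-cong σ y≈) (τ-* σ r _)

  -- If x = r σ(x) with r ∈ W then N(r) = 1, so r⁻¹ is a product of
  -- conjugates of r.
  x≼σx : ∀ x → x ≼ s x
  x≼σx x with em {P = x ≈ 0#}
  ... | yes x≈0 = ≼-respʳ (sym (trans (τ-cong σ x≈0) (τ-0 σ))) ≼-0
  ... | no x≉0  = [ (λ le → le) , invert ]′ (≼-total x (s x))
    where
    Nm-σ : Nm (s x) ≈ Nm x
    Nm-σ = trans (∏.big-cong p (λ k _ → reflexive (^ᴬ-comm σ k x)))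
      (trans (sym (σ-∏ p (λ k → σ^ k x))) (σ-Nm x))
    Nm≈1 : ∀ {r} → x ≈ r * s x → Nm r ≈ 1#
    Nm≈1 {r} eq = *-cancelʳ (Nm-nonzero x≉0) (trans (trans (*-congˡ (sym Nm-σ)) (trans (sym (Nm-* r (s x))) (Nm-cong (sym eq))))
      (sym (*-identityˡ _)))
    invert : s x ≼ x → x ≼ s x
    invert (r , r∈ , eq) = case W-inverse-Nm r∈ (Nm≈1 eq) of λ { (r⁻¹ , r⁻¹∈ , rr⁻¹≈1) →
      r⁻¹ , r⁻¹∈ , sym (trans (*-congˡ eq) (trans (sym (*-assoc _ _ _))
        (trans (*-congʳ (trans (*-comm _ _) rr⁻¹≈1)) (*-identityˡ _)))) }

  x≼σ^x : ∀ k x → x ≼ σ^ k x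
  x≼σ^x zero    x = ≼-refl
  x≼σ^x (suc k) x = ≼-trans (x≼σ^x k x) (x≼σx (σ^ k x))

  Δ : Carrier → Carrier
  Δ x = x - s x

  -- σˡ generates the Galois group.
  conjugate-difference : ∀ l b → 0 ℕ.< l → l ℕ.< p → b - σ^ l b ≼ Δ b
  conjugate-difference l b 0<l l<p = case prime-inverse p-prime l 0<l l<p of λ { (j , m , m′ , eq) →
    ≼-respʳ (+-congˡ (-‿cong (begin
      σ^ (j ℕ.* l) b                       ≈⟨ τ-cong (σ ^ᴬ (j ℕ.* l)) (σ^[m*p]≈id m′ b) ⟨
      σ^ (j ℕ.* l) (σ^ (m′ ℕ.* p) b)       ≡⟨ ^ᴬ-+ σ (j ℕ.* l) (m′ ℕ.* p) b ⟨
      σ^ (j ℕ.* l ℕ.+ m′ ℕ.* p) b          ≡⟨ ≡.cong (λ k → σ^ k b) eq ⟩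
      s (σ^ (m ℕ.* p) b)                   ≈⟨ τ-cong σ (σ^[m*p]≈id m b) ⟩
      s b                                  ∎))) (multiples j) }
    where
    multiples : ∀ j → b - σ^ l b ≼ b - σ^ (j ℕ.* l) b
    multiples zero    = ≼-respʳ (sym (-‿inverseʳ b)) ≼-0
    -- The difference telescopes into `b - σˡ b` and the `σˡ`-conjugate of the previous difference;
    -- conjugation preserves the bound by `x≼σ^x`.
    multiples (suc j) = ≼-respʳ lemma (≼-+ ≼-refl
      (≼-trans (x≼σ^x l _) (≼-σ^ l (multiples j))))
      where
      ≼-σ^ : ∀ k {x y} → x ≼ y → σ^ k x ≼ σ^ k y
      ≼-σ^ zero    le = le
      ≼-σ^ (suc k) le = ≼-σ (≼-σ^ k le)
      lemma : b - σ^ l b + σ^ l (b - σ^ (j ℕ.* l) b) ≈ b - σ^ (l ℕ.+ j ℕ.* l) b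
      lemma = trans (+-congˡ (τ-sub (σ ^ᴬ l) b _))
        (trans (solve 3 (λ b x y → b :- x :+ (x :- y) := b :- y) refl b (σ^ l b) _)
          (+-congˡ (-‿cong (reflexive (≡.sym (^ᴬ-+ σ l (j ℕ.* l) b))))))

  z : Carrier
  z = 1# - ζᴸ

  z≼1-ζ^ : ∀ k → z ≼ 1# - ζᴸ ^ k
  z≼1-ζ^ k = ∑.big k (ζᴸ ^_) , W.sum-closed k (λ i → ζ^∈W (toℕ i)) , trans (sym (geometric ζᴸ k)) (*-comm _ _)

  Fixed : Pred Carrier _
  Fixed c = s c ≈ c

  ζ^-fixed : ∀ k → Fixed (ζᴸ ^ k)
  ζ^-fixed k = trans (τ-^ σ ζᴸ k) (^-congˡ k (Automorphism.fixes-K σ ζ))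

  1-fixed : ∀ {c} → Fixed c → Fixed (1# - c)
  1-fixed eq = trans (τ-sub σ 1# _) (+-cong (τ-1 σ) (-‿cong eq))

  Δ^ : ℕ → Carrier → Carrier
  Δ^ zero    x = x
  Δ^ (suc m) x = Δ^ m (Δ x)

  Δ-cong : ∀ {x y} → x ≈ y → Δ x ≈ Δ y
  Δ-cong eq = +-cong eq (-‿cong (τ-cong σ eq))

  Δ^-cong : ∀ m {x y} → x ≈ y → Δ^ m x ≈ Δ^ m y
  Δ^-cong zero    eq = eq
  Δ^-cong (suc m) eq = Δ^-cong m (Δ-cong eq)

  Δ^-+ : ∀ m x y → Δ^ m (x + y) ≈ Δ^ m x + Δ^ m y
  Δ^-+ zero    x y = refl
  Δ^-+ (suc m) x y = trans (Δ^-cong m (trans (+-congˡ (-‿cong (τ-+ σ x y)))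
    (solve 4 (λ x y u v → x :+ y :- (u :+ v) := x :- u :+ (y :- v)) refl x y _ _))) (Δ^-+ m (Δ x) (Δ y))

  Δ^-scale : ∀ m {c} x → Fixed c → Δ^ m (c * x) ≈ c * Δ^ m x
  Δ^-scale zero        x c-fixed = refl
  Δ^-scale (suc m) {c} x c-fixed = trans (Δ^-cong m (trans (+-congˡ (-‿cong (trans (τ-* σ c x) (*-congʳ c-fixed))))
    (solve 3 (λ c x y → c :* x :- c :* y := c :* (x :- y)) refl c x _))) (Δ^-scale m (Δ x) c-fixed)

  -- Eigen m = ∏ (1 - ζⁱ σ) over 1 ≤ i ≤ m.
  Eigen : ℕ → Carrier → Carrier
  Eigen zero    y = y
  Eigen (suc m) y = Eigen m y - ζᴸ ^ suc m * s (Eigen m y)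

  -- On the orbit `k ↦ σᵏ y` the shift acts as `σ`, which turns `G` into `Eigen`.
  Eigen≈Tr : ∀ y → Eigen n y ≈ Tr y
  Eigen≈Tr y = trans (sym (go n 0)) (trans (G≈∑ (λ k → σ^ k y) 0)
    (∑.big-cong p (λ i _ → reflexive (≡.cong (λ k → σ^ k y) (ℕ.+-identityʳ i)))))
    where
    go : ∀ m k → G m (λ k → σ^ k y) k ≈ σ^ k (Eigen m y)
    go zero    k = refl
    go (suc m) k = begin
      G m (λ k → σ^ k y) k - ζᴸ ^ suc m * G m (λ k → σ^ k y) (suc k)
        ≈⟨ +-cong (go m k) (-‿cong (*-cong (sym (fixed k)) (trans (go m (suc k)) (reflexive (≡.sym (^ᴬ-comm σ k _)))))) ⟩
      σ^ k (Eigen m y) - σ^ k (ζᴸ ^ suc m) * σ^ k (s (Eigen m y))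
        ≈⟨ trans (τ-sub (σ ^ᴬ k) _ _) (+-congˡ (-‿cong (τ-* (σ ^ᴬ k) _ _))) ⟨
      σ^ k (Eigen (suc m) y)  ∎
      where
      fixed : ∀ k → σ^ k (ζᴸ ^ suc m) ≈ ζᴸ ^ suc m
      fixed zero    = refl
      fixed (suc k) = trans (τ-cong σ (fixed k)) (ζ^-fixed (suc m))

  module Tame {b ε : Carrier} (b≉0 : b ≉ 0#) (ε≉0 : ε ≉ 0#) (ε∈W : ε ∈ W) (ε≼z : ε ≼ z)
    (Δb≈εb : Δ b ≈ ε * b) (tame : ∀ m → ε ^ m * b ≼ Δ^ m b) where

    -- Tameness relative to a reference size `g`, which need not be the value of `x` itself: only in
    -- this form does it pass to products and to the operators `1 - ζᵏ σ`.
    O : Carrier → Pred Carrier _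
    O g x = ∀ m → ε ^ m * g ≼ Δ^ m x

    O-resp : ∀ {g h x} → g ≈ h → O g x → O h x
    O-resp eq ox m = ≼-respˡ (*-congˡ eq) (ox m)

    O-1 : O 1# 1#
    O-1 zero    = ≼-respˡ (sym (*-identityˡ 1#)) ≼-refl
    O-1 (suc m) = ≼-respʳ (sym (trans (Δ^-cong m (trans (+-congˡ (-‿cong (τ-1 σ)))
      (-‿inverseʳ 1#))) (Δ^-0 m))) ≼-0
      where
      Δ^-0 : ∀ m → Δ^ m 0# ≈ 0#
      Δ^-0 zero    = refl
      Δ^-0 (suc m) = trans (Δ^-cong m (trans (+-congˡ (-‿cong (τ-0 σ))) (-‿inverseʳ 0#))) (Δ^-0 m)

    O-Δ : ∀ {g x} → O g x → O (ε * g) (Δ x)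
    O-Δ {g} ox m = ≼-respˡ (solve 3 (λ e w g → e :* w :* g := w :* (e :* g)) refl ε _ g) (ox (suc m))

    -- Induction on `m` through the twisted Leibniz rule `Δ(x y) = x Δy + Δx y - Δx Δy`. The last
    -- term gains `ε²`, which is more than enough as `ε` lies in `W`.
    O-* : ∀ {g h x y} → O g x → O h y → O (g * h) (x * y)
    O-* {g} {h} {x} {y} ox oy zero = ≼-respˡ
      (solve 2 (λ g h → :1 :* g :* (:1 :* h) := :1 :* (g :* h)) refl g h) (≼-* (ox 0) (oy 0))
    O-* {g} {h} {x} {y} ox oy (suc m) = ≼-respʳ (sym (trans (Δ^-cong m leibniz) (trans (Δ^-+ m _ _)
        (+-cong (Δ^-+ m _ _) (trans (Δ^-cong m (sym (-1*x≈-x _)))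
          (trans (Δ^-scale m _ -1-fixed) (-1*x≈-x _)))))))
      (≼-sub (≼-+ (≼-respˡ (solve 4 (λ w g e h → w :* (g :* (e :* h)) := e :* w :* (g :* h)) refl _ g ε h) (O-* ox (O-Δ oy) m))
                  (≼-respˡ (solve 4 (λ w g e h → w :* (e :* g :* h) := e :* w :* (g :* h)) refl _ g ε h) (O-* (O-Δ ox) oy m)))
             (≼-trans (ε , ε∈W , solve 4 (λ w g e h → w :* (e :* g :* (e :* h)) := e :* (e :* w :* (g :* h))) refl _ g ε h)
               (O-* (O-Δ ox) (O-Δ oy) m)))
      where
      -1-fixed : Fixed (- 1#)
      -1-fixed = trans (τ-neg σ 1#) (-‿cong (τ-1 σ))
      leibniz : Δ (x * y) ≈ x * Δ y + Δ x * y - Δ x * Δ y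
      leibniz = trans (+-congˡ (-‿cong (τ-* σ x y)))
        (solve 4 (λ x y u v → x :* y :- u :* v := x :* (y :- v) :+ (x :- u) :* y :- (x :- u) :* (y :- v)) refl x y _ _)

    O-^ : ∀ k → O (b ^ k) (b ^ k)
    O-^ zero    = O-1
    O-^ (suc k) = O-* tame (O-^ k)

    -- `1 - ζᵏ σ = (1 - ζᵏ) + ζᵏ Δ`: the first summand gains `ε` because `ε ≼ z`, the second because
    -- `x` is tame.
    O-eigen : ∀ k {g x} → O g x → O (ε * g) (x - ζᴸ ^ k * s x)
    O-eigen k {g} {x} ox m = ≼-respʳ
      (sym (trans (Δ^-cong m (solve 3 (λ x y c → x :- c :* y := (:1 :- c) :* x :+ c :* (x :- y)) refl x (s x) (ζᴸ ^ k)))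
        (trans (Δ^-+ m _ _) (+-cong (Δ^-scale m x (1-fixed (ζ^-fixed k))) (Δ^-scale m (Δ x) (ζ^-fixed k))))))
      (≼-+ (≼-respˡ (solve 3 (λ e w g → e :* (w :* g) := w :* (e :* g)) refl ε _ g)
              (≼-* (≼-trans ε≼z (z≼1-ζ^ k)) (ox m)))
           (≼-scale (ζ^∈W k) (O-Δ ox m)))

    O-Eigen : ∀ m {g x} → O g x → O (ε ^ m * g) (Eigen m x)
    O-Eigen zero    ox = O-resp (sym (*-identityˡ _)) ox
    O-Eigen (suc m) ox = O-resp (sym (*-assoc _ _ _)) (O-eigen (suc m) (O-Eigen m ox))

    -- `P n` is the characteristic polynomial of `b` divided by `X - b`. It vanishes at the other
    -- conjugates of `b`, so summing it over all conjugates leaves only the value at `b`.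
    P : ℕ → Carrier → Carrier
    P zero    x = 1#
    P (suc N) x = P N x * (x - σ^ (suc N) b)

    P-root : ∀ N i → i ℕ.< N → P N (σ^ (suc i) b) ≈ 0#
    P-root (suc N) i i<1+N with ℕ.m≤n⇒m<n∨m≡n (ℕ.s≤s⁻¹ i<1+N)
    ... | inj₁ i<N    = trans (*-congʳ (P-root N i i<N)) (zeroˡ _)
    ... | inj₂ ≡.refl = trans (*-congˡ (-‿inverseʳ _)) (zeroʳ _)

    Δb≉0 : Δ b ≉ 0#
    Δb≉0 eq = *-nonzero ε≉0 b≉0 (trans (sym Δb≈εb) eq)

    P-b : ∀ N → N ℕ.≤ n → P N b ≼ Δ b ^ N
    P-b zero    _   = ≼-refl
    P-b (suc N) N<n = ≼-respʳ (*-comm _ _)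
      (≼-* (P-b N (ℕ.<⇒≤ N<n)) (conjugate-difference (suc N) b ℕ.z<s (ℕ.s≤s N<n)))

    -- If τ bᵏ ≼ Tr(bᵏ) for all k < p, then expanding ∏ (X - σˡ b) over
    -- 0 < l < p in powers of X shows that τ bᵖ⁻¹ ≼ ∏ (b - σˡ b).
    trace-bound : ∀ τ → (∀ k → k ℕ.≤ n → τ * b ^ k ≼ Tr (b ^ k)) → τ ≼ ε ^ n
    trace-bound τ τ≼ = ≼-cancel (^-nonzero n b≉0) (≼-respˡ (*-comm τ _)
      (≼-trans (≼-respʳ at-b (≼-respˡ (*-congˡ (^-congʳ b (ℕ.+-identityʳ n))) (moments n 0 (ℕ.≤-reflexive (ℕ.+-identityʳ n)))))
        (≼-respʳ (trans (^-congˡ n Δb≈εb) (trans (^-distrib-* ε b n) (*-comm _ _))) (P-b n ℕ.≤-refl))))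
      where
      -- A new linear factor splits the sum into the moments `m + 1` and `m` of `P N`, the latter
      -- multiplied by a conjugate of `b`, which costs no value compared with `b`. The total degree
      -- stays at most `n`, so only the assumed traces occur.
      moments : ∀ N m → N ℕ.+ m ℕ.≤ n →
        τ * b ^ (N ℕ.+ m) ≼ ∑.big p (λ i → σ^ i b ^ m * P N (σ^ i b))
      moments zero m m≤n = ≼-respʳ
        (∑.big-cong p (λ i _ → trans (τ-^ (σ ^ᴬ i) b m) (sym (*-identityʳ _)))) (τ≼ m m≤n)
      moments (suc N) m N+m≤n = ≼-respʳ split (≼-sub
        (≼-respˡ (*-congˡ (^-congʳ b (ℕ.+-suc N m))) (moments N (suc m) (≡.subst (ℕ._≤ n) (≡.sym (ℕ.+-suc N m)) N+m≤n)))
        (≼-respˡ (solve 3 (λ b t w → b :* (t :* w) := t :* (b :* w)) refl b τ _)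
          (≼-* (x≼σ^x (suc N) b) (moments N m (ℕ.<⇒≤ N+m≤n)))))
        where
        d = σ^ (suc N) b
        u v : ℕ → Carrier
        u i = σ^ i b ^ suc m * P N (σ^ i b)
        v i = σ^ i b ^ m * P N (σ^ i b)
        split : ∑.big p u - d * ∑.big p v ≈ ∑.big p (λ i → σ^ i b ^ m * P (suc N) (σ^ i b))
        split = trans (+-congˡ (trans (-‿distribˡ-* d _) (∑.big-hom (- d *_) (zeroʳ _) (distribˡ _) p v)))
          (trans (sym (∑.big-∙ p u (λ i → - d * v i))) (∑.big-cong p (λ i _ →
            solve 4 (λ x w q c → x :* w :* q :+ :- c :* (w :* q) := w :* (q :* (x :- c))) refl (σ^ i b) (σ^ i b ^ m) (P N (σ^ i b)) d)))
      at-b : ∑.big p (λ i → σ^ i b ^ 0 * P n (σ^ i b)) ≈ P n b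
      at-b = trans (+-cong (*-identityˡ _) (trans (∑.big-cong n {g = λ _ → 0#}
        (λ i i<n → trans (*-identityˡ _) (P-root n i i<n))) (zeros n))) (+-identityʳ _)
        where
        zeros : ∀ m → ∑.big m (λ _ → 0#) ≈ 0#
        zeros zero    = refl
        zeros (suc m) = trans (+-identityˡ _) (zeros m)

    -- Take for `τ` the element `Tr bᵏ / bᵏ` of minimal value among `k ≤ n`; minimality is exactly
    -- the hypothesis of `trace-bound`.
    small-trace : ∃ λ k → Tr (b ^ k) ≼ ε ^ n * b ^ k
    small-trace = case inverse b≉0 of λ { (b⁻¹ , bb⁻¹≈1) → go b⁻¹ bb⁻¹≈1 (minimum (λ k → Tr (b ^ k) * b⁻¹ ^ k) n) }
      where
      go : ∀ b⁻¹ → b * b⁻¹ ≈ 1# →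
        (∃ λ j → j ℕ.≤ n × (∀ k → k ℕ.≤ n → Tr (b ^ j) * b⁻¹ ^ j ≼ Tr (b ^ k) * b⁻¹ ^ k)) →
        ∃ λ k → Tr (b ^ k) ≼ ε ^ n * b ^ k
      go b⁻¹ bb⁻¹≈1 (j , _ , min) = j , ≼-respˡ (cancel j)
        (≼-* (trace-bound (Tr (b ^ j) * b⁻¹ ^ j) (λ k k≤n → ≼-respʳ (cancel k) (≼-* (min k k≤n) ≼-refl))) ≼-refl)
        where
        cancel : ∀ k → Tr (b ^ k) * b⁻¹ ^ k * b ^ k ≈ Tr (b ^ k)
        cancel k = trans (*-assoc _ _ _) (trans (*-congˡ (trans (sym (^-distrib-* b⁻¹ b k))
          (trans (^-congˡ k (trans (*-comm b⁻¹ b) bb⁻¹≈1)) (1^n≈1 k)))) (*-identityʳ _))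

    -- For q = ∏ (1 - ζⁱ σ) bᵏ over 0 < i < p - 1 we have q - ζ⁻¹ σ(q) = T.
    eigenvector : ∀ k → Tr (b ^ k) ≼ ε ^ n * b ^ k → ∃ λ β → s β ≈ ζᴸ * β × z ≼ ε * (1# - β)
    eigenvector k T≼ = case inverse T≉0 of λ { (T⁻¹ , TT⁻¹≈1) → go n ≡.refl T⁻¹ TT⁻¹≈1 }
      where
      T = Tr (b ^ k)
      T≉0 : T ≉ 0#
      T≉0 = ≼-nonzero T≼ (*-nonzero (^-nonzero n ε≉0) (^-nonzero k b≉0))
      go : ∀ n′ → n ≡ n′ → ∀ T⁻¹ → T * T⁻¹ ≈ 1# → ∃ λ β → s β ≈ ζᴸ * β × z ≼ ε * (1# - β)
      go zero    ≡.refl _ _ = contradiction p-prime ¬prime[1]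
      go (suc r) n≡1+r T⁻¹ TT⁻¹≈1 = β , sβ≈ζβ , z≼
        where
        q = Eigen r (b ^ k)
        η = ζᴸ ^ n
        -- `q / T` solves `σ(x) = ζ x - ζ`, whose solution in `K` is `1 / (1 - ζ⁻¹)`. Their
        -- difference is an eigenvector, and scaling by `- (1 - ζ⁻¹)` gives `β`.
        β = 1# - (1# - η) * (q * T⁻¹)
        T≈ : T ≈ q - η * s q
        T≈ = trans (sym (Eigen≈Tr (b ^ k))) (trans (reflexive (≡.cong (λ m → Eigen m (b ^ k)) n≡1+r))
          (+-congˡ (-‿cong (*-congʳ (^-congʳ ζᴸ (≡.sym n≡1+r))))))
        sq≈ : s q ≈ ζᴸ * q - ζᴸ * T
        sq≈ = begin
          s q                            ≈⟨ *-identityˡ _ ⟨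
          1# * s q                       ≈⟨ *-congʳ ζ^p≈1 ⟨
          ζᴸ * η * s q                   ≈⟨ solve 4 (λ z e q t → z :* e :* t := z :* q :- z :* (q :- e :* t)) refl ζᴸ η q (s q) ⟩
          ζᴸ * q - ζᴸ * (q - η * s q)    ≈⟨ +-congˡ (-‿cong (*-congˡ T≈)) ⟨
          ζᴸ * q - ζᴸ * T                ∎
        sT⁻¹≈T⁻¹ : s T⁻¹ ≈ T⁻¹
        sT⁻¹≈T⁻¹ = *-cancelˡ T≉0 (trans (*-congʳ (sym (σ-Tr (b ^ k)))) (trans (τ-inverse σ TT⁻¹≈1) (sym TT⁻¹≈1)))
        sβ≈ζβ : s β ≈ ζᴸ * β
        sβ≈ζβ = begin
          s β
            ≈⟨ trans (τ-sub σ _ _) (+-cong (τ-1 σ) (-‿cong (trans (τ-* σ _ _)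
                 (*-cong (1-fixed (ζ^-fixed n)) (trans (τ-* σ q T⁻¹) (*-cong sq≈ sT⁻¹≈T⁻¹)))))) ⟩
          1# - (1# - η) * ((ζᴸ * q - ζᴸ * T) * T⁻¹)
            ≈⟨ solve 5 (λ z e q t t⁻¹ → :1 :- (:1 :- e) :* ((z :* q :- z :* t) :* t⁻¹)
                 := :1 :- z :* ((:1 :- e) :* (q :* t⁻¹)) :+ (z :- z :* e) :* (t :* t⁻¹)) refl ζᴸ η q T T⁻¹ ⟩
          1# - ζᴸ * ((1# - η) * (q * T⁻¹)) + (ζᴸ - ζᴸ * η) * (T * T⁻¹)
            ≈⟨ +-congˡ (trans (*-congˡ TT⁻¹≈1) (trans (*-identityʳ _) (+-congˡ (-‿cong ζ^p≈1)))) ⟩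
          1# - ζᴸ * ((1# - η) * (q * T⁻¹)) + (ζᴸ - 1#)
            ≈⟨ solve 2 (λ z w → :1 :- z :* w :+ (z :- :1) := z :* (:1 :- w)) refl ζᴸ _ ⟩
          ζᴸ * β  ∎
        -- `q` has gained only `r = n - 1` factors `ε`, one fewer than the bound on `T` allows.
        T≼εq : T ≼ ε * q
        T≼εq = ≼-trans T≼ (≼-trans (≼-respʳ (trans (*-congʳ (^-congʳ ε n≡1+r)) (*-assoc ε _ _)) ≼-refl)
          (≼-* ≼-refl (≼-respˡ (*-identityˡ _) (O-Eigen r (O-^ k) 0))))
        z≼ : z ≼ ε * (1# - β)
        z≼ = ≼-respʳ (solve 4 (λ e x q t → x :* (e :* q :* t) := e :* (:1 :- (:1 :- x :* (q :* t)))) refl ε (1# - η) q T⁻¹)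
          (≼-respˡ (*-identityʳ z) (≼-* (z≼1-ζ^ n) (≼-respˡ TT⁻¹≈1 (≼-* T≼εq ≼-refl))))

    approximation : ∃ λ β → s β ≈ ζᴸ * β × z ≼ ε * (1# - β)
    approximation = case small-trace of λ { (k , T≼) → eigenvector k T≼ }

  -- The operators `1 - ζⁱ σ` for `0 ≤ i < k` applied to `b`; the one with `i = 0` is `Δ`, the
  -- others form `Eigen`.
  chain : Carrier → ℕ → Carrier
  chain b zero    = b
  chain b (suc m) = Eigen m (Δ b)

  chain-suc : ∀ b k → chain b (suc k) ≈ chain b k - ζᴸ ^ k * s (chain b k)
  chain-suc b zero    = +-congˡ (-‿cong (sym (*-identityˡ _)))
  chain-suc b (suc m) = refl

  Tr-Δ : ∀ b → Tr (Δ b) ≈ 0#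
  Tr-Δ b = begin
    Tr (Δ b)                        ≈⟨ solve 2 (λ x y → x := x :+ y :- y) refl _ (Tr (s b)) ⟩
    Tr (Δ b) + Tr (s b) - Tr (s b)  ≈⟨ +-cong sum-Tr (-‿cong Tr-s) ⟩
    Tr b - Tr b                     ≈⟨ -‿inverseʳ _ ⟩
    0#                              ∎
    where
    sum-Tr : Tr (Δ b) + Tr (s b) ≈ Tr b
    sum-Tr = trans (sym (∑.big-∙ p (λ k → σ^ k (Δ b)) (λ k → σ^ k (s b)))) (∑.big-cong p (λ k _ →
      trans (sym (τ-+ (σ ^ᴬ k) _ _)) (τ-cong (σ ^ᴬ k) (solve 2 (λ x y → x :- y :+ y := x) refl b (s b)))))
    Tr-s : Tr (s b) ≈ Tr b
    Tr-s = trans (∑.big-cong p (λ k _ → reflexive (^ᴬ-comm σ k b)))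
      (trans (sym (σ-∑ p (λ k → σ^ k b))) (σ-Tr b))

  -- The `p` operators compose to `1 - σᵖ = 0`, seen here as the trace of `Δ b`.
  chain-≥p : ∀ b k → chain b (k ℕ.+ p) ≈ 0#
  chain-≥p b zero    = trans (Eigen≈Tr (Δ b)) (Tr-Δ b)
  chain-≥p b (suc k) = trans (chain-suc b (k ℕ.+ p))
    (trans (+-cong (chain-≥p b k) (-‿cong (*-congˡ (trans (τ-cong σ (chain-≥p b k)) (τ-0 σ)))))
      (solve 1 (λ x → :0 :- x :* :0 := :0) refl _))

  -- The ratio 0 at `x = 0` has the largest value, so a vanishing member of the chain never
  -- displaces a nonvanishing ratio as the minimum.
  ratio : ∀ x → ∃ λ ρ → Δ x ≈ ρ * x × (x ≈ 0# → ρ ≈ 0#)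
  ratio x with em {P = x ≈ 0#}
  ... | yes x≈0 = 0# , trans (Δ-cong x≈0) (trans (trans (+-congˡ (-‿cong (τ-0 σ))) (-‿inverseʳ 0#))
                    (sym (zeroˡ x))) , λ _ → refl
  ... | no x≉0  = case inverse x≉0 of λ { (x⁻¹ , xx⁻¹≈1) → Δ x * x⁻¹ ,
    sym (trans (*-assoc _ _ _) (trans (*-congˡ (trans (*-comm _ _) xx⁻¹≈1)) (*-identityʳ _))) ,
    λ x≈0 → contradiction x≈0 x≉0 }

  -- The last condition is asked for every `k`, also past the end of the chain, since
  -- `critical-tame` climbs the chain without tracking where it becomes 0.
  Critical : Carrier → ℕ → Carrier → Set _
  Critical b j ε = chain b j ≉ 0# × ε ≉ 0# × Δ (chain b j) ≈ ε * chain b j ×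
    (∀ k → ε * chain b k ≼ Δ (chain b k))

  critical : ∀ b → Δ b ≉ 0# → ∃₂ (Critical b)
  critical b Δb≉0 = go (minimum ρ n)
    where
    ρ : ℕ → Carrier
    ρ k = proj₁ (ratio (chain b k))
    ρ-eq : ∀ k → Δ (chain b k) ≈ ρ k * chain b k
    ρ-eq k = proj₁ (proj₂ (ratio (chain b k)))
    go : (∃ λ j → j ℕ.≤ n × (∀ k → k ℕ.≤ n → ρ j ≼ ρ k)) → ∃₂ (Critical b)
    go (j , _ , min) = j , ρ j , (λ eq → ρj≉0 (proj₂ (proj₂ (ratio (chain b j))) eq)) , ρj≉0 , ρ-eq j , bound
      where
      ρj≉0 : ρ j ≉ 0#
      ρj≉0 = ≼-nonzero (min 0 ℕ.z≤n)
        (λ ρ0≈0 → Δb≉0 (trans (ρ-eq 0) (trans (*-congʳ ρ0≈0) (zeroˡ b))))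
      bound : ∀ k → ρ j * chain b k ≼ Δ (chain b k)
      bound k with k ℕ.≤? n
      ... | yes k≤n = ≼-respʳ (sym (ρ-eq k)) (≼-* (min k k≤n) ≼-refl)
      ... | no k≰n  = ≼-respʳ (sym (trans (Δ-cong (trans (reflexive (≡.cong (chain b)
        (≡.sym (ℕ.m∸n+n≡m (ℕ.≰⇒> k≰n))))) (chain-≥p b (k ℕ.∸ p))))
        (trans (+-congˡ (-‿cong (τ-0 σ))) (-‿inverseʳ 0#)))) ≼-0

  module _ {b : Carrier} {j : ℕ} {ε : Carrier} (crit : Critical b j ε) (ε≼z : ε ≼ z) where
    private
      bⱼ = chain b j
      ε≼Δ = proj₂ (proj₂ (proj₂ crit))

    critical-∈W : ε ∈ W
    critical-∈W = case ≼-sub ≼-refl (x≼σx bⱼ) of λ { (r , r∈ , eq) →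
      W.resp (*-cancelʳ (proj₁ crit) (trans (sym eq) (proj₁ (proj₂ (proj₂ crit))))) r∈ }

    -- Double induction. For `m = 0`, each further operator `(1 - ζᵏ) + ζᵏ Δ` gains `ε` by `ε ≼ z`
    -- and by minimality. For larger `m`, solving for `Δ` trades one `Δ` for a step along the chain,
    -- up to the multiple `1 - ζᵏ` and a unit.
    critical-tame : ∀ m i → ε ^ (m ℕ.+ i) * bⱼ ≼ Δ^ m (chain b (i ℕ.+ j))
    critical-tame zero zero    = ≼-respˡ (sym (*-identityˡ _)) ≼-refl
    critical-tame zero (suc i) = ≼-respʳ
      (sym (trans (chain-suc b (i ℕ.+ j)) (solve 3 (λ x y c → x :- c :* y := (:1 :- c) :* x :+ c :* (x :- y)) refl _ _ (ζᴸ ^ (i ℕ.+ j)))))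
      (≼-respˡ (sym (*-assoc _ _ _)) (≼-+
        (≼-* (≼-trans ε≼z (z≼1-ζ^ (i ℕ.+ j))) (critical-tame 0 i))
        (≼-scale (ζ^∈W (i ℕ.+ j)) (≼-trans (≼-* ≼-refl (critical-tame 0 i)) (ε≼Δ (i ℕ.+ j))))))
    critical-tame (suc m) i = ≼-respʳ (sym (begin
        Δ^ m (Δ x)
          ≈⟨ Δ^-cong m (*-cancelˡ (^-nonzero k ζ≉0) (begin
               ζᴸ ^ k * Δ x
                 ≈⟨ solve 3 (λ x y c → c :* (x :- y) := x :- c :* y :+ :- (:1 :- c) :* x) refl x (s x) (ζᴸ ^ k) ⟩
               x - ζᴸ ^ k * s x + - (1# - ζᴸ ^ k) * x    ≈⟨ +-congʳ (chain-suc b k) ⟨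
               chain b (suc k) + - (1# - ζᴸ ^ k) * x     ≈⟨ *-identityˡ _ ⟨
               1# * (chain b (suc k) + - (1# - ζᴸ ^ k) * x)  ≈⟨ *-congʳ ζᵏζ⁻ᵏ≈1 ⟨
               ζᴸ ^ k * (ζᴸ ^ n) ^ k * (chain b (suc k) + - (1# - ζᴸ ^ k) * x)  ≈⟨ *-assoc _ _ _ ⟩
               ζᴸ ^ k * ((ζᴸ ^ n) ^ k * (chain b (suc k) + - (1# - ζᴸ ^ k) * x))  ∎)) ⟩
        Δ^ m ((ζᴸ ^ n) ^ k * (chain b (suc k) + - (1# - ζᴸ ^ k) * x))
          ≈⟨ Δ^-scale m _ (trans (τ-^ σ _ k) (^-congˡ k (ζ^-fixed n))) ⟩
        (ζᴸ ^ n) ^ k * Δ^ m (chain b (suc k) + - (1# - ζᴸ ^ k) * x)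
          ≈⟨ *-congˡ (trans (Δ^-+ m _ _) (+-congˡ (Δ^-scale m x (trans (τ-neg σ _) (-‿cong (1-fixed (ζ^-fixed k))))))) ⟩
        (ζᴸ ^ n) ^ k * (Δ^ m (chain b (suc k)) + - (1# - ζᴸ ^ k) * Δ^ m x)  ∎))
      (≼-scale (W.^-closed k (ζ^∈W n)) (≼-+
        (≼-respˡ (*-congʳ (^-congʳ ε (ℕ.+-suc m i))) (critical-tame m (suc i)))
        (≼-respˡ (sym (*-assoc _ _ _)) (≼-* (≼-neg (≼-trans ε≼z (z≼1-ζ^ k))) (critical-tame m i)))))
      where
      k = i ℕ.+ j
      x = chain b k
      ζᵏζ⁻ᵏ≈1 : ζᴸ ^ k * (ζᴸ ^ n) ^ k ≈ 1#
      ζᵏζ⁻ᵏ≈1 = trans (sym (^-distrib-* ζᴸ (ζᴸ ^ n) k)) (trans (^-congˡ k ζ^p≈1) (1^n≈1 k))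

    critical-approximation : ∃ λ β → s β ≈ ζᴸ * β × z ≼ ε * (1# - β)
    critical-approximation = Tame.approximation (proj₁ crit) (proj₁ (proj₂ crit)) critical-∈W ε≼z
      (proj₁ (proj₂ (proj₂ crit)))
      (λ m → ≼-respˡ (*-congʳ (^-congʳ ε (ℕ.+-identityʳ m))) (critical-tame m 0))

  -- States `w (z / (1 - β)) ≤ w (x)` without a quotient. `β ≉ 0#` is recorded because only a
  -- nonzero eigenvector generates `L`.
  Approximable : Pred Carrier _
  Approximable x = ∃ λ β → s β ≈ ζᴸ * β × β ≉ 0# × z ≼ x * (1# - β)

  -- The inverse of `α` has eigenvalue `ζ⁻¹`, and its `n`-th power has eigenvalue `ζ⁻ⁿ = ζ`. For `x`
  -- already divisible by `z`, such a `β` suffices, as `1 - β` is in `W`.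
  integral-eigenvector : ∃ λ β → s β ≈ ζᴸ * β × β ≉ 0# × β ∈ W
  integral-eigenvector = case inverse α≉0 of λ { (α⁻¹ , αα⁻¹≈1) →
    [ (λ α∈ → α , σα≈ζα , α≉0 , α∈)
    , (λ α⁻¹∈ → α⁻¹ ^ n , *-cancelˡ (^-nonzero n (τ-nonzero σ α≉0)) (eq αα⁻¹≈1) ,
        ^-nonzero n (unit-nonzeroʳ αα⁻¹≈1) , W.^-closed n α⁻¹∈) ]′ (W-total αα⁻¹≈1) }
    where
    eq : ∀ {α⁻¹} → α * α⁻¹ ≈ 1# → s α ^ n * s (α⁻¹ ^ n) ≈ s α ^ n * (ζᴸ * α⁻¹ ^ n)
    eq {α⁻¹} αα⁻¹≈1 = begin
      s α ^ n * s (α⁻¹ ^ n)       ≈⟨ *-congˡ (τ-^ σ α⁻¹ n) ⟩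
      s α ^ n * s α⁻¹ ^ n         ≈⟨ ^-distrib-* (s α) (s α⁻¹) n ⟨
      (s α * s α⁻¹) ^ n           ≈⟨ trans (^-congˡ n (τ-inverse σ αα⁻¹≈1)) (1^n≈1 n) ⟩
      1#                          ≈⟨ trans (^-congˡ n αα⁻¹≈1) (1^n≈1 n) ⟨
      (α * α⁻¹) ^ n               ≈⟨ ^-distrib-* α α⁻¹ n ⟩
      α ^ n * α⁻¹ ^ n             ≈⟨ *-identityˡ _ ⟨
      1# * (α ^ n * α⁻¹ ^ n)      ≈⟨ *-congʳ ζ^p≈1 ⟨
      ζᴸ ^ p * (α ^ n * α⁻¹ ^ n)
        ≈⟨ solve 4 (λ z w x y → z :* w :* (x :* y) := w :* x :* (z :* y)) refl ζᴸ (ζᴸ ^ n) (α ^ n) (α⁻¹ ^ n) ⟩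
      ζᴸ ^ n * α ^ n * (ζᴸ * α⁻¹ ^ n)   ≈⟨ *-congʳ (trans (^-congˡ n σα≈ζα) (^-distrib-* ζᴸ α n)) ⟨
      s α ^ n * (ζᴸ * α⁻¹ ^ n)    ∎

  z≼⇒Approximable : ∀ {x} → z ≼ x → Approximable x
  z≼⇒Approximable z≼x = case integral-eigenvector of λ { (β , sβ≈ζβ , β≉0 , β∈) →
    β , sβ≈ζβ , β≉0 , ≼-respʳ (*-comm _ _) (≼-scale (W.sub-closed W.1∈ β∈) z≼x) }

  Approximable-0 : ∀ {x} → x ≈ 0# → Approximable x
  Approximable-0 x≈0 = z≼⇒Approximable (≼-respʳ (sym x≈0) ≼-0)

  Approximable-scale : ∀ {r x} → r ∈ W → Approximable x → Approximable (r * x)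
  Approximable-scale r∈ (β , sβ≈ζβ , β≉0 , z≼) =
    β , sβ≈ζβ , β≉0 , ≼-respʳ (sym (*-assoc _ _ _)) (≼-scale r∈ z≼)

  -- Of two eigenvectors, the one closer to 1 serves both summands.
  Approximable-+ : ∀ {x y} → Approximable x → Approximable y → Approximable (x + y)
  Approximable-+ {x} {y} (β , sβ≈ζβ , β≉0 , z≼) (γ , sγ≈ζγ , γ≉0 , z≼′) = case ≼-total (1# - β) (1# - γ) of λ
    { (inj₁ le) → γ , sγ≈ζγ , γ≉0 , ≼-respʳ (sym (distribʳ _ x y)) (≼-+ (≼-trans z≼ (≼-* ≼-refl le)) z≼′)
    ; (inj₂ ge) → β , sβ≈ζβ , β≉0 , ≼-respʳ (sym (distribʳ _ x y)) (≼-+ z≼ (≼-trans z≼′ (≼-* ≼-refl ge)))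
    }

  approximable : ∀ {b b⁻¹} → b * b⁻¹ ≈ 1# → Approximable (s b * b⁻¹ - 1#)
  approximable {b} {b⁻¹} bb⁻¹≈1 with em {P = Δ b ≈ 0#}
  ... | yes Δb≈0 = Approximable-0 (trans (+-congʳ (trans (*-congʳ (sym (x-y≈0⇒x≈y Δb≈0))) bb⁻¹≈1)) (-‿inverseʳ 1#))
  ... | no Δb≉0  = case critical b Δb≉0 of λ { (j , ε , crit) → go {j} crit (≼-total ε z) }
    where
    x = s b * b⁻¹ - 1#
    ε≼x : ∀ {j ε} → Critical b j ε → ε ≼ x
    ε≼x (_ , _ , _ , ε≼Δ) = ≼-respˡ (trans (*-assoc _ _ _) (trans (*-congˡ bb⁻¹≈1) (*-identityʳ _)))
      (≼-respʳ (trans (solve 3 (λ b c y → :- ((b :- y) :* c) := y :* c :- b :* c) refl b b⁻¹ (s b))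
        (+-congˡ (-‿cong bb⁻¹≈1))) (≼-neg (≼-* (ε≼Δ 0) (≼-refl {b⁻¹}))))
    go : ∀ {j ε} → Critical b j ε → ε ≼ z ⊎ z ≼ ε → Approximable x
    go {j} {ε} crit (inj₂ z≼ε) = z≼⇒Approximable (≼-trans z≼ε (ε≼x {j} crit))
    go {j} {ε} crit (inj₁ ε≼z) = case critical-approximation {b} {j} crit ε≼z of λ { (β , sβ≈ζβ , z≼) → finish sβ≈ζβ z≼ }
      where
      finish : ∀ {β} → s β ≈ ζᴸ * β → z ≼ ε * (1# - β) → Approximable x
      finish {β} sβ≈ζβ z≼ with em {P = β ≈ 0#}
      -- The eigenvector equation admits `β = 0`; then `z ≼ ε`, and an integral eigenvector can be
      -- used instead.
      ... | yes β≈0 = z≼⇒Approximable (≼-trans (≼-respʳ (trans (*-congˡ (trans (+-congˡ (trans (-‿cong β≈0) -0#≈0#))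
                        (+-identityʳ 1#))) (*-identityʳ ε)) z≼) (ε≼x {j} crit))
      ... | no β≉0  = β , sβ≈ζβ , β≉0 , ≼-trans z≼ (≼-* (ε≼x {j} crit) ≼-refl)

-- Comparison of the two ideals

module Spans {c ℓ r s t : Level} (K : Field c ℓ) {R : Pred (Field.Carrier K) r} (isSubring : Subring K R)
  {S : Pred (Field.Carrier K) s} {T : Pred (Field.Carrier K) t} where
  open Field K
  open import Algebra.Properties.CommutativeMonoid.Sum +-commutativeMonoid using (sum-cong-≋)

  Span-⊆ : (∀ {x} → x ∈ S → ∃₂ λ a y → a ∈ R × y ∈ T × x ≈ a * y) → Span K R S ⊆ Span K R T
  Span-⊆ f (n , a , x , a∈ , x∈ , eq) =
    n , (λ i → a i * proj₁ (g i)) , (λ i → proj₁ (proj₂ (g i))) ,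
    (λ i → Subring.*-closed isSubring (a∈ i) (proj₁ (proj₂ (proj₂ (g i))))) ,
    (λ i → proj₁ (proj₂ (proj₂ (proj₂ (g i))))) ,
    trans eq (sum-cong-≋ {n} (λ i → trans (*-congˡ (proj₂ (proj₂ (proj₂ (proj₂ (g i)))))) (sym (*-assoc _ _ _))))
    where
    g : ∀ i → ∃₂ λ a y → a ∈ R × y ∈ T × x i ≈ a * y
    g i = f (x∈ i)

module Comparison (em : ∀ {e} → ExcludedMiddle e) {c ℓ a c′ ℓ′ : Level} {K : Field c ℓ}
  (V : ValuationRing K a) (char0 : HasCharacteristic (Field.rawRing K) 0)
  (hensel : ValuationRing.Henselian V) {n : ℕ} (p-prime : Prime (suc n))
  {E : FieldExtension K c′ ℓ′} (D : KummerData E n) where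
  open Kummer em char0 D
  open FieldExtension E
  open Ideals V E
  open ValuationRing V using (A)
  open ValuationRingProperties em V using (A-isSubring; 0ᴬ; 1ᴬ)
  open IntegralClosure em V E
  open Field L
  open FieldProperties L
  open RingSolver commutativeRing
  private
    module A = Subring A-isSubring
    module KS = RingSolver K.commutativeRing

  algebraic : ∀ x → Alg.Int x
  algebraic x = go (L⊆K[α] x)
    where
    module S = Subring Alg.Int-isSubring
    Int-ι : ∀ b → Alg.Int (ι b)
    Int-ι b = Alg.R⊆Int (b , tt , refl)
    Int-α : Alg.Int α
    Int-α = p , Alg.Low-mono (ℕ.s≤s ℕ.z≤n) (Alg.Low-resp (sym α^p≈ιh) (Alg.R⊆Low₁ (h , tt , refl)))
    go : ∀ {x} → K[α] x → Alg.Int x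
    go (term b i x≈)  = S.resp (sym x≈) (S.*-closed (Int-ι b) (S.^-closed i Int-α))
    go (plus d e z≈) = S.resp (sym z≈) (S.+-closed (go d) (go e))

  B⊆Int : B ⊆ Int
  B⊆Int (f , monic , root) = root⇒Int f monic root

  Int-σ : ∀ {x} → Int x → Int (s x)
  Int-σ {x} (m , l) = m , Low-resp (τ-^ σ x m) (go l)
    where
    go : ∀ {m y} → Low x m y → Low (s x) m (s y)
    go (low₀ y≈0) = low₀ (trans (τ-cong σ y≈0) (τ-0 σ))
    go (lowₛ (b , b∈ , ιb≈) ly y≈) = lowₛ (b , b∈ , refl) (go ly)
      (trans (τ-cong σ (trans y≈ (+-congʳ (sym ιb≈)))) (trans (τ-+ σ _ _)
        (+-cong (Automorphism.fixes-K σ b) (τ-* σ x _))))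

  open Approximation em char0 D p-prime Int Int-isSubring
    (λ {x} xy≈1 → Int-total hensel xy≈1 (algebraic x)) Int-σ

  Nm-∈A : ∀ {r} → Int r → ∃ λ b → b ∈ A × ι b ≈ Nm r
  Nm-∈A {r} ir = case fixed-field (σ-Nm r) of λ { (b , ιb≈) →
    b , Int∩K⊆A (Int-resp (sym ιb≈) (Subring.product-closed Int-isSubring p (λ i → W-σ^ (toℕ i) ir))) , ιb≈ }

  -- If `ωᵐ = 1` with `0 < m < p`, raising to an inverse of `m` modulo the prime `p` gives `ω = 1`.
  root-primitive : ∀ {ω} → ω K.^ p K.≈ K.1# → ω K.≉ K.1# → IsPrimitiveRoot K p ω
  root-primitive {ω} ω^p≈1 ω≉1 = ω^p≈1 , λ m 0<m m<p ω^m≈1 →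
    case prime-inverse p-prime m 0<m m<p of λ { (j , k , k′ , eq) → ω≉1 (begin
      ω                                       ≈⟨ K.*-identityʳ ω ⟨
      ω K.* K.1#                              ≈⟨ K.*-congˡ (power k ω^p≈1) ⟨
      ω K.* ω K.^ (k ℕ.* p)                   ≡⟨ ≡.cong (ω K.^_) eq ⟨
      ω K.^ (j ℕ.* m ℕ.+ k′ ℕ.* p)            ≈⟨ KP.^-homo-* ω (j ℕ.* m) (k′ ℕ.* p) ⟩
      ω K.^ (j ℕ.* m) K.* ω K.^ (k′ ℕ.* p)    ≈⟨ K.*-cong (power j ω^m≈1) (power k′ ω^p≈1) ⟩
      K.1# K.* K.1#                           ≈⟨ K.*-identityˡ _ ⟩
      K.1#                                    ∎) }
    where
    open import Relation.Binary.Reasoning.Setoid K.setoid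
    power : ∀ j {m} → ω K.^ m K.≈ K.1# → ω K.^ (j ℕ.* m) K.≈ K.1#
    power j {m} ω^m≈1 = K.trans (KP.^-congʳ ω (ℕ.*-comm j m)) (K.trans (K.sym (KP.^-assocʳ ω m j))
      (K.trans (KP.^-congˡ j ω^m≈1) (KP.1^n≈1 j)))

  ζᴸ≉1 : ζᴸ ≉ 1#
  ζᴸ≉1 ζᴸ≈1 = proj₂ ζ-primitive 1 ℕ.z<s (ℕ.nonTrivial⇒n>1 p {{prime⇒nonTrivial p-prime}})
    (K.trans (K.*-identityʳ ζ) (ι-injective (trans ζᴸ≈1 (sym ι-1))))

  Generator : Pred K.Carrier _
  Generator x = ∃₂ λ h d → h ∈ 𝔄 p × ((h K.- K.1#) K.* d K.≈ K.1#) × (x K.≈ (ζ K.- K.1#) K.^ p K.* d)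

  NormValue : Pred K.Carrier _
  NormValue y = ∃ λ x → x ∈ 𝓙 σ × Norm x y

  𝓙⊆Approximable : 𝓙 σ ⊆ Approximable
  𝓙⊆Approximable (m , r , x , r∈ , x∈ , eq) = Approximable-resp (sym eq) (sum-approximable m (λ i → scaled (r∈ i) (x∈ i)))
    where
    Approximable-resp : ∀ {x y} → x ≈ y → Approximable x → Approximable y
    Approximable-resp eq (β , sβ≈ζβ , β≉0 , z≼) = β , sβ≈ζβ , β≉0 , ≼-respʳ (*-congʳ eq) z≼
    scaled : ∀ {r x} → r ∈ B → (∃₂ λ b b⁻¹ → (b * b⁻¹ ≈ 1#) × (x ≈ s b * b⁻¹ - 1#)) → Approximable (r * x)
    scaled r∈ (b , b⁻¹ , bb⁻¹≈1 , x≈) = Approximable-scale (B⊆Int r∈) (Approximable-resp (sym x≈) (approximable bb⁻¹≈1))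
    sum-approximable : ∀ m {f : Fin m → Carrier} → (∀ i → Approximable (f i)) → Approximable (sum f)
    sum-approximable zero    f∈ = Approximable-0 refl
    sum-approximable (suc m) f∈ = Approximable-+ (f∈ Fin.zero) (sum-approximable m (λ i → f∈ (Fin.suc i)))

  eigenvector≉1 : ∀ {β} → s β ≈ ζᴸ * β → 1# - β ≉ 0#
  eigenvector≉1 {β} sβ≈ζβ 1-β≈0 = ζᴸ≉1 (begin
    ζᴸ        ≈⟨ *-identityʳ ζᴸ ⟨
    ζᴸ * 1#   ≈⟨ *-congˡ 1≈β ⟩
    ζᴸ * β    ≈⟨ sβ≈ζβ ⟨
    s β       ≈⟨ τ-cong σ 1≈β ⟨
    s 1#      ≈⟨ τ-1 σ ⟩
    1#        ∎)
    where
    open import Relation.Binary.Reasoning.Setoid setoid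
    1≈β = x-y≈0⇒x≈y 1-β≈0

  -- Taking norms in `x (1 - β) = r (1 - ζ)` gives `y (1 - h′) = N(r) (1 - ζ)ᵖ` with `h′ = βᵖ`, and
  -- `N(r)` lies in `A` because `A` is integrally closed.
  Approximable⇒Generator : ∀ {x y} → Approximable x → ι y ≈ Nm x →
    ∃₂ λ b t → b ∈ A × t ∈ Generator × y K.≈ b K.* t
  Approximable⇒Generator {x} {y} (β , sβ≈ζβ , β≉0 , r , r∈ , eq) ιy≈ =
    case eigenvector-^p sβ≈ζβ of λ { (h′ , ιh′≈) →
    case Nm-∈A r∈ of λ { (b , b∈ , ιb≈) →
    case K.inverse (h′≉1 ιh′≈) of λ { (d , d-inverse) →
      -- The outer sign comes from passing to `h′ - 1`, the factor `(-1)ᵖ` from passing to `ζ - 1`;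
      -- keeping the power covers `p = 2` as well.
      K.- (b K.* (K.- K.1#) K.^ p) , (ζ K.- K.1#) K.^ p K.* d ,
      A.neg-closed (A.*-closed b∈ (A.^-closed p (A.neg-closed A.1∈))) ,
      (h′ , d , eigenvector-generates β≉0 sβ≈ζβ (sym ιh′≈) , d-inverse , K.refl) ,
      quotient ιh′≈ ιb≈ d-inverse } } }
    where
    Nm-1-β : Nm (1# - β) ≈ 1# - β ^ p
    Nm-1-β = Nm-eigenvector ζ-primitive sβ≈ζβ
    h′≉1 : ∀ {h′} → ι h′ ≈ β ^ p → h′ K.- K.1# K.≉ K.0#
    h′≉1 {h′} ιh′≈ h′-1≈0 = Nm-nonzero (eigenvector≉1 sβ≈ζβ) (trans Nm-1-β
      (x≈y⇒x-y≈0 (trans (sym ι-1) (trans (ι-cong (K.sym (KP.x-y≈0⇒x≈y h′-1≈0))) ιh′≈))))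
    product-formula : ∀ {h′ b} → ι h′ ≈ β ^ p → ι b ≈ Nm r →
      y K.* (K.1# K.- h′) K.≈ b K.* (K.1# K.- ζ) K.^ p
    product-formula {h′} {b} ιh′≈ ιb≈ = ι-injective (begin
      ι (y K.* (K.1# K.- h′))       ≈⟨ trans (ι-* _ _) (*-cong ιy≈ (trans (ι-sub _ _) (+-cong ι-1 (-‿cong ιh′≈)))) ⟩
      Nm x * (1# - β ^ p)           ≈⟨ *-congˡ Nm-1-β ⟨
      Nm x * Nm (1# - β)            ≈⟨ Nm-* x (1# - β) ⟨
      Nm (x * (1# - β))             ≈⟨ Nm-cong (trans eq (*-congˡ (sym (trans (ι-sub _ _) (+-congʳ ι-1))))) ⟩
      Nm (r * ι (K.1# K.- ζ))       ≈⟨ trans (Nm-* r _) (*-cong (sym ιb≈) (Nm-ι _)) ⟩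
      ι b * ι ((K.1# K.- ζ) K.^ p)  ≈⟨ ι-* _ _ ⟨
      ι (b K.* (K.1# K.- ζ) K.^ p)  ∎)
      where open import Relation.Binary.Reasoning.Setoid setoid
    quotient : ∀ {h′ b d} → ι h′ ≈ β ^ p → ι b ≈ Nm r → (h′ K.- K.1#) K.* d K.≈ K.1# →
      y K.≈ K.- (b K.* (K.- K.1#) K.^ p) K.* ((ζ K.- K.1#) K.^ p K.* d)
    quotient {h′} {b} {d} ιh′≈ ιb≈ d-inverse = begin
      y                                              ≈⟨ K.*-identityʳ y ⟨
      y K.* K.1#                                     ≈⟨ K.*-congˡ d-inverse ⟨
      y K.* ((h′ K.- K.1#) K.* d)
        ≈⟨ KS.solve 3 (λ y h d → y KS.:* ((h KS.:- KS.:1) KS.:* d) KS.:= KS.:- (y KS.:* (KS.:1 KS.:- h)) KS.:* d) K.refl y h′ d ⟩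
      K.- (y K.* (K.1# K.- h′)) K.* d
        ≈⟨ K.*-congʳ (K.-‿cong (K.trans (product-formula ιh′≈ ιb≈) (K.*-congˡ (K.trans
             (KP.^-congˡ p (KS.solve 1 (λ z → KS.:1 KS.:- z KS.:= KS.:- KS.:1 KS.:* (z KS.:- KS.:1)) K.refl ζ))
             (KP.^-distrib-* _ _ p))))) ⟩
      K.- (b K.* ((K.- K.1#) K.^ p K.* (ζ K.- K.1#) K.^ p)) K.* d
        ≈⟨ KS.solve 4 (λ b e w d → KS.:- (b KS.:* (e KS.:* w)) KS.:* d KS.:= KS.:- (b KS.:* e) KS.:* (w KS.:* d)) K.refl b _ _ d ⟩
      K.- (b K.* (K.- K.1#) K.^ p) K.* ((ζ K.- K.1#) K.^ p K.* d)  ∎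
      where open import Relation.Binary.Reasoning.Setoid K.setoid

  𝓝⊆𝓗 : 𝓝 σ ⊆ 𝓗 p ζ
  𝓝⊆𝓗 = Spans.Span-⊆ K A-isSubring {S = NormValue} {T = Generator} λ { (x , x∈𝓙 , norm) →
    Approximable⇒Generator (𝓙⊆Approximable x∈𝓙) (Norm⇒Nm norm) }

  module _ (nontrivial : NonTrivial) where

    -- If every root of `Xᵖ = h′` in `L` came from `K`, the field they generate would be `K`,
    -- against non-triviality.
    generating-root : ∀ {h′} → h′ ∈ 𝔄 p → ∃ λ β → β ^ p ≈ ι h′ × ¬ (∃ λ b → ι b ≈ β)
    generating-root {h′} h′∈𝔄 with em {P = ∃ λ β → β ^ p ≈ ι h′ × ¬ (∃ λ b → ι b ≈ β)}
    ... | yes root = root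
    ... | no ¬root = contradiction (λ x → go (h′∈𝔄 x)) nontrivial
      where
      go : ∀ {x} → x ∈ K⟨ (λ x → x ^ p ≈ ι h′) ⟩ → ∃ λ b → ι b ≈ x
      go (base b) = b , refl
      go {x} (gen x^p≈) with em {P = ∃ λ b → ι b ≈ x}
      ... | yes x∈K = x∈K
      ... | no x∉K  = contradiction (x , x^p≈ , x∉K) ¬root
      go (resp x≈y d) = case go d of λ { (b , ιb≈) → b , trans ιb≈ x≈y }
      go (add d e) = case go d of λ { (b , ιb≈) → case go e of λ { (b′ , ιb′≈) →
        b K.+ b′ , trans (ι-+ b b′) (+-cong ιb≈ ιb′≈) } }
      go (mul d e) = case go d of λ { (b , ιb≈) → case go e of λ { (b′ , ιb′≈) →
        b K.* b′ , trans (ι-* b b′) (*-cong ιb≈ ιb′≈) } }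
      go (neg d) = case go d of λ { (b , ιb≈) → K.- b , trans (ι-neg b) (-‿cong ιb≈) }
      go (inv xy≈1 d) = case go d of λ { (b , ιb≈) →
        case K.inverse (λ b≈0 → unit-nonzeroˡ xy≈1 (trans (sym ιb≈) (trans (ι-cong b≈0) ι-0))) of λ { (b′ , bb′≈1) →
          b′ , *-cancelˡ (unit-nonzeroˡ xy≈1) (trans (*-congʳ (sym ιb≈)) (trans (ι-inverse bb′≈1) (sym xy≈1))) } }

    1∈B : 1# ∈ B
    1∈B = (K.- K.1# , A.neg-closed A.1∈) ∷ 1ᴬ ∷ [] , (1 , K.refl , λ { (suc (suc _)) _ → K.refl ; (suc zero) (ℕ.s≤s ()) }) ,
      trans (+-cong (trans (ι-neg K.1#) (-‿cong ι-1)) (*-congˡ (+-congʳ ι-1)))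
        (solve 0 (:- :1 :+ :1 :* (:1 :+ :1 :* :0) := :0) refl)

    -- The eigenvalue `ω` of `β` is some nontrivial `p`-th root of unity depending on `h′`, so the
    -- computation yields `ω⁻¹ - 1` first; `ζ-1` then converts it.
    module Root {h′ d : K.Carrier} (d-inverse : (h′ K.- K.1#) K.* d K.≈ K.1#) {β : Carrier} (β^p≈ : β ^ p ≈ ι h′)
      (β∉K : ¬ (∃ λ b → ι b ≈ β)) {ω : K.Carrier} (ω^p≈1 : ω K.^ p K.≈ K.1#) (sβ≈ωβ : s β ≈ ι ω * β)
      {γ e : Carrier} (βγ≈1 : β * γ ≈ 1#) ([1-β]e≈1 : (1# - β) * e ≈ 1#) where
      open import Relation.Binary.Reasoning.Setoid setoid

      ω⁻¹ = ω K.^ n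

      ω≉1 : ω K.≉ K.1#
      ω≉1 ω≈1 = β∉K (fixed-field (trans sβ≈ωβ (trans (*-congʳ (trans (ι-cong ω≈1) ι-1)) (*-identityˡ β))))

      ω⁻¹-primitive : IsPrimitiveRoot K p ω⁻¹
      ω⁻¹-primitive = root-primitive
        (K.trans (KP.^-assocʳ ω n p) (K.trans (KP.^-congʳ ω (ℕ.*-comm n p)) (K.trans (K.sym (KP.^-assocʳ ω p n))
          (K.trans (KP.^-congˡ n ω^p≈1) (KP.1^n≈1 n)))))
        (λ ω⁻¹≈1 → ω≉1 (K.trans (K.sym (K.*-identityʳ ω)) (K.trans (K.*-congˡ (K.sym ω⁻¹≈1)) ω^p≈1)))

      b b⁻¹ j : Carrier
      b   = γ * (1# - β)
      b⁻¹ = β * e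
      j   = s b * b⁻¹ - 1#

      bb⁻¹≈1 : b * b⁻¹ ≈ 1#
      bb⁻¹≈1 = trans (solve 4 (λ γ x β e → γ :* x :* (β :* e) := β :* γ :* (x :* e)) refl γ (1# - β) β e)
        (trans (*-cong βγ≈1 [1-β]e≈1) (*-identityˡ 1#))

      j∈𝓙 : j ∈ 𝓙 σ
      j∈𝓙 = 1 , (λ _ → 1#) , (λ _ → j) , (λ _ → 1∈B) , (λ _ → b , b⁻¹ , bb⁻¹≈1 , refl) ,
        sym (trans (+-identityʳ _) (*-identityˡ j))

      sγβ≈ω⁻¹ : s γ * β ≈ ι ω⁻¹
      sγβ≈ω⁻¹ = *-cancelˡ (unit-nonzeroˡ (ι-inverse ω^p≈1)) (begin
        ι ω * (s γ * β)   ≈⟨ solve 3 (λ w g b → w :* (g :* b) := w :* b :* g) refl _ (s γ) β ⟩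
        ι ω * β * s γ     ≈⟨ *-congʳ sβ≈ωβ ⟨
        s β * s γ         ≈⟨ τ-inverse σ βγ≈1 ⟩
        1#                ≈⟨ ι-inverse ω^p≈1 ⟨
        ι ω * ι ω⁻¹       ∎)

      -- With `b = β⁻¹ - 1` one has `σ(b) - b = (ω⁻¹ - 1) β⁻¹`, and dividing by `b` leaves
      -- `(ω⁻¹ - 1) / (1 - β)`.
      j[1-β] : j * (1# - β) ≈ ι (ω⁻¹ K.- K.1#)
      j[1-β] = begin
        (s b * (β * e) - 1#) * (1# - β)
          ≈⟨ *-congʳ (+-congʳ (*-congʳ (trans (τ-* σ _ _) (*-congˡ (trans (τ-sub σ 1# β) (+-congʳ (τ-1 σ))))))) ⟩
        (s γ * (1# - s β) * (β * e) - 1#) * (1# - β)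
          ≈⟨ solve 4 (λ g t β e → (g :* (:1 :- t) :* (β :* e) :- :1) :* (:1 :- β)
               := (g :* β :- t :* g :* β) :* ((:1 :- β) :* e) :- (:1 :- β)) refl (s γ) (s β) β e ⟩
        (s γ * β - s β * s γ * β) * ((1# - β) * e) - (1# - β)
          ≈⟨ +-congʳ (*-cong (+-cong sγβ≈ω⁻¹ (-‿cong (*-congʳ (τ-inverse σ βγ≈1)))) [1-β]e≈1) ⟩
        (ι ω⁻¹ - 1# * β) * 1# - (1# - β)
          ≈⟨ solve 2 (λ w β → (w :- :1 :* β) :* :1 :- (:1 :- β) := w :- :1) refl (ι ω⁻¹) β ⟩
        ι ω⁻¹ - 1#                ≈⟨ trans (ι-sub _ _) (+-congˡ (-‿cong ι-1)) ⟨
        ι (ω⁻¹ K.- K.1#)          ∎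

      y : K.Carrier
      y = K.- ((ω⁻¹ K.- K.1#) K.^ p K.* d)

      1-h′≉0 : 1# - β ^ p ≉ 0#
      1-h′≉0 eq = KP.unit-nonzeroˡ d-inverse (KP.x≈y⇒x-y≈0 (ι-injective
        (trans (sym β^p≈) (trans (sym (x-y≈0⇒x≈y eq)) (sym ι-1)))))

      ιy≈Nm-j : ι y ≈ Nm j
      ιy≈Nm-j = *-cancelʳ 1-h′≉0 (begin
        ι y * (1# - β ^ p)               ≈⟨ *-congˡ (trans (ι-sub _ _) (+-cong ι-1 (-‿cong (sym β^p≈)))) ⟨
        ι y * ι (K.1# K.- h′)            ≈⟨ ι-* _ _ ⟨
        ι (y K.* (K.1# K.- h′))
          ≈⟨ ι-cong (K.trans (KS.solve 3 (λ w d h → KS.:- (w KS.:* d) KS.:* (KS.:1 KS.:- h) KS.:= w KS.:* ((h KS.:- KS.:1) KS.:* d)) K.refl _ d h′)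
               (K.trans (K.*-congˡ d-inverse) (K.*-identityʳ _))) ⟩
        ι ((ω⁻¹ K.- K.1#) K.^ p)         ≈⟨ Nm-ι _ ⟨
        Nm (ι (ω⁻¹ K.- K.1#))            ≈⟨ Nm-cong j[1-β] ⟨
        Nm (j * (1# - β))                ≈⟨ Nm-* j (1# - β) ⟩
        Nm j * Nm (1# - β)               ≈⟨ *-congˡ (Nm-eigenvector (root-primitive ω^p≈1 ω≉1) sβ≈ωβ) ⟩
        Nm j * (1# - β ^ p)              ∎)

      ω⁻¹∈A : ω⁻¹ ∈ A
      ω⁻¹∈A = Int∩K⊆A (W-root-of-unity (trans (sym (ι-^ ω⁻¹ p)) (trans (ι-cong (proj₁ ω⁻¹-primitive)) ι-1)))

      private module Cyc = Cyclotomic em K n ω⁻¹ ω⁻¹-primitive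

      -- `ω⁻¹` is primitive too, so `ζ` is a power of it, and the quotient is a geometric sum of
      -- powers of `ω⁻¹`, all in `A`.
      ζ-1 : ∃ λ q → q ∈ A × ζ K.- K.1# K.≈ q K.* (ω⁻¹ K.- K.1#)
      ζ-1 = case Cyc.root-of-unity {ζ} (proj₁ ζ-primitive) of λ { (m , _ , ζ≈) → from m ζ≈ }
        where
        divide-out : ∀ {x w q} → ζ K.≈ x → (K.1# K.- w) K.* q K.≈ K.1# K.- x → ζ K.- K.1# K.≈ q K.* (w K.- K.1#)
        divide-out {x} {w} {q} ζ≈x eq = K.trans (K.+-congʳ ζ≈x)
          (K.trans (KS.solve 1 (λ x → x KS.:- KS.:1 KS.:= KS.:- (KS.:1 KS.:- x)) K.refl x)
          (K.trans (K.-‿cong (K.sym eq))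
            (KS.solve 2 (λ w q → KS.:- ((KS.:1 KS.:- w) KS.:* q) KS.:= q KS.:* (w KS.:- KS.:1)) K.refl w q)))
        from : ∀ m → ζ K.≈ ω⁻¹ K.^ m → ∃ λ q → q ∈ A × ζ K.- K.1# K.≈ q K.* (ω⁻¹ K.- K.1#)
        from m ζ≈ = q , A.sum-closed m {λ i → ω⁻¹ K.^ toℕ i} (λ i → A.^-closed (toℕ i) ω⁻¹∈A) ,
            divide-out {w = ω⁻¹} ζ≈ (Cyc.geometric ω⁻¹ m)
          where
          q : K.Carrier
          q = Cyc.∑.big m (ω⁻¹ K.^_)

      factor : ∀ {x} → x K.≈ (ζ K.- K.1#) K.^ p K.* d → ∃₂ λ q y → q ∈ A × y ∈ NormValue × x K.≈ q K.* y
      factor {x} x≈ = case ζ-1 of λ { (q , q∈ , ζ-1≈) →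
        K.- q K.^ p , y , A.neg-closed (A.^-closed p q∈) , (j , j∈𝓙 , Nm⇒Norm ιy≈Nm-j) ,
        K.trans x≈ (K.trans (K.*-congʳ (K.trans (KP.^-congˡ p ζ-1≈) (KP.^-distrib-* q _ p)))
          (KS.solve 3 (λ q w d → q KS.:* w KS.:* d KS.:= KS.:- q KS.:* (KS.:- (w KS.:* d))) K.refl (q K.^ p) _ d)) }

    𝓗⊆𝓝 : 𝓗 p ζ ⊆ 𝓝 σ
    𝓗⊆𝓝 = Spans.Span-⊆ K A-isSubring {S = Generator} {T = NormValue} generator
      where
      generator : ∀ {x} → x ∈ Generator → ∃₂ λ q y → q ∈ A × y ∈ NormValue × x K.≈ q K.* y
      generator (h′ , d , h′∈𝔄 , d-inverse , x≈) = case generating-root h′∈𝔄 of λ { (β , β^p≈ , β∉K) →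
        case inverse (λ β≈0 → β∉K (K.0# , trans ι-0 (sym β≈0))) of λ { (γ , βγ≈1) →
        case inverse (λ 1-β≈0 → β∉K (K.1# , trans ι-1 (x-y≈0⇒x≈y 1-β≈0))) of λ { (e , [1-β]e≈1) →
        case conjugate-root σ (unit-nonzeroˡ βγ≈1) β^p≈ of λ { (k , _ , sβ≈) →
          Root.factor d-inverse β^p≈ β∉K {ω = ζ K.^ k}
            (K.trans (KP.^-assocʳ ζ k p) (K.trans (KP.^-congʳ ζ (ℕ.*-comm k p)) (K.trans (K.sym (KP.^-assocʳ ζ p k))
              (K.trans (KP.^-congˡ k (proj₁ ζ-primitive)) (KP.1^n≈1 k)))))
            (trans sβ≈ (*-congʳ (sym (ι-^ ζ k)))) βγ≈1 [1-β]e≈1 x≈ } } } }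

theorem1p3 : (∀ {e} → ExcludedMiddle e) →
    ∀ {c ℓ a c′ ℓ′} (K : Field c ℓ) (V : ValuationRing K a) (p : ℕ) →
    let module K = Field K in
    HasCharacteristic K.rawRing 0 →
    ValuationRing.Henselian V →
    0 ℕ.< p → HasCharacteristic (ValuationRing.residueField V) p →
    (ζ : K.Carrier) → IsPrimitiveRoot K p ζ →
    (E : FieldExtension K c′ ℓ′) →
    let open FieldExtension E
        module L = Field L
        open Ideals V E
    in
    (α : L.Carrier) (h : K.Carrier) →
    ¬ (h K.≈ K.0#) → α L.^ p L.≈ ι h →
    Generates (λ x → x L.≈ α) → NonTrivial →
    (σ : Automorphism) → ⟦ σ ⟧ α L.≈ ι ζ L.* α →
    𝓗 p ζ ≐ 𝓝 σ
theorem1p3 em K V (suc n) char0 hensel 0<p char ζ ζ-primitive E α h h≉0 α^p≈ιh generated nontrivial σ σα≈ζα =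
  𝓗⊆𝓝 nontrivial , 𝓝⊆𝓗
  where
  kummerData : KummerData E n
  kummerData = record
    { ζ = ζ ; ζ-primitive = ζ-primitive ; α = α ; h = h ; h≉0 = h≉0
    ; α^p≈ιh = α^p≈ιh ; generated = generated ; σ = σ ; σα≈ζα = σα≈ζα }
  open Comparison em V char0 hensel
    (ValuationRingProperties.residue-characteristic-prime em V 0<p char) kummerData
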